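{- Let $A$ and $B$ be skew shapes. If $s_A = s_B$, or $\mathrm{supp}_s(A)=\mathrm{supp}_s(B)$, or $\mathrm{supp}_F(A)=\mathrm{supp}_F(B)$, then the following three equivalent conditions are true: (1) $\mathrm{rows}_k(A) = \mathrm{rows}_k(B)$ for all $k\ge 1$; (2) $\mathrm{cols}_\ell(A) = \mathrm{cols}_\ell(B)$ for all $\ell\ge 1$; (3) $\mathrm{rects}_{k,\ell}(A) = \mathrm{rects}_{k,\ell}(B)$ for all $k,\ell\ge 1$.
   Context: A composition of $n$ is a sequence of positive integers with sum $n$; a partition is a weakly decreasing composition. Compositions $\alpha=(\alpha_1,\dots,\alpha_k)$ of $n$ correspond bijectively to subsets of $[n-1]=\{1,\dots,n-1\}$ via $S(\alpha)=\{\alpha_1,\alpha_1+\alpha_2,\dots,\alpha_1+\cdots+\alpha_{k-1}\}$. Young diagrams are left-justified with row $1$ at the top; a skew shape $\lambda/\mu$ is the Young diagram of $\lambda$ with the boxes of $\mu\subseteq\lambda$ removed from its top-left. A standard Young tableau (SYT) of a skew shape $A$ with $n$ boxes is a filling of the boxes by $1,\dots,n$, each used once, increasing left to right along rows and down columns. Its descent set is the set of $i$ such that $i+1$ appears in a strictly lower row than $i$, and its descent composition is the composition of $n$ corresponding to its descent set. The monomial quasisymmetric functions are $M_\alpha=\sum_{i_1<\cdots<i_k}x_{i_1}^{\alpha_1}\cdots x_{i_k}^{\alpha_k}$, and the fundamental quasisymmetric functions are $F_\alpha=\sum_{S(\alpha)\subseteq S(\beta)\subseteq[n-1]}M_\beta$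 for $\alpha$ of size $n$. The skew Schur function is $s_A=\sum_T F_{\mathrm{comp}(T)}$, the sum being over all SYT $T$ of shape $A$, where $\mathrm{comp}(T)$ is the descent composition of $T$; it is a symmetric function, and the Schur functions are $s_\lambda=s_{\lambda/\emptyset}$. The $F$-support $\mathrm{supp}_F(A)$ is the set of compositions $\alpha$ such that $F_\alpha$ has positive coefficient in $s_A$. The Schur support $\mathrm{supp}_s(A)$ is the set of partitions $\lambda$ such that $s_\lambda$ has nonzero coefficient in the expansion of $s_A$ in the basis of Schur functions. For a skew shape $A$ with $r$ rows and $1\le i\le r-k+1$, let $\mathrm{overlap}_k(i)$ be the number of columns occupied in common by rows $i,i+1,\dots,i+k-1$; $\mathrm{rows}_k(A)$ is the partition obtained by sorting $(\mathrm{overlap}_k(1),\dots,\mathrm{overlap}_k(r-k+1))$ into weakly decreasing order and omitting zeros (so it is the empty partition if there are no nonzero overlaps). $\mathrm{cols}_\ell(A)$ is defined in the same way with the roles of rows and columns exchanged. $\mathrm{rects}_{k,\ell}(A)$ is the number of $k\times\ell$ rectangular subdiagrams ($k$ rows, $\ell$ columns, consecutive) contained in $A$. -}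

module Defs where

open import Data.Bool using (true; false; if_then_else_)
open import Data.Fin as Fin using (Fin; toℕ)
import Data.Fin.Properties as Fin
open import Data.Integer as ℤ using (ℤ; 0ℤ; 1ℤ)
open import Data.List as List
  using (List; []; _∷_; length; map; filter; foldr; upTo; allFin; concatMap; cartesianProduct; cartesianProductWith)
open import Data.List.Membership.Propositional using (_∈_)
import Data.List.Properties as List
open import Data.List.Relation.Binary.Subset.Propositional using (_⊆_)
open import Data.List.Relation.Binary.Subset.DecPropositional using (_⊆?_)
open import Data.List.Relation.Unary.All as All using (All; []; _∷_)
import Data.List.Relation.Unary.All.Properties as All
open import Data.List.Relation.Unary.Linked using (Linked; [])
import Data.List.Relation.Unary.Linked.Properties as Linked
open import Data.List.Relation.Unary.Unique.Propositional using (Unique)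
open import Data.List.Sort using (sort; sort-↗)
open import Data.Nat using (ℕ; zero; suc; _+_; _∸_; _≤_; _≥_; _<_; z≤n; NonZero)
open import Data.Nat.ListAction using (sum)
open import Data.Nat.Properties
  using (_≟_; _≤?_; _<?_; nonZero?; allUpTo?; ≤-trans; ≤-decTotalOrder)
open import Data.Product using (Σ-syntax; ∃-syntax; _×_; _,_; proj₁; proj₂)
open import Data.Vec as Vec using (Vec; []; _∷_)
open import Function using (_∘_; flip)
open import Relation.Binary.PropositionalEquality
  using (_≡_; _≢_; _≗_; refl; sym; trans; cong)
open import Relation.Binary.Properties.DecTotalOrder ≤-decTotalOrder using (≥-decTotalOrder)
open import Relation.Nullary using (Dec; does; _×-dec_; _→-dec_)
open import Relation.Unary using (Pred; Decidable)
open import Level using (0ℓ)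

------------------------------------------------------------------------
-- Compositions and partitions

record Composition : Set where
  constructor mkComposition
  field
    parts     : List ℕ
    .positive : All NonZero parts

open Composition public using (parts)

record Partition : Set where
  constructor mkPartition
  field
    composition : Composition
    .decreasing : Linked _≥_ (parts composition)

open Partition public using (composition)

∣_∣ : Composition → ℕ
∣ α ∣ = sum (parts α)

partialSums : List ℕ → List ℕ
partialSums []           = []
partialSums (_ ∷ [])     = []
partialSums (a ∷ b ∷ as) = a ∷ map (a +_) (partialSums (b ∷ as))

S : Composition → List ℕ
S α = partialSums (parts α)

-- The two ways of enlarging a composition of n to one of n + 1 at its
-- front: a new part 1, or the first part increased by one.

newPart : Composition → Composition
newPart (mkComposition as ps) = mkComposition (1 ∷ as) (_ ∷ ps)

growPart : Composition → Composition
growPart (mkComposition []       _)        = mkComposition (1 ∷ []) (_ ∷ [])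
growPart (mkComposition (a ∷ as) ps)       = mkComposition (suc a ∷ as) (_ ∷ All.tail ps)

-- All compositions of n, each listed once.
compositions : ℕ → List Composition
compositions 0             = mkComposition [] [] ∷ []
compositions 1             = mkComposition (1 ∷ []) (_ ∷ []) ∷ []
compositions (suc (suc n)) =
  concatMap (λ α → newPart α ∷ growPart α ∷ []) (compositions (suc n))

-- 1, …, n - 1
[1⋯_-1] : ℕ → List ℕ
[1⋯ n -1] = map suc (upTo (n ∸ 1))

-- The inverse of S: the composition of n corresponding to the set of those
-- i in [n - 1] with D i (see S-fromSet).  The value at 1 ∈ D decides whether
-- the first unit is a part by itself.
fromSet : (n : ℕ) {D : Pred ℕ 0ℓ} → Decidable D → Composition
fromSet 0             D? = mkComposition [] []
fromSet 1             D? = mkComposition (1 ∷ []) (_ ∷ [])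
fromSet (suc (suc n)) D? =
  (if does (D? 1) then newPart else growPart) (fromSet (suc n) (D? ∘ suc))

------------------------------------------------------------------------
-- Formal power series in x₁, x₂, … with integer coefficients

-- The exponent list e₁ ∷ … ∷ eₘ ∷ [] stands for x₁^e₁ ⋯ xₘ^eₘ; lists that
-- differ by trailing zeros stand for the same monomial.
Monomial : Set
Monomial = List ℕ

-- A series is given by its coefficients.
Series : Set
Series = Monomial → ℤ

infixr 8 _·_
_·_ : ℤ → Series → Series
(c · f) e = c ℤ.* f e

∑ : {I : Set} → List I → (I → Series) → Series
∑ is f e = foldr ℤ._+_ 0ℤ (map (λ i → f i e) is)

-- A monomial is x_{i₁}^α₁ ⋯ x_{iₖ}^αₖ for some i₁ < ⋯ < iₖ exactly when its
-- nonzero exponents, read in order, are α₁, …, αₖ; the indices are then unique.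
M : Composition → Series
M α e = if does (List.≡-dec _≟_ (filter nonZero? e) (parts α)) then 1ℤ else 0ℤ

F : Composition → Series
F α = ∑ (filter (λ β → _⊆?_ _≟_ (S α) (S β)) (compositions ∣ α ∣)) M

-- A way of writing f as a finite linear combination of the family b.
record Expansion {I : Set} (b : I → Series) (f : Series) : Set where
  field
    coeff       : I → ℤ
    support     : List I
    unique      : Unique support
    vanishing   : ∀ i → coeff i ≢ 0ℤ → i ∈ support
    combination : f ≗ ∑ support (λ i → coeff i · b i)

open Expansion public using (coeff)

------------------------------------------------------------------------
-- Skew shapes

-- The i-th entry, counted from 0, and 0 beyond the end.
entry : List ℕ → ℕ → ℕ
entry []       _       = 0
entry (a ∷ _)  zero    = a
entry (_ ∷ as) (suc i) = entry as i

_!_ : Partition → ℕ → ℕ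
λ′ ! i = entry (parts (composition λ′)) i

record SkewShape : Set where
  constructor mkSkewShape
  field
    outer     : Partition
    inner     : Partition
    contained : ∀ i → inner ! i ≤ outer ! i

open SkewShape public

∅ : Partition
∅ = mkPartition (mkComposition [] []) []

_/∅ : Partition → SkewShape
λ′ /∅ = mkSkewShape λ′ ∅ (λ _ → z≤n)

-- Rows and columns are counted from 0.
Box : SkewShape → ℕ → ℕ → Set
Box A i j = inner A ! i ≤ j × j < outer A ! i

box? : ∀ A i j → Dec (Box A i j)
box? A i j = (inner A ! i ≤? j) ×-dec (j <? outer A ! i)

#rows #cols : SkewShape → ℕ
#rows A = length (parts (composition (outer A)))
#cols A = outer A ! 0

boxes : SkewShape → List (ℕ × ℕ)
boxes A = filter (λ (i , j) → box? A i j) (cartesianProduct (upTo (#rows A)) (upTo (#cols A)))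

size : SkewShape → ℕ
size A = length (boxes A)

------------------------------------------------------------------------
-- Standard Young tableaux

module _ (A : SkewShape) where

  row col : Fin (size A) → ℕ
  row p = proj₁ (List.lookup (boxes A) p)
  col p = proj₂ (List.lookup (boxes A) p)

  -- The box at position p of the list of boxes is filled with value T p.
  Filling : Set
  Filling = Vec (Fin (size A)) (size A)

  value : Filling → Fin (size A) → ℕ
  value T p = suc (toℕ (Vec.lookup T p))

  -- There are as many boxes as values, so injectivity says that each value
  -- is used exactly once.
  IsSYT : Filling → Set
  IsSYT T =
      (∀ p q → value T p ≡ value T q → p ≡ q)
    × (∀ p q → row p ≡ row q → col p < col q → value T p < value T q)
    × (∀ p q → col p ≡ col q → row p < row q → value T p < value T q)

  isSYT? : Decidable IsSYT
  isSYT? T =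
          Fin.all? (λ p → Fin.all? λ q → (value T p ≟ value T q) →-dec (p Fin.≟ q))
    ×-dec Fin.all? (λ p → Fin.all? λ q →
            (row p ≟ row q) →-dec ((col p <? col q) →-dec (value T p <? value T q)))
    ×-dec Fin.all? (λ p → Fin.all? λ q →
            (col p ≟ col q) →-dec ((row p <? row q) →-dec (value T p <? value T q)))

  Descent : Filling → Pred ℕ 0ℓ
  Descent T i = ∃[ p ] ∃[ q ] value T p ≡ i × value T q ≡ suc i × row p < row q

  descent? : ∀ T → Decidable (Descent T)
  descent? T i = Fin.any? λ p → Fin.any? λ q →
    (value T p ≟ i) ×-dec ((value T q ≟ suc i) ×-dec (row p <? row q))

  comp : Filling → Composition
  comp T = fromSet (size A) (descent? T)

allVecs : {X : Set} → List X → (n : ℕ) → List (Vec X n)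
allVecs xs zero    = [] ∷ []
allVecs xs (suc n) = cartesianProductWith _∷_ xs (allVecs xs n)

SYTs : (A : SkewShape) → List (Filling A)
SYTs A = filter (isSYT? A) (allVecs (allFin (size A)) (size A))

------------------------------------------------------------------------
-- Skew Schur functions and their supports

skewSchur : SkewShape → Series
skewSchur A = ∑ (SYTs A) (λ T → F (comp A T))

schur : Partition → Series
schur λ′ = skewSchur (λ′ /∅)

supp-F : SkewShape → Pred Composition 0ℓ
supp-F A α = Σ[ E ∈ Expansion F (skewSchur A) ] 0ℤ ℤ.< coeff E α

supp-s : SkewShape → Pred Partition 0ℓ
supp-s A λ′ = Σ[ E ∈ Expansion schur (skewSchur A) ] coeff E λ′ ≢ 0ℤ

------------------------------------------------------------------------
-- Overlaps and rectangles

count : {X : Set} {P : Pred X 0ℓ} → Decidable P → List X → ℕ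
count P? xs = length (filter P? xs)

sortedNonZero : List ℕ → Partition
sortedNonZero as = mkPartition
  (mkComposition (filter nonZero? bs) (All.all-filter nonZero? bs))
  (Linked.filter⁺ nonZero? (flip ≤-trans) (sort-↗ ≥-decTotalOrder as))
  where bs = sort ≥-decTotalOrder as

-- For a set P of boxes within r lines of length c: the number of positions
-- occupied in common by the lines i, …, i + k - 1.
overlapAt : {P : ℕ → ℕ → Set} → (∀ i j → Dec (P i j)) → (c k i : ℕ) → ℕ
overlapAt P? c k i = count (λ j → allUpTo? (λ a → P? (i + a) j) k) (upTo c)

-- The list (overlap_k(1), …, overlap_k(r - k + 1)), sorted, without zeros.
overlapPartition : {P : ℕ → ℕ → Set} → (∀ i j → Dec (P i j)) → (r c k : ℕ) → Partition
overlapPartition P? r c k = sortedNonZero (map (overlapAt P? c k) (upTo (suc r ∸ k)))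

rows cols : ℕ → SkewShape → Partition
rows k A = overlapPartition (box? A) (#rows A) (#cols A) k
cols ℓ A = overlapPartition (flip (box? A)) (#cols A) (#rows A) ℓ

-- The top left boxes of the k × ℓ rectangles contained in A are counted; for
-- k, ℓ ≥ 1 they lie in A.
rects : ℕ → ℕ → SkewShape → ℕ
rects k ℓ A = count
  (λ (i , j) → allUpTo? (λ a → allUpTo? (λ b → box? A (i + a) (j + b)) ℓ) k)
  (cartesianProduct (upTo (#rows A)) (upTo (#cols A)))

SameRows SameCols SameRects : SkewShape → SkewShape → Set
SameRows  A B = ∀ k → 1 ≤ k → rows k A ≡ rows k B
SameCols  A B = ∀ ℓ → 1 ≤ ℓ → cols ℓ A ≡ cols ℓ B
SameRects A B = ∀ k ℓ → 1 ≤ k → 1 ≤ ℓ → rects k ℓ A ≡ rects k ℓ B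

------------------------------------------------------------------------
-- fromSet n D? does correspond to D ∩ [n - 1]

private
  partialSums-suc : ∀ a as → partialSums (suc a ∷ as) ≡ map suc (partialSums (a ∷ as))
  partialSums-suc a []       = refl
  partialSums-suc a (b ∷ as) = cong (suc a ∷_) (List.map-∘ (partialSums (b ∷ as)))

  fromSet-nonEmpty : ∀ n {D : Pred ℕ 0ℓ} (D? : Decidable D) →
    ∃[ a ] ∃[ as ] parts (fromSet (suc n) D?) ≡ a ∷ as
  fromSet-nonEmpty zero    D? = 1 , [] , refl
  fromSet-nonEmpty (suc n) D? with does (D? 1)
  ... | true  = _ , _ , refl
  ... | false with fromSet (suc n) (D? ∘ suc)
  ...   | mkComposition []      _ = _ , _ , refl
  ...   | mkComposition (_ ∷ _) _ = _ , _ , refl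

  S-newPart : ∀ α {a as} → parts α ≡ a ∷ as → S (newPart α) ≡ 1 ∷ map suc (S α)
  S-newPart (mkComposition (_ ∷ _) _) refl = refl

  S-growPart : ∀ α {a as} → parts α ≡ a ∷ as → S (growPart α) ≡ map suc (S α)
  S-growPart (mkComposition (a ∷ as) _) refl = partialSums-suc a as

  filter-map-suc : ∀ {D : Pred ℕ 0ℓ} (D? : Decidable D) ns →
    map suc (filter (D? ∘ suc) ns) ≡ filter D? (map suc ns)
  filter-map-suc D? []       = refl
  filter-map-suc D? (n ∷ ns) with does (D? (suc n))
  ... | true  = cong (suc n ∷_) (filter-map-suc D? ns)
  ... | false = filter-map-suc D? ns

  [1⋯]-suc : ∀ n → [1⋯ suc (suc n) -1] ≡ 1 ∷ map suc [1⋯ suc n -1]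
  [1⋯]-suc n = cong (1 ∷_) (cong (map suc) (sym (List.map-upTo suc n)))

  S-step : ∀ n {D : Pred ℕ 0ℓ} (D? : Decidable D) →
    S (fromSet (suc n) (D? ∘ suc)) ≡ filter (D? ∘ suc) [1⋯ suc n -1] →
    S (fromSet (suc (suc n)) D?) ≡ filter D? (1 ∷ map suc [1⋯ suc n -1])
  S-step n D? ih
    with does (D? 1) | fromSet (suc n) (D? ∘ suc) | fromSet-nonEmpty n (D? ∘ suc) | ih
  ... | true  | α | _ , _ , eq | ih′ =
    trans (S-newPart α eq) (cong (1 ∷_) (trans (cong (map suc) ih′) (filter-map-suc D? [1⋯ suc n -1])))
  ... | false | α | _ , _ , eq | ih′ =
    trans (S-growPart α eq) (trans (cong (map suc) ih′) (filter-map-suc D? [1⋯ suc n -1]))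

S-fromSet : ∀ n {D : Pred ℕ 0ℓ} (D? : Decidable D) →
  S (fromSet n D?) ≡ filter D? [1⋯ n -1]
S-fromSet 0             D? = refl
S-fromSet 1             D? = refl
S-fromSet (suc (suc n)) D? =
  trans (S-step n D? (S-fromSet (suc n) (D? ∘ suc))) (cong (filter D?) (sym ([1⋯]-suc n)))

{-# OPTIONS --safe #-}
module Submission where

-- Call a run in a tableau a maximal interval of values without descents, or,
-- dually, of values that are all descents.  A run of the first kind adds a
-- horizontal strip, which never contains more than the top box of each column;
-- one of the second kind never adds more than the leftmost box of each row.
-- What is left of A after removing the k top boxes of every column and then
-- the l leftmost boxes of every row has rects (k + 1) (l + 1) A boxes, so this
-- number is the minimum, over all descent sets of tableaux of shape A, of what
-- remains after k runs of the first kind and l of the second, and it depends on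
-- the F-support only.  The overlaps are recovered from it as multisets, since
-- rects k (m + 1) A is the sum of the overlap_k (i) ∸ m.
--
-- No positivity of Littlewood-Richardson coefficients is needed for the Schur
-- support.  For fixed k, one descent set attains the minima for all (j , 0)
-- with j ≤ k and all (k , l) at once, and for a straight shape λ these minima
-- determine λ.  So the F of the optimal descent set of a minimal λ in the
-- Schur support cannot cancel.  The expansion exists because counting chains of
-- horizontal strips shows s_A to be symmetric and the s_λ to be unitriangular.

open import Defs
open import Data.Bool using (Bool; true; false; if_then_else_)
open import Data.Fin as Fin using (Fin; toℕ)
import Data.Fin.Properties as Fin
import Data.Integer.Base as ℤ hiding (+_)
open import Data.Integer using (ℤ; 0ℤ; 1ℤ)
import Data.Integer.Properties as ℤ
open import Data.Integer.Tactic.RingSolver using (solve-∀)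
open import Data.List as List
  using (List; []; _∷_; _++_; length; map; filter; foldr; upTo; applyUpTo; allFin; drop;
         replicate; concatMap; cartesianProduct; deduplicate)
open import Data.List.Membership.Propositional using (_∈_; _∉_; find; lose)
import Data.List.Membership.Propositional.Properties as ∈
import Data.List.Properties as List
open import Data.List.Relation.Binary.Permutation.Propositional as ↭ using (_↭_; ↭-sym; ↭⇒↭ₛ)
import Data.List.Relation.Binary.Permutation.Propositional.Properties as ↭
import Data.List.Relation.Binary.Permutation.Setoid.Properties as ↭ₛ
open import Data.List.Relation.Binary.Subset.Propositional using (_⊆_)
open import Data.List.Relation.Binary.Subset.DecPropositional using (_⊆?_)
open import Data.List.Relation.Unary.All as All using (All; []; _∷_)
import Data.List.Relation.Unary.All.Properties as All
open import Data.List.Relation.Unary.AllPairs as AllPairs using (AllPairs; []; _∷_)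
import Data.List.Relation.Unary.AllPairs.Properties as AllPairs
open import Data.List.Relation.Unary.Any as Any using (Any; here; there)
import Data.List.Relation.Unary.Any.Properties as Any
open import Data.List.Relation.Unary.Linked as Linked using (Linked; []; [-]; _∷_)
import Data.List.Relation.Unary.Linked.Properties as Linked
open import Data.List.Relation.Unary.Unique.Propositional using (Unique)
import Data.List.Relation.Unary.Unique.Propositional.Properties as Unique
open import Data.List.Sort using (sort; sort-↭; sort-↗)
open import Data.Nat
  using (ℕ; zero; suc; pred; _+_; _∸_; _⊓_; _⊔_; _≤_; _≥_; _<_; _<ᵇ_; z≤n; s≤s; s≤s⁻¹; NonZero)
open import Data.Nat.ListAction using (sum)
import Data.Nat.ListAction.Properties as Sum
open import Data.Nat.Properties
open import Algebra.Properties.CommutativeSemigroup +-commutativeSemigroup using ()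
  renaming (interchange to +-interchange; x∙yz≈y∙xz to x+[y+z]≡y+[x+z])
open import Data.Product using (Σ-syntax; ∃-syntax; _×_; _,_; proj₁; proj₂)
open import Data.Sum using (_⊎_; inj₁; inj₂; [_,_]′)
open import Data.Vec as Vec using (Vec; []; _∷_)
import Data.Vec.Properties as Vec
open import Function using (_∘_; flip; id)
open import Function.Bundles using (_⇔_; mk⇔; Equivalence)
open import Relation.Binary.Construct.On using () renaming (decTotalOrder to onDecTotalOrder)
open import Relation.Binary.Properties.DecTotalOrder ≤-decTotalOrder using (≥-decTotalOrder)
open import Relation.Binary.PropositionalEquality
  using (_≡_; _≢_; _≗_; refl; sym; trans; cong; cong₂; subst; subst₂; setoid; module ≡-Reasoning)
open import Relation.Nullary using (Dec; yes; no; does; ¬_; _×-dec_; _→-dec_; ¬?; contradiction)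
open import Relation.Nullary.Decidable using (recompute; dec-true; dec-false; does-⇔; decidable-stable)
open import Relation.Nullary.Reflects using (ofʸ; ofⁿ)
open import Relation.Unary using (Pred; Decidable; _≐_)
open import Level using (0ℓ)

-- Finite sums of natural numbers

-- `supp-s` and `supp-F` contain an index as soon as some expansion gives it a nonzero, or positive,
-- coefficient. An inclusion of supports says something about A only once there is an expansion of
-- `skewSchur A` to feed into it, which is why `F-expansion` and `schur-expansion` are constructed;
-- on the other side one works with whatever expansion the inclusion returns. It is evaluated by
-- `F-coefficient`, a linear functional defined on all series.
--
-- The optimal word depends on k, because it switches from horizontal to vertical strips after k
-- runs; hence k is a parameter of `Profile`. For a straight shape the minima at (j , 0) are the
-- sums of the rows beyond the j-th, so for j ≤ k they yield the first k rows by differences, while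
-- the minima at (k , l) yield the other rows through their column lengths.
--
-- Each argument proves only an inequality between rectangle numbers; equality comes from exchanging
-- A and B.

Σ< : ℕ → (ℕ → ℕ) → ℕ
Σ< zero    f = 0
Σ< (suc n) f = f 0 + Σ< n (f ∘ suc)

Σ<-cong : ∀ n {f g : ℕ → ℕ} → (∀ i → i < n → f i ≡ g i) → Σ< n f ≡ Σ< n g
Σ<-cong zero    eq = refl
Σ<-cong (suc n) eq = cong₂ _+_ (eq 0 (s≤s z≤n)) (Σ<-cong n (λ i i<n → eq (suc i) (s≤s i<n)))

Σ<-mono : ∀ n {f g : ℕ → ℕ} → (∀ i → i < n → f i ≤ g i) → Σ< n f ≤ Σ< n g
Σ<-mono zero    le = z≤n
Σ<-mono (suc n) le = +-mono-≤ (le 0 (s≤s z≤n)) (Σ<-mono n (λ i i<n → le (suc i) (s≤s i<n)))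

Σ<-zero : ∀ n {f : ℕ → ℕ} → (∀ i → i < n → f i ≡ 0) → Σ< n f ≡ 0
Σ<-zero zero    eq = refl
Σ<-zero (suc n) eq = cong₂ _+_ (eq 0 (s≤s z≤n)) (Σ<-zero n (λ i i<n → eq (suc i) (s≤s i<n)))

Σ<-+ : ∀ n (f g : ℕ → ℕ) → Σ< n (λ i → f i + g i) ≡ Σ< n f + Σ< n g
Σ<-+ zero    f g = refl
Σ<-+ (suc n) f g = trans (cong ((f 0 + g 0) +_) (Σ<-+ n (f ∘ suc) (g ∘ suc)))
                         (+-interchange (f 0) (g 0) (Σ< n (f ∘ suc)) (Σ< n (g ∘ suc)))

Σ<-swap : ∀ m n (f : ℕ → ℕ → ℕ) → Σ< m (λ i → Σ< n (f i)) ≡ Σ< n (λ j → Σ< m (λ i → f i j))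
Σ<-swap zero    n f = sym (Σ<-zero n (λ _ _ → refl))
Σ<-swap (suc m) n f = trans (cong (Σ< n (f 0) +_) (Σ<-swap m n (f ∘ suc)))
                            (sym (Σ<-+ n (f 0) (λ j → Σ< m (λ i → f (suc i) j))))

Σ<-last : ∀ n (f : ℕ → ℕ) → Σ< (suc n) f ≡ Σ< n f + f n
Σ<-last zero    f = +-comm (f 0) 0
Σ<-last (suc n) f = trans (cong (f 0 +_) (Σ<-last n (f ∘ suc))) (sym (+-assoc (f 0) _ _))

Σ<-trunc : ∀ {m n} → m ≤ n → {f : ℕ → ℕ} → (∀ i → m ≤ i → f i ≡ 0) → Σ< n f ≡ Σ< m f
Σ<-trunc {n = n} z≤n eq = Σ<-zero n (λ i _ → eq i z≤n)
Σ<-trunc (s≤s m≤n) {f} eq = cong (f 0 +_) (Σ<-trunc m≤n (λ i m≤i → eq (suc i) (s≤s m≤i)))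

-- The equality case of `Σ<-mono`. It turns equal weights of comparable shapes into equal entries.
Σ<-tight : ∀ n {f g : ℕ → ℕ} → (∀ i → i < n → f i ≤ g i) → Σ< n g ≤ Σ< n f → ∀ i → i < n → f i ≡ g i
Σ<-tight (suc n) {f} {g} le ge zero i<n = ≤-antisym (le 0 (s≤s z≤n))
  (+-cancelʳ-≤ (Σ< n (f ∘ suc)) _ _
    (≤-trans (+-monoʳ-≤ (g 0) (Σ<-mono n (λ i i<n → le (suc i) (s≤s i<n)))) ge))
Σ<-tight (suc n) {f} {g} le ge (suc i) (s≤s i<n) =
  Σ<-tight n (λ i i<n → le (suc i) (s≤s i<n))
    (+-cancelˡ-≤ (f 0) _ _ (≤-trans (+-monoˡ-≤ (Σ< n (g ∘ suc)) (le 0 (s≤s z≤n))) ge)) i i<n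

sum-applyUpTo : ∀ f n → sum (applyUpTo f n) ≡ Σ< n f
sum-applyUpTo f zero    = refl
sum-applyUpTo f (suc n) = cong (f 0 +_) (sum-applyUpTo (f ∘ suc) n)

sum-map-upTo : ∀ f n → sum (map f (upTo n)) ≡ Σ< n f
sum-map-upTo f n = trans (cong sum (List.map-upTo f n)) (sum-applyUpTo f n)

𝟙 : {P : Set} → Dec P → ℕ
𝟙 P? = if does P? then 1 else 0

𝟙-yes : {P : Set} (P? : Dec P) → P → 𝟙 P? ≡ 1
𝟙-yes P? p = cong (if_then 1 else 0) (dec-true P? p)

𝟙-no : {P : Set} (P? : Dec P) → ¬ P → 𝟙 P? ≡ 0
𝟙-no P? ¬p = cong (if_then 1 else 0) (dec-false P? ¬p)

count-applyUpTo : {X : Set} {P : Pred X 0ℓ} (P? : Decidable P) (f : ℕ → X) → ∀ n →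
  count P? (applyUpTo f n) ≡ Σ< n (λ i → 𝟙 (P? (f i)))
count-applyUpTo P? f zero    = refl
count-applyUpTo P? f (suc n) with does (P? (f 0))
... | true  = cong suc (count-applyUpTo P? (f ∘ suc) n)
... | false = count-applyUpTo P? (f ∘ suc) n

count-map : {X Y : Set} {P : Pred Y 0ℓ} (P? : Decidable P) (f : X → Y) → ∀ xs →
  count P? (map f xs) ≡ count (P? ∘ f) xs
count-map P? f []       = refl
count-map P? f (x ∷ xs) with does (P? (f x))
... | true  = cong suc (count-map P? f xs)
... | false = count-map P? f xs

count-cartesianProduct : {X Y : Set} {P : Pred (X × Y) 0ℓ} (P? : Decidable P) (f : ℕ → X) → ∀ m ys →
  count P? (cartesianProduct (applyUpTo f m) ys) ≡ Σ< m (λ i → count (λ y → P? (f i , y)) ys)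
count-cartesianProduct P? f zero    ys = refl
count-cartesianProduct P? f (suc m) ys = begin
  count P? (map (f 0 ,_) ys ++ rest)
    ≡⟨ cong length (List.filter-++ P? (map (f 0 ,_) ys) rest) ⟩
  length (filter P? (map (f 0 ,_) ys) ++ filter P? rest)
    ≡⟨ List.length-++ (filter P? (map (f 0 ,_) ys)) ⟩
  count P? (map (f 0 ,_) ys) + count P? rest
    ≡⟨ cong₂ _+_ (count-map P? (f 0 ,_) ys) (count-cartesianProduct P? (f ∘ suc) m ys) ⟩
  Σ< (suc m) (λ i → count (λ y → P? (f i , y)) ys) ∎
  where
  open ≡-Reasoning
  rest = cartesianProduct (applyUpTo (f ∘ suc) m) ys

count-grid : {P : Pred (ℕ × ℕ) 0ℓ} (P? : Decidable P) → ∀ r c →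
  count P? (cartesianProduct (upTo r) (upTo c)) ≡ Σ< r (λ i → Σ< c (λ j → 𝟙 (P? (i , j))))
count-grid P? r c = trans (count-cartesianProduct P? id r (upTo c))
  (Σ<-cong r (λ i _ → count-applyUpTo (λ j → P? (i , j)) id c))

-- Truncated subtraction is correct also when `b ≤ a`, so empty skew rows and rows without room for
-- a rectangle need no separate treatment.
count-interval : ∀ n {a b} {P : ℕ → Set} (P? : ∀ j → Dec (P j)) →
  (∀ j → P j → a ≤ j × j < b) → (∀ j → a ≤ j → j < b → P j) → b ≤ n →
  Σ< n (λ j → 𝟙 (P? j)) ≡ b ∸ a
count-interval n {a} {zero} P? to from b≤n =
  trans (Σ<-zero n (λ j _ → 𝟙-no (P? j) (λ p → contradiction (proj₂ (to j p)) λ ()))) (sym (0∸n≡0 a))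
count-interval (suc n) {zero} {suc b} P? to from (s≤s b≤n) =
  cong₂ _+_ (𝟙-yes (P? 0) (from 0 z≤n (s≤s z≤n)))
    (count-interval n (P? ∘ suc) (λ j p → z≤n , s≤s⁻¹ (proj₂ (to (suc j) p)))
      (λ j _ j<b → from (suc j) z≤n (s≤s j<b)) b≤n)
count-interval (suc n) {suc a} {suc b} P? to from (s≤s b≤n) =
  cong₂ _+_ (𝟙-no (P? 0) (λ p → contradiction (proj₁ (to 0 p)) λ ()))
    (count-interval n (P? ∘ suc) (λ j p → s≤s⁻¹ (proj₁ (to (suc j) p)) , s≤s⁻¹ (proj₂ (to (suc j) p)))
      (λ j a≤j j<b → from (suc j) (s≤s a≤j) (s≤s j<b)) b≤n)

-- Rectangles and overlaps

Convex : (ℕ → Set) → Set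
Convex Q = ∀ {x y z} → x ≤ y → y ≤ z → Q x → Q z → Q y

initial-segment : ∀ c {Q : ℕ → Set} (Q? : ∀ j → Dec (Q j)) → (∀ j → Q j → j < c) →
  (∀ {x y} → x ≤ y → Q y → Q x) →
  ∀ j → (Q j → j < Σ< c (λ i → 𝟙 (Q? i))) × (j < Σ< c (λ i → 𝟙 (Q? i)) → Q j)
initial-segment zero    Q? bd down j = (λ q → contradiction (bd j q) λ ()) , λ ()
initial-segment (suc c) Q? bd down j with Q? 0
... | no ¬q0 = (λ q → contradiction (down z≤n q) ¬q0)
             , (λ lt → contradiction (subst (j <_) none lt) λ ())
  where
  none : Σ< c (λ i → 𝟙 (Q? (suc i))) ≡ 0
  none = Σ<-zero c (λ i _ → 𝟙-no (Q? (suc i)) (¬q0 ∘ down z≤n))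
... | yes q0 with j
...   | zero   = (λ _ → s≤s z≤n) , (λ _ → q0)
...   | suc j′ with initial-segment c (Q? ∘ suc) (λ i q → s≤s⁻¹ (bd (suc i) q)) (λ le → down (s≤s le)) j′
...     | to , from = (λ q → s≤s (to q)) , (λ lt → from (s≤s⁻¹ lt))

-- Positions before the first element of the convex set start no window. At the first element the
-- rest of the set is an initial segment with `h` elements, so the window starting there fits
-- exactly if `m ≤ h`.
count-windows : ∀ c {Q R : ℕ → Set} (Q? : ∀ j → Dec (Q j)) (R? : ∀ j → Dec (R j)) →
  (∀ j → Q j → j < c) → Convex Q → ∀ m →
  (∀ j → R j → ∀ b → b ≤ m → Q (j + b)) → (∀ j → (∀ b → b ≤ m → Q (j + b)) → R j) →
  Σ< c (λ j → 𝟙 (R? j)) ≡ Σ< c (λ j → 𝟙 (Q? j)) ∸ m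
count-windows zero    Q? R? bd cv m to from = sym (0∸n≡0 m)
count-windows (suc c) {Q} {R} Q? R? bd cv m to from with Q? 0
... | no ¬q0 = cong₂ _+_ (𝟙-no (R? 0) (λ r0 → ¬q0 (to 0 r0 0 z≤n)))
  (count-windows c (Q? ∘ suc) (R? ∘ suc) (λ i q → s≤s⁻¹ (bd (suc i) q))
    (λ le le′ → cv (s≤s le) (s≤s le′)) m (to ∘ suc) (from ∘ suc))
... | yes q0 = trans (cong (𝟙 (R? 0) +_)
    (count-windows c (Q? ∘ suc) (R? ∘ suc) (λ i q → s≤s⁻¹ (bd (suc i) q))
      (λ le le′ → cv (s≤s le) (s≤s le′)) m (to ∘ suc) (from ∘ suc)))
    (first m to′ from′)
  where
  h = Σ< c (λ j → 𝟙 (Q? (suc j)))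
  seg = initial-segment c (Q? ∘ suc) (λ i q → s≤s⁻¹ (bd (suc i) q)) (λ le → cv z≤n (s≤s le) q0)
  to′ : R 0 → m ≤ h
  to′ r0 = go m ≤-refl where
    go : ∀ b → b ≤ m → b ≤ h
    go zero    _  = z≤n
    go (suc b) le = proj₁ (seg b) (to 0 r0 (suc b) le)
  from′ : m ≤ h → R 0
  from′ m≤h = from 0 λ { zero _ → q0 ; (suc b) le → proj₂ (seg b) (≤-trans le m≤h) }
  first : ∀ m → (R 0 → m ≤ h) → (m ≤ h → R 0) → 𝟙 (R? 0) + (h ∸ m) ≡ suc h ∸ m
  first m to from with m ≤? h
  ... | yes le = trans (cong (_+ (h ∸ m)) (𝟙-yes (R? 0) (from le))) (sym (+-∸-assoc 1 le))
  ... | no ¬le = trans (cong₂ _+_ (𝟙-no (R? 0) (¬le ∘ to)) (m≤n⇒m∸n≡0 (<⇒≤ (≰⇒> ¬le))))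
                       (sym (m≤n⇒m∸n≡0 (≰⇒> ¬le)))

-- For a partition, the number of boxes to the right of column `m`. Consecutive values differ by the
-- parts of the conjugate partition.
excess : ℕ → List ℕ → ℕ
excess m as = sum (map (_∸ m) as)

excess-nonZero : ∀ m as → excess m (filter nonZero? as) ≡ excess m as
excess-nonZero m []           = refl
excess-nonZero m (zero ∷ as)  = trans (excess-nonZero m as) (cong (_+ excess m as) (sym (0∸n≡0 m)))
excess-nonZero m (suc a ∷ as) = cong (suc a ∸ m +_) (excess-nonZero m as)

excess-↭ : ∀ m {as bs} → as ↭ bs → excess m as ≡ excess m bs
excess-↭ m p = Sum.sum-↭ (↭.map⁺ (_∸ m) p)

sortedParts : List ℕ → List ℕ
sortedParts as = parts (composition (sortedNonZero as))

excess-sortedNonZero : ∀ m as → excess m (sortedParts as) ≡ excess m as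
excess-sortedNonZero m as = trans (excess-nonZero m (sort ≥-decTotalOrder as)) (excess-↭ m (sort-↭ ≥-decTotalOrder as))

module _ {P : ℕ → ℕ → Set} (P? : ∀ i j → Dec (P i j)) {r c : ℕ}
         (bound-i : ∀ {i j} → P i j → i < r) (bound-j : ∀ {i j} → P i j → j < c)
         (convex-j : ∀ i → Convex (P i)) where

  -- Rectangles with `k` lines starting in line `i` are windows of `m + 1` consecutive positions in
  -- the convex set shared by those lines. Working with an arbitrary `P` lets `flip` give the
  -- version for columns.
  grid-excess : ∀ k m → 1 ≤ k →
    {R : ℕ → ℕ → Set} (R? : ∀ i j → Dec (R i j)) →
    (∀ i j → R i j → ∀ a → a < k → ∀ b → b ≤ m → P (i + a) (j + b)) →
    (∀ i j → (∀ a → a < k → ∀ b → b ≤ m → P (i + a) (j + b)) → R i j) →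
    Σ< r (λ i → Σ< c (λ j → 𝟙 (R? i j))) ≡ excess m (parts (composition (overlapPartition P? r c k)))
  grid-excess k@(suc k-1) m _ R? to from = begin
    Σ< r (λ i → Σ< c (λ j → 𝟙 (R? i j)))
      ≡⟨ Σ<-cong r (λ i _ → count-windows c (all? i) (R? i)
           (λ j q → bound-j (q {0} (s≤s z≤n)))
           (λ le le′ p q {a} lt → convex-j (i + a) le le′ (p lt) (q lt)) m
           (λ j ρ b b≤m {a} lt → to i j ρ a lt b b≤m)
           (λ j h → from i j (λ a lt b b≤m → h b b≤m lt))) ⟩
    Σ< r (λ i → Σ< c (λ j → 𝟙 (all? i j)) ∸ m)
      ≡⟨ Σ<-cong r (λ i _ → cong (_∸ m) (sym (count-applyUpTo (all? i) id c))) ⟩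
    Σ< r (λ i → overlapAt P? c k i ∸ m)
      ≡⟨ Σ<-trunc (m∸n≤m r k-1) beyond ⟩
    Σ< (r ∸ k-1) (λ i → overlapAt P? c k i ∸ m)
      ≡⟨ sum-map-upTo (λ i → overlapAt P? c k i ∸ m) (r ∸ k-1) ⟨
    sum (map (λ i → overlapAt P? c k i ∸ m) (upTo (r ∸ k-1)))
      ≡⟨ cong sum (List.map-∘ (upTo (r ∸ k-1))) ⟩
    excess m (map (overlapAt P? c k) (upTo (r ∸ k-1)))
      ≡⟨ excess-sortedNonZero m (map (overlapAt P? c k) (upTo (r ∸ k-1))) ⟨
    excess m (parts (composition (overlapPartition P? r c k))) ∎
    where
    open ≡-Reasoning
    all? : ∀ i j → Dec (∀ {a} → a < k → P (i + a) j)
    all? i j = allUpTo? (λ a → P? (i + a) j) k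
    -- The count of rectangles runs over all `r` lines, the overlaps over `r - k + 1` of them; from
    -- any other line, `k` lines would leave the diagram.
    beyond : ∀ i → r ∸ k-1 ≤ i → overlapAt P? c k i ∸ m ≡ 0
    beyond i le = trans (cong (_∸ m) (trans (count-applyUpTo (all? i) id c)
      (Σ<-zero c (λ j _ → 𝟙-no (all? i j) λ q → <⇒≱ (bound-i (q (n<1+n k-1)))
        (≤-trans (m≤n+m∸n r k-1) (≤-trans (+-monoʳ-≤ k-1 le) (≤-reflexive (+-comm k-1 i)))))))) (0∸n≡0 m)

private
  excess-head : ∀ {x xs} → Linked _≥_ (x ∷ xs) → excess x (x ∷ xs) ≡ 0
  excess-head {x} [-] = cong (_+ 0) (n∸n≡0 x)
  excess-head {x} {y ∷ ys} (x≥y ∷ l) = cong₂ _+_ (n∸n≡0 x) (tail y ys x≥y l)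
    where
    tail : ∀ y ys → y ≤ x → Linked _≥_ (y ∷ ys) → excess x (y ∷ ys) ≡ 0
    tail y []       y≤x _         = cong (_+ 0) (m≤n⇒m∸n≡0 y≤x)
    tail y (z ∷ zs) y≤x (y≥z ∷ l) = cong₂ _+_ (m≤n⇒m∸n≡0 y≤x) (tail z zs (≤-trans y≥z y≤x) l)

  head-≤ : ∀ {x xs y ys} → Linked _≥_ (y ∷ ys) → excess y (x ∷ xs) ≡ excess y (y ∷ ys) → x ≤ y
  head-≤ {x} {xs} {y} l eq = m∸n≡0⇒m≤n {x} {y} (m+n≡0⇒m≡0 (x ∸ y) {excess y xs} (trans eq (excess-head l)))

-- At `m` equal to the head of one list, the excess of that list vanishes because it is decreasing,
-- so the other head is at most `m`. The heads thus agree, and their contributions cancel for every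
-- `m`.
excess-injective : ∀ {xs ys} → Linked _≥_ xs → Linked _≥_ ys → All NonZero xs → All NonZero ys →
  (∀ m → excess m xs ≡ excess m ys) → xs ≡ ys
excess-injective {[]}         {[]}         _ _ _ _ eq = refl
excess-injective {[]}         {suc y ∷ ys} _ _ _ _ eq = contradiction (eq 0) λ ()
excess-injective {[]}         {zero ∷ ys}  _ _ _ (record { nonZero = () } ∷ _)
excess-injective {suc x ∷ xs} {[]}         _ _ _ _ eq = contradiction (eq 0) λ ()
excess-injective {zero ∷ xs}  {[]}         _ _ (record { nonZero = () } ∷ _)
excess-injective {x ∷ xs} {y ∷ ys} lx ly (_ ∷ px) (_ ∷ py) eq
  with ≤-antisym (head-≤ {x} {xs} {y} {ys} ly (eq y)) (head-≤ {y} {ys} {x} {xs} lx (sym (eq x)))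
... | refl = cong (x ∷_) (excess-injective (Linked.tail lx) (Linked.tail ly) px py
               (λ m → +-cancelˡ-≡ (x ∸ m) _ _ (eq m)))

nonZeroParts : ∀ α → All NonZero (parts α)
nonZeroParts (mkComposition as pos) = recompute (All.all? nonZero? as) pos

decreasingParts : ∀ λ′ → Linked _≥_ (parts (composition λ′))
decreasingParts (mkPartition α dec) = recompute (Linked.linked? _≥?_ (parts α)) dec

composition-≡ : ∀ {α β} → parts α ≡ parts β → α ≡ β
composition-≡ refl = refl

partition-≡ : ∀ {λ′ μ′} → parts (composition λ′) ≡ parts (composition μ′) → λ′ ≡ μ′
partition-≡ refl = refl

partition-excess-≡ : ∀ {λ′ μ′} →
  (∀ m → excess m (parts (composition λ′)) ≡ excess m (parts (composition μ′))) → λ′ ≡ μ′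
partition-excess-≡ {λ′} {μ′} eq = partition-≡ (excess-injective (decreasingParts λ′) (decreasingParts μ′)
  (nonZeroParts (composition λ′)) (nonZeroParts (composition μ′)) eq)

-- Rectangle numbers of a skew shape

entry-beyond : ∀ as i → length as ≤ i → entry as i ≡ 0
entry-beyond []       i       _         = refl
entry-beyond (a ∷ as) (suc i) (s≤s le) = entry-beyond as i le

entry-suc-≤ : ∀ {as} → Linked _≥_ as → ∀ i → entry as (suc i) ≤ entry as i
entry-suc-≤ []        i       = z≤n
entry-suc-≤ [-]       i       = z≤n
entry-suc-≤ (a≥b ∷ l) zero    = a≥b
entry-suc-≤ (a≥b ∷ l) (suc i) = entry-suc-≤ l i

antitone : ∀ {f : ℕ → ℕ} → (∀ i → f (suc i) ≤ f i) → ∀ {i j} → i ≤ j → f j ≤ f i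
antitone step {zero}  {zero}  z≤n      = ≤-refl
antitone step {zero}  {suc j} z≤n      = ≤-trans (step j) (antitone step (z≤n {j}))
antitone {f} step {suc i} {suc j} (s≤s le) = antitone {f ∘ suc} (step ∘ suc) le

!-suc-≤ : ∀ λ′ i → λ′ ! suc i ≤ λ′ ! i
!-suc-≤ λ′ = entry-suc-≤ (decreasingParts λ′)

!-antitone : ∀ λ′ {i j} → i ≤ j → λ′ ! j ≤ λ′ ! i
!-antitone λ′ = antitone (!-suc-≤ λ′)

outer-beyond : ∀ A i → #rows A ≤ i → outer A ! i ≡ 0
outer-beyond A = entry-beyond (parts (composition (outer A)))

module _ (A : SkewShape) where

  box-row : ∀ {i j} → Box A i j → i < #rows A
  box-row {i} (_ , lt) with i <? #rows A
  ... | yes i<r = i<r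
  ... | no  i≮r = contradiction (subst (_ <_) (outer-beyond A i (≮⇒≥ i≮r)) lt) λ ()

  box-col : ∀ {i j} → Box A i j → j < #cols A
  box-col (_ , lt) = ≤-trans lt (!-antitone (outer A) z≤n)

  box-convex-j : ∀ i → Convex (Box A i)
  box-convex-j i x≤y y≤z (lo , _) (_ , hi) = ≤-trans lo x≤y , ≤-<-trans y≤z hi

  box-convex-i : ∀ j → Convex (λ i → Box A i j)
  box-convex-i j x≤y y≤z (lo , _) (_ , hi) =
    ≤-trans (!-antitone (inner A) x≤y) lo , <-≤-trans hi (!-antitone (outer A) y≤z)

  Rect : ℕ → ℕ → ℕ → ℕ → Set
  Rect k ℓ i j = ∀ {a} → a < k → ∀ {b} → b < ℓ → Box A (i + a) (j + b)

  rect? : ∀ k ℓ i j → Dec (Rect k ℓ i j)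
  rect? k ℓ i j = allUpTo? (λ a → allUpTo? (λ b → box? A (i + a) (j + b)) ℓ) k

  rects-grid : ∀ k ℓ → rects k ℓ A ≡ Σ< (#rows A) (λ i → Σ< (#cols A) (λ j → 𝟙 (rect? k ℓ i j)))
  rects-grid k ℓ = count-grid (λ (i , j) → rect? k ℓ i j) (#rows A) (#cols A)

  rects-rows : ∀ k m → 1 ≤ k → rects k (suc m) A ≡ excess m (parts (composition (rows k A)))
  rects-rows k m 1≤k = trans (rects-grid k (suc m))
    (grid-excess (box? A) box-row box-col box-convex-j k m 1≤k (rect? k (suc m))
      (λ i j ρ a lt b b≤m → ρ lt (s≤s b≤m)) (λ i j h {a} lt {b} lt′ → h a lt b (s≤s⁻¹ lt′)))

  rects-cols : ∀ m ℓ → 1 ≤ ℓ → rects (suc m) ℓ A ≡ excess m (parts (composition (cols ℓ A)))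
  rects-cols m ℓ 1≤ℓ = trans (rects-grid (suc m) ℓ)
    (trans (Σ<-swap (#rows A) (#cols A) _)
      (grid-excess (flip (box? A)) box-col box-row box-convex-i ℓ m 1≤ℓ (λ j i → rect? (suc m) ℓ i j)
        (λ j i ρ b lt a a≤m → ρ (s≤s a≤m) lt) (λ j i h {a} lt {b} lt′ → h b lt′ a (s≤s⁻¹ lt))))

  -- A rectangle lies in the shape exactly if its top left box is right of the inner border and its
  -- bottom right box is left of the outer one; so the admissible columns of its corner form an
  -- interval.
  rects-formula : ∀ k l →
    rects (suc k) (suc l) A ≡ Σ< (#rows A) (λ i → outer A ! (i + k) ∸ (inner A ! i + l))
  rects-formula k l = trans (rects-grid (suc k) (suc l)) (Σ<-cong (#rows A) line)
    where
    line : ∀ i → i < #rows A →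
      Σ< (#cols A) (λ j → 𝟙 (rect? (suc k) (suc l) i j)) ≡ outer A ! (i + k) ∸ (inner A ! i + l)
    line i _ = trans
      (count-interval (#cols A) {inner A ! i} {outer A ! (i + k) ∸ l} (rect? (suc k) (suc l) i)
        (λ j ρ → subst₂ _≤_ (cong (inner A !_) (+-identityʳ i)) (+-identityʳ j) (proj₁ (ρ {0} (s≤s z≤n) {0} (s≤s z≤n)))
               , m+n≤o⇒m≤o∸n (suc j) (proj₂ (ρ {k} ≤-refl {l} ≤-refl)))
        (λ j lo hi {a} lt {b} lt′ →
            ≤-trans (!-antitone (inner A) (m≤m+n i a)) (≤-trans lo (m≤m+n j b))
          , <-≤-trans (≤-<-trans (+-monoʳ-≤ j (s≤s⁻¹ lt′)) (m<n∸o⇒m+o<n j hi))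
                      (!-antitone (outer A) (+-monoʳ-≤ i (s≤s⁻¹ lt))))
        (≤-trans (m∸n≤m _ l) (!-antitone (outer A) z≤n)))
      (trans (∸-+-assoc (outer A ! (i + k)) l (inner A ! i))
             (cong (outer A ! (i + k) ∸_) (+-comm l (inner A ! i))))
      where
      m<n∸o⇒m+o<n : ∀ j → j < outer A ! (i + k) ∸ l → j + l < outer A ! (i + k)
      m<n∸o⇒m+o<n j lt = ≤-trans (+-monoˡ-≤ l lt) (≤-reflexive (m∸n+n≡m {outer A ! (i + k)} {l}
        (≰⇒≥ λ n≤l → contradiction (subst (j <_) (m≤n⇒m∸n≡0 n≤l) lt) λ ())))

  size-formula : size A ≡ Σ< (#rows A) (λ i → outer A ! i ∸ inner A ! i)
  size-formula = trans (count-grid (λ (i , j) → box? A i j) (#rows A) (#cols A))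
    (Σ<-cong (#rows A) (λ i _ → count-interval (#cols A) (box? A i) (λ _ p → p) (λ _ lo hi → lo , hi)
      (!-antitone (outer A) z≤n)))

module _ (A B : SkewShape) where

  sameRows⇔sameRects : SameRows A B ⇔ SameRects A B
  sameRows⇔sameRects = mk⇔
    (λ { same k (suc m) 1≤k _ → trans (rects-rows A k m 1≤k)
           (trans (cong (λ λ′ → excess m (parts (composition λ′))) (same k 1≤k)) (sym (rects-rows B k m 1≤k))) })
    (λ same k 1≤k → partition-excess-≡ λ m →
      trans (sym (rects-rows A k m 1≤k)) (trans (same k (suc m) 1≤k (s≤s z≤n)) (rects-rows B k m 1≤k)))

  sameCols⇔sameRects : SameCols A B ⇔ SameRects A B
  sameCols⇔sameRects = mk⇔
    (λ { same (suc m) ℓ _ 1≤ℓ → trans (rects-cols A m ℓ 1≤ℓ)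
           (trans (cong (λ λ′ → excess m (parts (composition λ′))) (same ℓ 1≤ℓ)) (sym (rects-cols B m ℓ 1≤ℓ))) })
    (λ same ℓ 1≤ℓ → partition-excess-≡ λ m →
      trans (sym (rects-cols A m ℓ 1≤ℓ)) (trans (same (suc m) ℓ (s≤s z≤n) 1≤ℓ) (rects-cols B m ℓ 1≤ℓ)))

-- Vectors read as sequences that are zero from some point on

at : ∀ {r} → Vec ℕ r → ℕ → ℕ
at []       _       = 0
at (x ∷ xs) zero    = x
at (x ∷ xs) (suc i) = at xs i

at-beyond : ∀ {r} (x : Vec ℕ r) {i} → r ≤ i → at x i ≡ 0
at-beyond []       _        = refl
at-beyond (x ∷ xs) (s≤s le) = at-beyond xs le

at-ext : ∀ {r} {x y : Vec ℕ r} → (∀ i → at x i ≡ at y i) → x ≡ y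
at-ext {x = []}     {[]}     eq = refl
at-ext {x = x ∷ xs} {y ∷ ys} eq = cong₂ _∷_ (eq 0) (at-ext (eq ∘ suc))

tab : ∀ r → (ℕ → ℕ) → Vec ℕ r
tab zero    f = []
tab (suc r) f = f 0 ∷ tab r (f ∘ suc)

at-tab : ∀ r {f : ℕ → ℕ} → (∀ i → r ≤ i → f i ≡ 0) → ∀ i → at (tab r f) i ≡ f i
at-tab zero    vanish i       = sym (vanish i z≤n)
at-tab (suc r) vanish zero    = refl
at-tab (suc r) vanish (suc i) = at-tab r (λ i le → vanish (suc i) (s≤s le)) i

inc : ∀ {r} → ℕ → Vec ℕ r → Vec ℕ r
inc _       []       = []
inc zero    (x ∷ xs) = suc x ∷ xs
inc (suc i) (x ∷ xs) = x ∷ inc i xs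

at-inc : ∀ {r} {i} → i < r → (x : Vec ℕ r) → at (inc i x) i ≡ suc (at x i)
at-inc {i = zero}  _        (x ∷ xs) = refl
at-inc {i = suc i} (s≤s lt) (x ∷ xs) = at-inc lt xs

at-inc-≢ : ∀ {r} {i j} → i ≢ j → (x : Vec ℕ r) → at (inc i x) j ≡ at x j
at-inc-≢ {i = i}     {j}     ne []       = refl
at-inc-≢ {i = zero}  {zero}  ne (x ∷ xs) = contradiction refl ne
at-inc-≢ {i = zero}  {suc j} ne (x ∷ xs) = refl
at-inc-≢ {i = suc i} {zero}  ne (x ∷ xs) = refl
at-inc-≢ {i = suc i} {suc j} ne (x ∷ xs) = at-inc-≢ (ne ∘ cong suc) xs

at-≤-inc : ∀ {r} i j (x : Vec ℕ r) → at x j ≤ at (inc i x) j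
at-≤-inc i       j       []       = z≤n
at-≤-inc zero    zero    (x ∷ xs) = n≤1+n x
at-≤-inc zero    (suc j) (x ∷ xs) = ≤-refl
at-≤-inc (suc i) zero    (x ∷ xs) = ≤-refl
at-≤-inc (suc i) (suc j) (x ∷ xs) = at-≤-inc i j xs

total : ∀ {r} → Vec ℕ r → ℕ
total {r} x = Σ< r (at x)

total-inc : ∀ {r} {i} → i < r → (x : Vec ℕ r) → total (inc i x) ≡ suc (total x)
total-inc {i = zero}  _        (x ∷ xs) = refl
total-inc {i = suc i} (s≤s lt) (x ∷ xs) = trans (cong (x +_) (total-inc lt xs)) (+-suc x (total xs))

find-min : ∀ n {P : ℕ → Set} → (∀ i → Dec (P i)) →
  (∃[ i ] i < n × P i × (∀ j → j < i → ¬ P j)) ⊎ (∀ i → i < n → ¬ P i)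
find-min zero    P? = inj₂ λ _ ()
find-min (suc n) P? with P? 0
... | yes p0 = inj₁ (0 , s≤s z≤n , p0 , λ _ ())
... | no ¬p0 with find-min n (P? ∘ suc)
...   | inj₁ (i , lt , p , least) =
        inj₁ (suc i , s≤s lt , p , λ { zero _ → ¬p0 ; (suc j) (s≤s lt) → least j lt })
...   | inj₂ none = inj₂ λ { zero _ → ¬p0 ; (suc i) (s≤s lt) → none i lt }

find-max : ∀ n {P : ℕ → Set} → (∀ i → Dec (P i)) →
  (∃[ i ] i < n × P i × (∀ j → i < j → j < n → ¬ P j)) ⊎ (∀ i → i < n → ¬ P i)
find-max zero    P? = inj₂ λ _ ()
find-max (suc n) P? with find-max n (P? ∘ suc)
... | inj₁ (i , lt , p , greatest) =
      inj₁ (suc i , s≤s lt , p , λ { (suc j) (s≤s lt) (s≤s lt′) → greatest j lt lt′ })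
... | inj₂ none with P? 0
...   | yes p0 = inj₁ (0 , s≤s z≤n , p0 , λ { (suc j) _ (s≤s lt) → none j lt })
...   | no ¬p0 = inj₂ λ { zero _ → ¬p0 ; (suc i) (s≤s lt) → none i lt }

-- Tableaux as lattice paths

-- A tableau is recorded by the list of the rows of 1, 2, ….  In its descent
-- word, letter t says whether t is a descent for t ≥ 1; letter 0 is false.
descents : ℕ → List ℕ → List Bool
descents s []      = []
descents s (i ∷ p) = does (s ≤? i) ∷ descents (suc i) p

descentWord : List ℕ → List Bool
descentWord []      = []
descentWord (i ∷ p) = false ∷ descents (suc i) p

-- The number of boxes left after k maximal runs without descents, followed by
-- l maximal runs of descents; the first box has already been read.
leftover : ℕ → ℕ → List Bool → ℕ
leftover zero    zero    v           = suc (length v)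
leftover (suc k) l       []          = 0
leftover (suc k) l       (false ∷ v) = leftover (suc k) l v
leftover (suc k) l       (true ∷ v)  = leftover k l v
leftover zero    (suc l) []          = 0
leftover zero    (suc l) (true ∷ v)  = leftover zero (suc l) v
leftover zero    (suc l) (false ∷ v) = leftover zero l v

remaining : ℕ → ℕ → List Bool → ℕ
remaining k l []      = 0
remaining k l (_ ∷ v) = leftover k l v

length-descents : ∀ s p → length (descents s p) ≡ length p
length-descents s []      = refl
length-descents s (i ∷ p) = cong suc (length-descents (suc i) p)

length-descentWord : ∀ p → length (descentWord p) ≡ length p
length-descentWord []      = refl
length-descentWord (i ∷ p) = cong suc (length-descents (suc i) p)

remaining-0-0 : ∀ v → remaining 0 0 v ≡ length v
remaining-0-0 []      = refl
remaining-0-0 (b ∷ v) = refl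

module Paths {r : ℕ} (top : Vec ℕ r) (top-suc-≤ : ∀ i → at top (suc i) ≤ at top i) where

  State : Set
  State = Vec ℕ r

  top-antitone : ∀ {i j} → i ≤ j → at top j ≤ at top i
  top-antitone = antitone top-suc-≤

  record Good (κ : State) : Set where
    constructor good
    field
      decreasing : ∀ i → at κ (suc i) ≤ at κ i
      below      : ∀ i → at κ i ≤ at top i

  open Good public

  -- Row 0 has no row above it; the value `at top 0` makes the condition on that row the same as
  -- staying inside `top`.
  above : State → ℕ → ℕ
  above κ zero    = at top 0
  above κ (suc i) = at κ i

  Addable : State → ℕ → Set
  Addable κ i = at κ i < at top i × at κ i < above κ i

  addable? : ∀ κ i → Dec (Addable κ i)
  addable? κ i = (at κ i <? at top i) ×-dec (at κ i <? above κ i)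

  below-top⇒row : ∀ {m i} → m < at top i → i < r
  below-top⇒row {i = i} lt with i <? r
  ... | yes i<r = i<r
  ... | no  i≮r = contradiction (subst (_ <_) (at-beyond top (≮⇒≥ i≮r)) lt) λ ()

  addable-row : ∀ κ {i} → Addable κ i → i < r
  addable-row κ = below-top⇒row ∘ proj₁

  good-inc : ∀ {κ i} → Good κ → Addable κ i → Good (inc i κ)
  good-inc {κ} {i} g add@(lt , lt′) = good dec bel
    where
    dec : ∀ j → at (inc i κ) (suc j) ≤ at (inc i κ) j
    dec j with i ≟ suc j
    ... | yes refl = ≤-trans (≤-reflexive (at-inc (addable-row κ add) κ)) (≤-trans lt′ (at-≤-inc i j κ))
    ... | no  ne   = ≤-trans (≤-reflexive (at-inc-≢ ne κ)) (≤-trans (decreasing g j) (at-≤-inc i j κ))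
    bel : ∀ j → at (inc i κ) j ≤ at top j
    bel j with i ≟ j
    ... | yes refl = ≤-trans (≤-reflexive (at-inc (addable-row κ add) κ)) lt
    ... | no  ne   = ≤-trans (≤-reflexive (at-inc-≢ ne κ)) (below g j)

  data Path : State → List ℕ → Set where
    done : Path top []
    step : ∀ {κ i p} → Addable κ i → Path (inc i κ) p → Path κ (i ∷ p)

  -- For κ the inner shape, the number of (k + 1) × (l + 1) rectangles; see excessBeyond-rects.
  excessBeyond : ℕ → ℕ → State → ℕ
  excessBeyond k l κ = Σ< r (λ i → at top (i + k) ∸ (at κ i + l))

  excessBeyond-top : ∀ k l → excessBeyond k l top ≡ 0
  excessBeyond-top k l = Σ<-zero r λ i _ →
    m≤n⇒m∸n≡0 (≤-trans (top-antitone (m≤m+n i k)) (m≤m+n (at top i) l))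

  excessBeyond-total : ∀ κ → (∀ i → at κ i ≤ at top i) → excessBeyond 0 0 κ + total κ ≡ total top
  excessBeyond-total κ le = trans (sym (Σ<-+ r _ _)) (Σ<-cong r λ i _ →
    trans (cong₂ (λ a b → at top a ∸ b + at κ i) (+-identityʳ i) (+-identityʳ (at κ i))) (m∸n+n≡m (le i)))

  path-total : ∀ {κ p} → Path κ p → length p + total κ ≡ total top
  path-total done = refl
  path-total {κ} {i ∷ p} (step add π) = trans (sym (+-suc (length p) (total κ)))
    (trans (cong (length p +_) (sym (total-inc (addable-row κ add) κ))) (path-total π))

  path-length : ∀ {κ p} → Good κ → Path κ p → length p ≡ excessBeyond 0 0 κ
  path-length {κ} g π = +-cancelʳ-≡ (total κ) _ _ (trans (path-total π) (sym (excessBeyond-total κ (below g))))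

  private
    -- Row `i` on the left is compared with row `suc i` on the right. The last row on the left is
    -- left over, and `f` vanishes there.
    shift : ∀ r (f : ℕ → ℕ) (κ κ′ : ℕ → ℕ) → (∀ i → r ≤ i → f i ≡ 0) → ∀ k l → (∀ i → κ′ (suc i) ≤ κ i) →
      Σ< r (λ i → f (i + suc k) ∸ (κ i + l)) ≤ Σ< r (λ i → f (i + k) ∸ (κ′ i + l))
    shift zero    f κ κ′ vanish k l le = z≤n
    shift (suc r) f κ κ′ vanish k l le = begin
      Σ< (suc r) (λ i → f (i + suc k) ∸ (κ i + l))
        ≡⟨ Σ<-last r _ ⟩
      Σ< r (λ i → f (i + suc k) ∸ (κ i + l)) + (f (r + suc k) ∸ (κ r + l))
        ≡⟨ cong (λ x → Σ< r (λ i → f (i + suc k) ∸ (κ i + l)) + (x ∸ (κ r + l)))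
             (vanish (r + suc k) (≤-trans (s≤s (m≤m+n r k)) (≤-reflexive (sym (+-suc r k))))) ⟩
      Σ< r (λ i → f (i + suc k) ∸ (κ i + l)) + (0 ∸ (κ r + l))
        ≡⟨ trans (cong (Σ< r (λ i → f (i + suc k) ∸ (κ i + l)) +_) (0∸n≡0 (κ r + l))) (+-identityʳ _) ⟩
      Σ< r (λ i → f (i + suc k) ∸ (κ i + l))
        ≤⟨ Σ<-mono r (λ i _ → ∸-mono (≤-reflexive (cong f (+-suc i k))) (+-monoˡ-≤ l (le i))) ⟩
      Σ< r (λ i → f (suc i + k) ∸ (κ′ (suc i) + l))
        ≤⟨ m≤n+m _ _ ⟩
      Σ< (suc r) (λ i → f (i + k) ∸ (κ′ i + l)) ∎
      where open ≤-Reasoning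

  excessBeyond-row : ∀ k l κ κ′ → (∀ i → at κ′ (suc i) ≤ at κ i) →
    excessBeyond (suc k) l κ ≤ excessBeyond k l κ′
  excessBeyond-row k l κ κ′ = shift r (at top) (at κ) (at κ′) (λ _ → at-beyond top) k l

  excessBeyond-col : ∀ k l κ κ′ → (∀ i → at κ′ i ≤ suc (at κ i)) →
    excessBeyond k (suc l) κ ≤ excessBeyond k l κ′
  excessBeyond-col k l κ κ′ le = Σ<-mono r λ i _ → ∸-monoʳ-≤ (at top (i + k))
    (≤-trans (+-monoˡ-≤ l (le i)) (≤-reflexive (sym (+-suc (at κ i) l))))

  -- A run without descents adds a horizontal strip, a run of descents adds a
  -- vertical strip.
  mutual
    excess≤remaining : ∀ k l {κ p} → Good κ → Path κ p → excessBeyond k l κ ≤ remaining k l (descentWord p)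
    excess≤remaining k l g done = ≤-reflexive (excessBeyond-top k l)
    excess≤remaining zero zero {p = i ∷ p} g π@(step _ _) = ≤-reflexive
      (trans (sym (path-length g π)) (cong suc (sym (length-descents (suc i) p))))
    excess≤remaining (suc k) l {κ} {i ∷ p} g (step add π) = row-run k l κ i (good-inc g add) π
      interlace (λ j lt → at-inc-≢ (>⇒≢ lt) κ)
      where
      interlace : ∀ j → at (inc i κ) (suc j) ≤ at κ j
      interlace j with i ≟ suc j
      ... | yes refl = ≤-trans (≤-reflexive (at-inc (addable-row κ add) κ)) (proj₂ add)
      ... | no ne    = ≤-trans (≤-reflexive (at-inc-≢ ne κ)) (decreasing g j)
    excess≤remaining zero (suc l) {κ} {i ∷ p} g (step add π) = col-run l κ i (good-inc g add) π
      grow (λ j lt → at-inc-≢ (<⇒≢ lt) κ)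
      where
      grow : ∀ j → at (inc i κ) j ≤ suc (at κ j)
      grow j with i ≟ j
      ... | yes refl = ≤-reflexive (at-inc (addable-row κ add) κ)
      ... | no ne    = ≤-trans (≤-reflexive (at-inc-≢ ne κ)) (n≤1+n _)

    -- Here `κ₀` is the state before the run and `last` the row of its latest box. Rows weakly move
    -- up during the run, so rows above `last` are still those of `κ₀`; a new box in row
    -- `suc j ≤ last` is therefore bounded by row `j` of `κ₀`, which keeps the strip horizontal.
    row-run : ∀ k l κ₀ last {κ p} → Good κ → Path κ p →
      (∀ j → at κ (suc j) ≤ at κ₀ j) → (∀ j → j < last → at κ j ≡ at κ₀ j) →
      excessBeyond (suc k) l κ₀ ≤ leftover (suc k) l (descents (suc last) p)
    row-run k l κ₀ last g done il same =
      ≤-trans (excessBeyond-row k l κ₀ top il) (≤-reflexive (excessBeyond-top k l))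
    -- The letter `does (suc last ≤? i)` computes to `last <ᵇ i`; abstracting it lets `leftover`
    -- reduce. A descent makes the current box the first one of the next run.
    row-run k l κ₀ last {κ} {i ∷ p} g π@(step add π′) il same with last <ᵇ i | <ᵇ-reflects-< last i
    ... | true  | _ = ≤-trans (excessBeyond-row k l κ₀ κ il) (excess≤remaining k l g π)
    ... | false | ofⁿ nlt = row-run k l κ₀ i (good-inc g add) π′ il′
                     (λ j lt → trans (at-inc-≢ (>⇒≢ lt) κ) (same j (<-≤-trans lt i≤last)))
      where
      i≤last : i ≤ last
      i≤last = ≮⇒≥ nlt
      il′ : ∀ j → at (inc i κ) (suc j) ≤ at κ₀ j
      il′ j with i ≟ suc j
      ... | yes refl = ≤-trans (≤-reflexive (at-inc (addable-row κ add) κ))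
                         (≤-trans (proj₂ add) (≤-reflexive (same j i≤last)))
      ... | no ne    = ≤-trans (≤-reflexive (at-inc-≢ ne κ)) (il j)

    -- Dually to `row-run`, the rows strictly move down, so rows below `last` are untouched and each
    -- new box is the first that its row receives in this run.
    col-run : ∀ l κ₀ last {κ p} → Good κ → Path κ p →
      (∀ j → at κ j ≤ suc (at κ₀ j)) → (∀ j → last < j → at κ j ≡ at κ₀ j) →
      excessBeyond zero (suc l) κ₀ ≤ leftover zero (suc l) (descents (suc last) p)
    col-run l κ₀ last g done gr same =
      ≤-trans (excessBeyond-col 0 l κ₀ top gr) (≤-reflexive (excessBeyond-top 0 l))
    col-run l κ₀ last {κ} {i ∷ p} g π@(step add π′) gr same with last <ᵇ i | <ᵇ-reflects-< last i
    ... | false | _ = ≤-trans (excessBeyond-col 0 l κ₀ κ gr) (excess≤remaining zero l g π)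
    ... | true  | ofʸ lt = col-run l κ₀ i (good-inc g add) π′ gr′
                     (λ j lt′ → trans (at-inc-≢ (<⇒≢ lt′) κ) (same j (<-trans lt lt′)))
      where
      gr′ : ∀ j → at (inc i κ) j ≤ suc (at κ₀ j)
      gr′ j with i ≟ j
      ... | yes refl = ≤-reflexive (trans (at-inc (addable-row κ add) κ) (cong suc (same j lt)))
      ... | no ne    = ≤-trans (≤-reflexive (at-inc-≢ ne κ)) (gr j)

-- Optimal paths from maximal strips

module Greedy {r : ℕ} (top : Vec ℕ r) (top-suc-≤ : ∀ i → at top (suc i) ≤ at top i) where
  open Paths top top-suc-≤

  -- `fillRows` adds the top box of every column of `top / κ`, the largest horizontal strip;
  -- `fillCols` adds the leftmost box of every row, the largest vertical strip.
  fillRows fillCols : State → State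
  fillRows κ = tab r (λ i → above κ i ⊓ at top i)
  fillCols κ = tab r (λ i → suc (at κ i) ⊓ at top i)

  at-fillRows : ∀ κ i → at (fillRows κ) i ≡ above κ i ⊓ at top i
  at-fillRows κ = at-tab r λ i le →
    trans (cong (above κ i ⊓_) (at-beyond top le)) (⊓-zeroʳ (above κ i))

  at-fillCols : ∀ κ i → at (fillCols κ) i ≡ suc (at κ i) ⊓ at top i
  at-fillCols κ = at-tab r λ i le →
    trans (cong (suc (at κ i) ⊓_) (at-beyond top le)) (⊓-zeroʳ (suc (at κ i)))

  ≤-fillRows : ∀ {κ} → Good κ → ∀ i → at κ i ≤ at (fillRows κ) i
  ≤-fillRows {κ} g i = ≤-trans (⊓-glb (le i) (below g i)) (≤-reflexive (sym (at-fillRows κ i)))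
    where
    le : ∀ i → at κ i ≤ above κ i
    le zero    = below g 0
    le (suc i) = decreasing g i

  ≤-fillCols : ∀ {κ} → Good κ → ∀ i → at κ i ≤ at (fillCols κ) i
  ≤-fillCols {κ} g i = ≤-trans (⊓-glb (n≤1+n _) (below g i)) (≤-reflexive (sym (at-fillCols κ i)))

  good-fillRows : ∀ {κ} → Good κ → Good (fillRows κ)
  good-fillRows {κ} g = good
    (λ i → subst₂ _≤_ (sym (at-fillRows κ (suc i))) (sym (at-fillRows κ i)) (⊓-mono-≤ (le i) (top-suc-≤ i)))
    (λ i → ≤-trans (≤-reflexive (at-fillRows κ i)) (m⊓n≤n (above κ i) (at top i)))
    where
    le : ∀ i → above κ (suc i) ≤ above κ i
    le zero    = below g 0
    le (suc i) = decreasing g i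

  good-fillCols : ∀ {κ} → Good κ → Good (fillCols κ)
  good-fillCols {κ} g = good
    (λ i → subst₂ _≤_ (sym (at-fillCols κ (suc i))) (sym (at-fillCols κ i))
      (⊓-mono-≤ (s≤s (decreasing g i)) (top-suc-≤ i)))
    (λ i → ≤-trans (≤-reflexive (at-fillCols κ i)) (m⊓n≤n (suc (at κ i)) (at top i)))

  -- Converse of `excessBeyond-row` for the largest strip. Row 0 becomes full and contributes
  -- nothing. Row `suc i` either reaches `at κ i`, and its term is the one shifted from row `i`, or
  -- is full.
  excessBeyond-fillRows : ∀ k l κ → excessBeyond k l (fillRows κ) ≤ excessBeyond (suc k) l κ
  excessBeyond-fillRows k l κ = go r refl
    where
    term : ∀ i → at top (suc i + k) ∸ (at (fillRows κ) (suc i) + l) ≤ at top (i + suc k) ∸ (at κ i + l)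
    term i with ⊓-sel (at κ i) (at top (suc i))
    ... | inj₁ eq = ∸-mono (≤-reflexive (cong (at top) (sym (+-suc i k))))
                      (+-monoˡ-≤ l (≤-reflexive (sym (trans (at-fillRows κ (suc i)) eq))))
    ... | inj₂ eq = ≤-trans (≤-reflexive (m≤n⇒m∸n≡0 (≤-trans (top-antitone (m≤m+n (suc i) k))
                      (≤-trans (≤-reflexive (sym (trans (at-fillRows κ (suc i)) eq))) (m≤m+n _ l))))) z≤n
    go : ∀ n → n ≡ r → Σ< n (λ i → at top (i + k) ∸ (at (fillRows κ) i + l)) ≤
                        Σ< n (λ i → at top (i + suc k) ∸ (at κ i + l))
    go zero    _ = z≤n
    go (suc n) _ = ≤-trans
      (+-mono-≤ (≤-reflexive (m≤n⇒m∸n≡0 (≤-trans (top-antitone z≤n)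
          (≤-trans (≤-reflexive (sym (trans (at-fillRows κ 0) (⊓-idem (at top 0))))) (m≤m+n _ l)))))
        (Σ<-mono n (λ i _ → term i)))
      (≤-trans (m≤m+n _ _) (≤-reflexive (sym (Σ<-last n _))))

  excessBeyond-fillCols : ∀ l κ → excessBeyond 0 l (fillCols κ) ≤ excessBeyond 0 (suc l) κ
  excessBeyond-fillCols l κ = Σ<-mono r λ i _ → term i
    where
    term : ∀ i → at top (i + 0) ∸ (at (fillCols κ) i + l) ≤ at top (i + 0) ∸ (at κ i + suc l)
    term i with ⊓-sel (suc (at κ i)) (at top i)
    ... | inj₁ eq = ∸-monoʳ-≤ (at top (i + 0)) (≤-reflexive
          (trans (+-suc (at κ i) l) (cong (_+ l) (sym (trans (at-fillCols κ i) eq)))))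
    ... | inj₂ eq = ≤-trans (≤-reflexive (m≤n⇒m∸n≡0 (≤-trans (top-antitone (m≤m+n i 0))
          (≤-trans (≤-reflexive (sym (trans (at-fillCols κ i) eq))) (m≤m+n _ l))))) z≤n

  descents-true : ∀ {s i} p → s ≤ i → descents s (i ∷ p) ≡ true ∷ descents (suc i) p
  descents-true {s} {i} p le = cong (_∷ descents (suc i) p) (dec-true (s ≤? i) le)

  descents-false : ∀ {s i} p → i < s → descents s (i ∷ p) ≡ false ∷ descents (suc i) p
  descents-false {s} {i} p lt = cong (_∷ descents (suc i) p) (dec-false (s ≤? i) (<⇒≱ lt))

  inc-≤ : ∀ (κ κ′ : State) {i} → i < r → (∀ j → at κ j ≤ at κ′ j) → at κ i < at κ′ i → ∀ j → at (inc i κ) j ≤ at κ′ j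
  inc-≤ κ κ′ {i} i<r le lt j with i ≟ j
  ... | yes refl = ≤-trans (≤-reflexive (at-inc i<r κ)) lt
  ... | no ne    = ≤-trans (≤-reflexive (at-inc-≢ ne κ)) (le j)

  total-mono : ∀ (κ κ′ : State) → (∀ j → at κ j ≤ at κ′ j) → total κ ≤ total κ′
  total-mono κ κ′ le = Σ<-mono r (λ j _ → le j)

  -- `n` is the number of boxes of `κ′ / κ` still to be added; it is the decreasing argument of
  -- `rowPath` and `colPath`.
  advance : ∀ n (κ κ′ : State) {i} → n + total κ ≡ total κ′ → i < r → (∀ j → at (inc i κ) j ≤ at κ′ j) →
    ∃[ m ] n ≡ suc m × m + total (inc i κ) ≡ total κ′
  advance zero κ κ′ eq i<r le = contradiction (total-mono (inc _ κ) κ′ le)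
    (<⇒≱ (≤-reflexive (trans (cong suc (sym eq)) (sym (total-inc i<r κ)))))
  advance (suc m) κ κ′ eq i<r le = m , refl , trans (cong (m +_) (total-inc i<r κ)) (trans (+-suc m (total κ)) eq)

  same-state : ∀ {κ κ′ : State} → (∀ j → at κ j ≤ at κ′ j) → (∀ j → j < r → ¬ at κ j < at κ′ j) → κ ≡ κ′
  same-state {κ} {κ′} le none = at-ext λ j → [ (λ lt → ≤-antisym (le j) (≮⇒≥ (none j lt)))
    , (λ ge → trans (at-beyond κ ge) (sym (at-beyond κ′ ge))) ]′ (<-≤-connex j r)

  -- Row 0 is capped by `top` alone, and a full row leaves the next one no cap but `top`. So once
  -- the strip is complete, no row above `s` is addable: the next box makes a descent, and the run
  -- ends where the strip ends.
  full-rows : ∀ {κ s} → (∀ j → j < s → at κ j ≡ above κ j ⊓ at top j) → ∀ j → j < s → at κ j ≡ at top j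
  full-rows eq zero    lt = trans (eq 0 lt) (⊓-idem (at top 0))
  full-rows {κ} eq (suc j) lt = trans (eq (suc j) lt)
    (trans (cong (_⊓ at top (suc j)) (full-rows {κ} eq j (<-trans (n<1+n j) lt))) (m≥n⇒m⊓n≡n (top-suc-≤ j)))

  -- The boxes are added from the lowest row upwards.
  rowPath : ∀ n s κ {κ′ q} → n + total κ ≡ total κ′ → (∀ j → at κ j ≤ at κ′ j) →
    (∀ j → s ≤ j → at κ j ≡ at κ′ j) → (∀ j → j < s → at κ′ j ≡ above κ j ⊓ at top j) → Path κ′ q →
    ∃[ p ] Path κ p × (∀ k l → leftover (suc k) l (descents s p) ≡ remaining k l (descentWord q))
  rowPath n s κ {κ′} {q} eq le fixed cap π with find-max r (λ i → at κ i <? at κ′ i)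
  ... | inj₂ none with same-state {κ} {κ′} le none
  ...   | refl = q , π , finish π
    where
    finish : ∀ {q} → Path κ q → ∀ k l → leftover (suc k) l (descents s q) ≡ remaining k l (descentWord q)
    finish done k l = refl
    finish {i ∷ q} (step add _) k l = cong (leftover (suc k) l) (descents-true q (≮⇒≥ λ i<s →
      <⇒≢ (proj₁ add) (full-rows {κ} cap i i<s)))
  rowPath n s κ {κ′} {q} eq le fixed cap π | inj₁ (i , i<r , lt , greatest)
    with advance n κ κ′ eq i<r (inc-≤ κ κ′ i<r le lt)
  ... | m , refl , eq′ =
    let p , π′ , rem = rowPath m (suc i) (inc i κ) eq′ (inc-≤ κ κ′ i<r le lt) fixed′ cap′ π
    in i ∷ p , step add π′ , λ k l → trans (cong (leftover (suc k) l) (descents-false p i<s)) (rem k l)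
    where
    i<s : i < s
    i<s = ≰⇒> λ s≤i → <⇒≢ lt (fixed i s≤i)
    fixed′ : ∀ j → i < j → at (inc i κ) j ≡ at κ′ j
    fixed′ j i<j = trans (at-inc-≢ (<⇒≢ i<j) κ) ([ (λ j<r → ≤-antisym (le j) (≮⇒≥ (greatest j i<j j<r)))
      , (λ ge → trans (at-beyond κ ge) (sym (at-beyond κ′ ge))) ]′ (<-≤-connex j r))
    above-inc : ∀ j → j ≤ i → above (inc i κ) j ≡ above κ j
    above-inc zero    _   = refl
    above-inc (suc j) j<i = at-inc-≢ (>⇒≢ j<i) κ
    cap′ : ∀ j → j < suc i → at κ′ j ≡ above (inc i κ) j ⊓ at top j
    cap′ j j≤i = trans (cap j (≤-trans j≤i i<s)) (cong (_⊓ at top j) (sym (above-inc j (s≤s⁻¹ j≤i))))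
    lt′ : at κ i < above κ i ⊓ at top i
    lt′ = <-≤-trans lt (≤-reflexive (cap i i<s))
    add : Addable κ i
    add = <-≤-trans lt′ (m⊓n≤n (above κ i) (at top i)) , <-≤-trans lt′ (m⊓n≤m (above κ i) (at top i))

  -- The boxes are added from the top row downwards, so every letter is a descent. When the strip is
  -- complete, an addable row `i ≥ s` would contradict `cap`; the next box therefore lies above `s`,
  -- and its letter `false` ends the run.
  colPath : ∀ n s κ {κ′ q} → Good κ′ → n + total κ ≡ total κ′ → (∀ j → at κ j ≤ at κ′ j) →
    (∀ j → j < s → at κ j ≡ at κ′ j) → (∀ j → s ≤ j → at κ′ j ≡ suc (at κ j) ⊓ at top j) → Path κ′ q →
    ∃[ p ] Path κ p × (∀ l → leftover 0 (suc l) (descents s p) ≡ remaining 0 l (descentWord q))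
  colPath n s κ {κ′} {q} g′ eq le fixed cap π with find-min r (λ i → at κ i <? at κ′ i)
  ... | inj₂ none with same-state {κ} {κ′} le none
  ...   | refl = q , π , finish π
    where
    finish : ∀ {q} → Path κ q → ∀ l → leftover 0 (suc l) (descents s q) ≡ remaining 0 l (descentWord q)
    finish done l = refl
    finish {i ∷ q} (step add _) l = cong (leftover 0 (suc l)) (descents-false q (≰⇒> λ s≤i →
      <⇒≢ (n<1+n (at κ i)) (trans (cap i s≤i) (m≤n⇒m⊓n≡m (proj₁ add)))))
  colPath n s κ {κ′} {q} g′ eq le fixed cap π | inj₁ (i , i<r , lt , least)
    with advance n κ κ′ eq i<r (inc-≤ κ κ′ i<r le lt)
  ... | m , refl , eq′ =
    let p , π′ , rem = colPath m (suc i) (inc i κ) g′ eq′ (inc-≤ κ κ′ i<r le lt) fixed′ cap′ π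
    in i ∷ p , step (<-≤-trans lt (below g′ i) , free i lt least) π′
       , λ l → trans (cong (leftover 0 (suc l)) (descents-true p s≤i)) (rem l)
    where
    s≤i : s ≤ i
    s≤i = ≮⇒≥ λ i<s → <⇒≢ lt (fixed i i<s)
    fixed′ : ∀ j → j < suc i → at (inc i κ) j ≡ at κ′ j
    fixed′ j j≤i with i ≟ j
    ... | yes refl = trans (at-inc i<r κ)
          (≤-antisym lt (≤-trans (≤-reflexive (cap i s≤i)) (m⊓n≤m (suc (at κ i)) (at top i))))
    ... | no ne    = trans (at-inc-≢ ne κ) (≤-antisym (le j) (≮⇒≥ (least j (≤∧≢⇒< (s≤s⁻¹ j≤i) (ne ∘ sym)))))
    cap′ : ∀ j → suc i ≤ j → at κ′ j ≡ suc (at (inc i κ) j) ⊓ at top j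
    cap′ j i<j = trans (cap j (≤-trans s≤i (<⇒≤ i<j)))
      (cong (λ x → suc x ⊓ at top j) (sym (at-inc-≢ (<⇒≢ i<j) κ)))
    free : ∀ i → at κ i < at κ′ i → (∀ j → j < i → ¬ at κ j < at κ′ j) → at κ i < above κ i
    free zero    lt _     = <-≤-trans lt (below g′ 0)
    free (suc i) lt least = <-≤-trans lt (≤-trans (decreasing g′ i) (≮⇒≥ (least i (n<1+n i))))

  -- `remaining` ignores the letter of the first box, `rowPath` does not. With the threshold `r`
  -- that letter is `false`, which a run without descents skips; in `col-step` the threshold 0 makes
  -- it `true`.
  row-step : ∀ {κ q} → Good κ → Path (fillRows κ) q →
    ∃[ p ] Path κ p × (∀ k l → remaining (suc k) l (descentWord p) ≡ remaining k l (descentWord q))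
  row-step {κ} g π
    with rowPath (total (fillRows κ) ∸ total κ) r κ (m∸n+n≡m (total-mono κ (fillRows κ) (≤-fillRows g))) (≤-fillRows g)
           (λ j ge → trans (at-beyond κ ge) (sym (at-beyond (fillRows κ) ge))) (λ j _ → at-fillRows κ j) π
  ... | p , π′ , rem = p , π′ , λ k l → trans (first π′ k l) (rem k l)
    where
    first : ∀ {p} → Path κ p → ∀ k l → remaining (suc k) l (descentWord p) ≡ leftover (suc k) l (descents r p)
    first done k l = refl
    first {i ∷ p} (step add _) k l = sym (cong (leftover (suc k) l) (descents-false p (addable-row κ add)))

  col-step : ∀ {κ q} → Good κ → Path (fillCols κ) q →
    ∃[ p ] Path κ p × (∀ l → remaining 0 (suc l) (descentWord p) ≡ remaining 0 l (descentWord q))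
  col-step {κ} g π
    with colPath (total (fillCols κ) ∸ total κ) 0 κ (good-fillCols g)
           (m∸n+n≡m (total-mono κ (fillCols κ) (≤-fillCols g))) (≤-fillCols g)
           (λ j ()) (λ j _ → at-fillCols κ j) π
  ... | p , π′ , rem = p , π′ , λ l → trans (first p l) (rem l)
    where
    first : ∀ p l → remaining 0 (suc l) (descentWord p) ≡ leftover 0 (suc l) (descents 0 p)
    first []      l = refl
    first (i ∷ p) l = sym (cong (leftover 0 (suc l)) (descents-true p z≤n))

  remaining-path : ∀ {κ p} → Good κ → Path κ p → remaining 0 0 (descentWord p) ≤ excessBeyond 0 0 κ
  remaining-path {p = p} g π = ≤-reflexive
    (trans (remaining-0-0 (descentWord p)) (trans (length-descentWord p) (path-length g π)))

  -- Vertical strips are filled until `top` is reached. Each adds a box, so `n` bounds the number of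
  -- rounds.
  greedyCols : ∀ n {κ} → Good κ → total top ≤ n + total κ →
    ∃[ p ] Path κ p × (∀ l → remaining 0 l (descentWord p) ≤ excessBeyond 0 l κ)
  greedyCols n {κ} g bound with find-min r (λ i → at κ i <? at top i)
  ... | inj₂ none with same-state {κ} {top} (below g) none
  ...   | refl = [] , done , λ _ → z≤n
  greedyCols zero {κ} g bound | inj₁ (i , i<r , lt , _) =
    contradiction (≤-trans (total-mono (inc i κ) top (inc-≤ κ top i<r (below g) lt)) bound)
      (<⇒≱ (≤-reflexive (sym (total-inc i<r κ))))
  greedyCols (suc n) {κ} g bound | inj₁ (i , i<r , lt , _) = let
      p′ , π′ , bd′ = greedyCols n (good-fillCols g) bound′
      p , π , rem = col-step g π′
    in p , π , λ { zero → remaining-path g π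
                 ; (suc l) → ≤-trans (≤-reflexive (rem l)) (≤-trans (bd′ l) (excessBeyond-fillCols l κ)) }
    where
    lt′ : at κ i < at (fillCols κ) i
    lt′ = ≤-trans (⊓-glb ≤-refl lt) (≤-reflexive (sym (at-fillCols κ i)))
    bound′ : total top ≤ n + total (fillCols κ)
    bound′ = ≤-trans bound (≤-trans (≤-reflexive (trans (sym (+-suc n (total κ))) (cong (n +_) (sym (total-inc i<r κ)))))
      (+-monoʳ-≤ n (total-mono (inc i κ) (fillCols κ) (inc-≤ κ (fillCols κ) i<r (≤-fillCols g) lt′))))

  -- A single path leaves as little as possible after j ≤ k runs without
  -- descents, and also after k such runs followed by any number of runs of descents.
  greedy : ∀ k {κ} → Good κ → ∃[ p ] Path κ p
    × (∀ j → j ≤ k → remaining j 0 (descentWord p) ≤ excessBeyond j 0 κ)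
    × (∀ l → remaining k l (descentWord p) ≤ excessBeyond k l κ)
  greedy zero {κ} g = let p , π , bd = greedyCols (total top) g (m≤m+n (total top) (total κ))
    in p , π , (λ { zero _ → remaining-path g π }) , bd
  greedy (suc k) {κ} g = let
      p′ , π′ , bdⱼ , bdₗ = greedy k (good-fillRows g)
      p , π , rem = row-step g π′
    in p , π
     , (λ { zero _ → remaining-path g π
          ; (suc j) (s≤s le) → ≤-trans (≤-reflexive (rem j 0)) (≤-trans (bdⱼ j le) (excessBeyond-fillRows j 0 κ)) })
     , λ l → ≤-trans (≤-reflexive (rem k l)) (≤-trans (bdₗ l) (excessBeyond-fillRows k l κ))

-- Finite sums of integers

Σℤ : {I : Set} → List I → (I → ℤ) → ℤ
Σℤ is f = foldr ℤ._+_ 0ℤ (map f is)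

𝟙ℤ : Bool → ℤ
𝟙ℤ b = if b then 1ℤ else 0ℤ

ℤ-interchange : ∀ a b c d → (a ℤ.+ b) ℤ.+ (c ℤ.+ d) ≡ (a ℤ.+ c) ℤ.+ (b ℤ.+ d)
ℤ-interchange = solve-∀

ℤ-interchange-minus : ∀ a b c d → (a ℤ.- b) ℤ.+ (c ℤ.- d) ≡ (a ℤ.+ c) ℤ.- (b ℤ.+ d)
ℤ-interchange-minus = solve-∀

module _ {I : Set} where

  Σℤ-cong : ∀ is {f g : I → ℤ} → (∀ i → i ∈ is → f i ≡ g i) → Σℤ is f ≡ Σℤ is g
  Σℤ-cong []       eq = refl
  Σℤ-cong (i ∷ is) eq = cong₂ ℤ._+_ (eq i (here refl)) (Σℤ-cong is (λ j j∈ → eq j (there j∈)))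

  Σℤ-zero : ∀ is {f : I → ℤ} → (∀ i → i ∈ is → f i ≡ 0ℤ) → Σℤ is f ≡ 0ℤ
  Σℤ-zero []       eq = refl
  Σℤ-zero (i ∷ is) eq = cong₂ ℤ._+_ (eq i (here refl)) (Σℤ-zero is (λ j j∈ → eq j (there j∈)))

  Σℤ-+ : ∀ is (f g : I → ℤ) → Σℤ is (λ i → f i ℤ.+ g i) ≡ Σℤ is f ℤ.+ Σℤ is g
  Σℤ-+ []       f g = refl
  Σℤ-+ (i ∷ is) f g = trans (cong ((f i ℤ.+ g i) ℤ.+_) (Σℤ-+ is f g))
                            (ℤ-interchange (f i) (g i) (Σℤ is f) (Σℤ is g))

  Σℤ-minus : ∀ is (f g : I → ℤ) → Σℤ is (λ i → f i ℤ.- g i) ≡ Σℤ is f ℤ.- Σℤ is g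
  Σℤ-minus []       f g = refl
  Σℤ-minus (i ∷ is) f g = trans (cong ((f i ℤ.- g i) ℤ.+_) (Σℤ-minus is f g))
                                (ℤ-interchange-minus (f i) (g i) (Σℤ is f) (Σℤ is g))

  Σℤ-* : ∀ c is (f : I → ℤ) → Σℤ is (λ i → c ℤ.* f i) ≡ c ℤ.* Σℤ is f
  Σℤ-* c []       f = sym (ℤ.*-zeroʳ c)
  Σℤ-* c (i ∷ is) f = trans (cong ((c ℤ.* f i) ℤ.+_) (Σℤ-* c is f)) (sym (ℤ.*-distribˡ-+ c (f i) (Σℤ is f)))

  Σℤ-++ : ∀ is js (f : I → ℤ) → Σℤ (is ++ js) f ≡ Σℤ is f ℤ.+ Σℤ js f
  Σℤ-++ []       js f = sym (ℤ.+-identityˡ _)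
  Σℤ-++ (i ∷ is) js f = trans (cong (f i ℤ.+_) (Σℤ-++ is js f)) (sym (ℤ.+-assoc (f i) _ _))

  Σℤ-↭ : ∀ {is js} (f : I → ℤ) → is ↭ js → Σℤ is f ≡ Σℤ js f
  Σℤ-↭ f ↭.refl         = refl
  Σℤ-↭ f (↭.prep i p)   = cong (f i ℤ.+_) (Σℤ-↭ f p)
  Σℤ-↭ f (↭.swap {xs = xs} {ys = ys} i j p) = trans (cong (λ x → f i ℤ.+ (f j ℤ.+ x)) (Σℤ-↭ f p))
    (exchange (f i) (f j) (Σℤ ys f))
    where
    exchange : ∀ x y z → x ℤ.+ (y ℤ.+ z) ≡ y ℤ.+ (x ℤ.+ z)
    exchange = solve-∀
  Σℤ-↭ f (↭.trans p q) = trans (Σℤ-↭ f p) (Σℤ-↭ f q)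

  Σℤ-filter : ∀ {P : Pred I 0ℓ} (P? : Decidable P) is (f : I → ℤ) →
    Σℤ (filter P? is) f ≡ Σℤ is (λ i → 𝟙ℤ (does (P? i)) ℤ.* f i)
  Σℤ-filter P? []       f = refl
  Σℤ-filter P? (i ∷ is) f with does (P? i)
  ... | true  = cong₂ ℤ._+_ (sym (ℤ.*-identityˡ (f i))) (Σℤ-filter P? is f)
  ... | false = trans (Σℤ-filter P? is f) (sym (ℤ.+-identityˡ _))

  Σℤ-≢0 : ∀ is {f : I → ℤ} → Σℤ is f ≢ 0ℤ → ∃[ i ] i ∈ is × f i ≢ 0ℤ
  Σℤ-≢0 is {f} ne with Any.any? (λ i → ¬? (f i ℤ.≟ 0ℤ)) is
  ... | yes some = find some
  ... | no none  = contradiction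
    (Σℤ-zero is (λ i i∈ → decidable-stable (f i ℤ.≟ 0ℤ) (λ nz → none (lose i∈ nz)))) ne

  Σℤ-nonneg : ∀ is {f : I → ℤ} → (∀ i → 0ℤ ℤ.≤ f i) → 0ℤ ℤ.≤ Σℤ is f
  Σℤ-nonneg []       nn = ℤ.≤-refl
  Σℤ-nonneg (i ∷ is) nn = ℤ.+-mono-≤ (nn i) (Σℤ-nonneg is nn)

  Σℤ-pos : ∀ is {f : I → ℤ} → (∀ i → 0ℤ ℤ.≤ f i) → ∀ {i} → i ∈ is → 0ℤ ℤ.< f i → 0ℤ ℤ.< Σℤ is f
  Σℤ-pos (i ∷ is) nn (here refl) pos = ℤ.+-mono-<-≤ pos (Σℤ-nonneg is nn)
  Σℤ-pos (i ∷ is) nn (there i∈)  pos = ℤ.+-mono-≤-< (nn i) (Σℤ-pos is nn i∈ pos)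

  Σℤ-single : ∀ {is} → Unique is → {f : I → ℤ} → ∀ {i} → i ∈ is →
    (∀ j → j ∈ is → j ≢ i → f j ≡ 0ℤ) → Σℤ is f ≡ f i
  Σℤ-single {i ∷ is} (i∉ ∷ u) {f} (here refl) z = trans
    (cong (f i ℤ.+_) (Σℤ-zero is (λ j j∈ → z j (there j∈) (λ j≡i → All.lookup i∉ j∈ (sym j≡i)))))
    (ℤ.+-identityʳ (f i))
  Σℤ-single {j ∷ is} (j∉ ∷ u) {f} (there i∈) z = trans
    (cong₂ ℤ._+_ (z j (here refl) (All.lookup j∉ i∈)) (Σℤ-single u i∈ (λ k k∈ → z k (there k∈))))
    (ℤ.+-identityˡ _)

module _ {I J : Set} where

  Σℤ-swap : ∀ is js (f : I → J → ℤ) →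
    Σℤ is (λ i → Σℤ js (f i)) ≡ Σℤ js (λ j → Σℤ is (λ i → f i j))
  Σℤ-swap []       js f = sym (Σℤ-zero js (λ _ _ → refl))
  Σℤ-swap (i ∷ is) js f = trans (cong (Σℤ js (f i) ℤ.+_) (Σℤ-swap is js f))
                                (sym (Σℤ-+ js (f i) (λ j → Σℤ is (λ i → f i j))))

  Σℤ-map : ∀ (g : I → J) is (f : J → ℤ) → Σℤ (map g is) f ≡ Σℤ is (f ∘ g)
  Σℤ-map g is f = cong (foldr ℤ._+_ 0ℤ) (sym (List.map-∘ is))

  Σℤ-concatMap : ∀ (g : I → List J) is (f : J → ℤ) → Σℤ (concatMap g is) f ≡ Σℤ is (λ i → Σℤ (g i) f)
  Σℤ-concatMap g []       f = refl
  Σℤ-concatMap g (i ∷ is) f = trans (Σℤ-++ (g i) (concatMap g is) f) (cong (Σℤ (g i) f ℤ.+_) (Σℤ-concatMap g is f))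

Unique-resp-↭ : {I : Set} {is js : List I} → is ↭ js → Unique is → Unique js
Unique-resp-↭ {I} p = ↭ₛ.Unique-resp-↭ (setoid I) (↭⇒↭ₛ p)

∈⇒↭ : {I : Set} {i : I} {is : List I} → i ∈ is → ∃[ js ] is ↭ i ∷ js
∈⇒↭ {is = i ∷ is} (here refl) = is , ↭.refl
∈⇒↭ {is = j ∷ is} (there i∈)  with ∈⇒↭ i∈
... | js , p = j ∷ js , ↭.trans (↭.prep j p) (↭.swap j _ ↭.refl)

-- The bijection is a relation because a tableau and its path are matched by a property that makes
-- sense for arbitrary fillings. The first element and its partner are removed together.
Σℤ-bijection : {X Y : Set} (R : X → Y → Set) → ∀ {xs ys} → Unique xs → Unique ys →
  (∀ x → x ∈ xs → ∃[ y ] y ∈ ys × R x y) → (∀ y → y ∈ ys → ∃[ x ] x ∈ xs × R x y) →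
  (∀ {x y y′} → x ∈ xs → y ∈ ys → y′ ∈ ys → R x y → R x y′ → y ≡ y′) →
  (∀ {x x′ y} → x ∈ xs → x′ ∈ xs → y ∈ ys → R x y → R x′ y → x ≡ x′) →
  {f : X → ℤ} {g : Y → ℤ} → (∀ {x y} → x ∈ xs → y ∈ ys → R x y → f x ≡ g y) → Σℤ xs f ≡ Σℤ ys g
Σℤ-bijection R {[]} {[]}     ux uy to from fun inj eq = refl
Σℤ-bijection R {[]} {y ∷ ys} ux uy to from fun inj eq with from y (here refl)
... | _ , () , _
Σℤ-bijection R {x ∷ xs} {ys} (x∉ ∷ ux) uy to from fun inj {f} {g} eq with to x (here refl)
... | y , y∈ , Rxy with ∈⇒↭ y∈
...   | zs , p with Unique-resp-↭ p uy
...     | y∉ ∷ uz = trans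
  (cong₂ ℤ._+_ (eq (here refl) y∈ Rxy)
    (Σℤ-bijection R ux uz to′ from′
      (λ a b c → fun (there a) (back b) (back c)) (λ a b c → inj (there a) (there b) (back c))
      (λ a b → eq (there a) (back b))))
  (sym (Σℤ-↭ g p))
  where
  back : ∀ {z} → z ∈ zs → z ∈ ys
  back z∈ = ↭.∈-resp-↭ (↭-sym p) (there z∈)
  to′ : ∀ x′ → x′ ∈ xs → ∃[ z ] z ∈ zs × R x′ z
  to′ x′ x′∈ with to x′ (there x′∈)
  ... | z , z∈ , Rx′z with ↭.∈-resp-↭ p z∈
  ...   | there z∈′ = z , z∈′ , Rx′z
  ...   | here refl = contradiction (inj (here refl) (there x′∈) y∈ Rxy Rx′z) (All.lookup x∉ x′∈)
  from′ : ∀ z → z ∈ zs → ∃[ x′ ] x′ ∈ xs × R x′ z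
  from′ z z∈ with from z (back z∈)
  ... | x′ , there x′∈ , Rx′z = x′ , x′∈ , Rx′z
  ... | _  , here refl , Rxz  = contradiction (fun (here refl) y∈ (back z∈) Rxy Rxz) (All.lookup y∉ z∈)

-- Extracting coefficients of fundamental quasisymmetric functions

-- The alternating sum of `g` over the words obtained from the argument by turning letters `true`
-- into `false`: Möbius inversion in the Boolean lattice.
möbius : (List Bool → ℤ) → List Bool → ℤ
möbius g []          = g []
möbius g (false ∷ v) = möbius (g ∘ (false ∷_)) v
möbius g (true ∷ v)  = möbius (g ∘ (true ∷_)) v ℤ.- möbius (g ∘ (false ∷_)) v

möbius-cong : ∀ {g h} → (∀ v → g v ≡ h v) → ∀ w → möbius g w ≡ möbius h w
möbius-cong eq []          = eq []
möbius-cong eq (false ∷ w) = möbius-cong (eq ∘ (false ∷_)) w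
möbius-cong eq (true ∷ w)  = cong₂ ℤ._-_ (möbius-cong (eq ∘ (true ∷_)) w) (möbius-cong (eq ∘ (false ∷_)) w)

möbius-Σ : {I : Set} (is : List I) (g : I → List Bool → ℤ) → ∀ w →
  möbius (λ v → Σℤ is (λ i → g i v)) w ≡ Σℤ is (λ i → möbius (g i) w)
möbius-Σ is g []          = refl
möbius-Σ is g (false ∷ w) = möbius-Σ is (λ i → g i ∘ (false ∷_)) w
möbius-Σ is g (true ∷ w)  = trans
  (cong₂ ℤ._-_ (möbius-Σ is (λ i → g i ∘ (true ∷_)) w) (möbius-Σ is (λ i → g i ∘ (false ∷_)) w))
  (sym (Σℤ-minus is _ _))

möbius-* : ∀ c g w → möbius (λ v → c ℤ.* g v) w ≡ c ℤ.* möbius g w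
möbius-* c g []          = refl
möbius-* c g (false ∷ w) = möbius-* c (g ∘ (false ∷_)) w
möbius-* c g (true ∷ w)  = trans
  (cong₂ ℤ._-_ (möbius-* c (g ∘ (true ∷_)) w) (möbius-* c (g ∘ (false ∷_)) w))
  (distrib c (möbius (g ∘ (true ∷_)) w) (möbius (g ∘ (false ∷_)) w))
  where
  distrib : ∀ c x y → c ℤ.* x ℤ.- c ℤ.* y ≡ c ℤ.* (x ℤ.- y)
  distrib = solve-∀

_≤ʷ_ _≡ʷ_ : List Bool → List Bool → Bool
[]          ≤ʷ []          = true
[]          ≤ʷ (_ ∷ _)     = false
(_ ∷ _)     ≤ʷ []          = false
(false ∷ u) ≤ʷ (_ ∷ v)     = u ≤ʷ v
(true ∷ u)  ≤ʷ (true ∷ v)  = u ≤ʷ v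
(true ∷ u)  ≤ʷ (false ∷ v) = false

[]          ≡ʷ []          = true
[]          ≡ʷ (_ ∷ _)     = false
(_ ∷ _)     ≡ʷ []          = false
(false ∷ u) ≡ʷ (false ∷ v) = u ≡ʷ v
(true ∷ u)  ≡ʷ (true ∷ v)  = u ≡ʷ v
(false ∷ u) ≡ʷ (true ∷ v)  = false
(true ∷ u)  ≡ʷ (false ∷ v) = false

≡ʷ-refl : ∀ u → u ≡ʷ u ≡ true
≡ʷ-refl []          = refl
≡ʷ-refl (false ∷ u) = ≡ʷ-refl u
≡ʷ-refl (true ∷ u)  = ≡ʷ-refl u

≡ʷ⇒≡ : ∀ u v → u ≡ʷ v ≡ true → u ≡ v
≡ʷ⇒≡ []          []          _  = refl
≡ʷ⇒≡ (false ∷ u) (false ∷ v) eq = cong (false ∷_) (≡ʷ⇒≡ u v eq)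
≡ʷ⇒≡ (true ∷ u)  (true ∷ v)  eq = cong (true ∷_) (≡ʷ⇒≡ u v eq)

≤ʷ-antisym : ∀ u v → u ≤ʷ v ≡ true → v ≤ʷ u ≡ true → u ≡ v
≤ʷ-antisym []          []          _  _  = refl
≤ʷ-antisym (false ∷ u) (false ∷ v) le ge = cong (false ∷_) (≤ʷ-antisym u v le ge)
≤ʷ-antisym (true ∷ u)  (true ∷ v)  le ge = cong (true ∷_) (≤ʷ-antisym u v le ge)

möbius-const-0 : ∀ w → möbius (λ _ → 0ℤ) w ≡ 0ℤ
möbius-const-0 []          = refl
möbius-const-0 (false ∷ w) = möbius-const-0 w
möbius-const-0 (true ∷ w)  = cong₂ ℤ._-_ (möbius-const-0 w) (möbius-const-0 w)

-- Where `w` has `true`, a letter `false` of `u` makes the two branches cancel, and a letter `true`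
-- leaves only the first branch.
möbius-≤ʷ : ∀ u w → möbius (λ v → 𝟙ℤ (u ≤ʷ v)) w ≡ 𝟙ℤ (u ≡ʷ w)
möbius-≤ʷ []          []          = refl
möbius-≤ʷ []          (false ∷ w) = möbius-const-0 w
möbius-≤ʷ []          (true ∷ w)  = cong₂ ℤ._-_ (möbius-const-0 w) (möbius-const-0 w)
möbius-≤ʷ (_ ∷ u)     []          = refl
möbius-≤ʷ (false ∷ u) (false ∷ w) = möbius-≤ʷ u w
möbius-≤ʷ (true ∷ u)  (false ∷ w) = möbius-const-0 w
möbius-≤ʷ (false ∷ u) (true ∷ w)  = ℤ.+-inverseʳ (möbius (λ v → 𝟙ℤ (u ≤ʷ v)) w)
möbius-≤ʷ (true ∷ u)  (true ∷ w)  = trans (cong₂ ℤ._-_ (möbius-≤ʷ u w) (möbius-const-0 w)) (ℤ.+-identityʳ _)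

-- Words as compositions, and the values of fundamental quasisymmetric functions

fromLetters : List Bool → Composition
fromLetters []          = mkComposition (1 ∷ []) (_ ∷ [])
fromLetters (true ∷ v)  = newPart (fromLetters v)
fromLetters (false ∷ v) = growPart (fromLetters v)

-- The first letter is ignored, as in descentWord.
fromWord : List Bool → Composition
fromWord []      = mkComposition [] []
fromWord (_ ∷ v) = fromLetters v

fromLetters-nonEmpty : ∀ v → ∃[ a ] ∃[ as ] parts (fromLetters v) ≡ a ∷ as
fromLetters-nonEmpty []          = 1 , [] , refl
fromLetters-nonEmpty (true ∷ v)  = _ , _ , refl
fromLetters-nonEmpty (false ∷ v) with fromLetters v
... | mkComposition []      _ = _ , _ , refl
... | mkComposition (_ ∷ _) _ = _ , _ , refl

size-growPart : ∀ α → ∣ growPart α ∣ ≡ suc ∣ α ∣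
size-growPart (mkComposition []      _) = refl
size-growPart (mkComposition (_ ∷ _) _) = refl

size-fromLetters : ∀ v → ∣ fromLetters v ∣ ≡ suc (length v)
size-fromLetters []          = refl
size-fromLetters (true ∷ v)  = cong suc (size-fromLetters v)
size-fromLetters (false ∷ v) = trans (size-growPart (fromLetters v)) (cong suc (size-fromLetters v))

letters : List Bool → List ℕ
letters []          = []
letters (true ∷ v)  = 1 ∷ map suc (letters v)
letters (false ∷ v) = map suc (letters v)

partialSums-suc : ∀ a as → partialSums (suc a ∷ as) ≡ map suc (partialSums (a ∷ as))
partialSums-suc a []       = refl
partialSums-suc a (b ∷ as) = cong (suc a ∷_) (List.map-∘ (partialSums (b ∷ as)))

S-fromLetters : ∀ v → S (fromLetters v) ≡ letters v
S-fromLetters []          = refl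
S-fromLetters (true ∷ v)  with fromLetters v | fromLetters-nonEmpty v | S-fromLetters v
... | mkComposition (_ ∷ _) _ | _ , _ , refl | ih = cong (λ xs → 1 ∷ map suc xs) ih
S-fromLetters (false ∷ v) with fromLetters v | fromLetters-nonEmpty v | S-fromLetters v
... | mkComposition (a ∷ as) _ | _ , _ , refl | ih = trans (partialSums-suc a as) (cong (map suc) ih)

0∉letters : ∀ v → 0 ∉ letters v
0∉letters (true ∷ v)  (there 0∈) with ∈.∈-map⁻ suc 0∈
... | _ , _ , ()
0∉letters (false ∷ v) 0∈ with ∈.∈-map⁻ suc 0∈
... | _ , _ , ()

letters-suc⁺ : ∀ b v {x} → x ∈ letters v → suc x ∈ letters (b ∷ v)
letters-suc⁺ true  v x∈ = there (∈.∈-map⁺ suc x∈)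
letters-suc⁺ false v x∈ = ∈.∈-map⁺ suc x∈

letters-suc⁻ : ∀ b v {x} → x ≢ 0 → suc x ∈ letters (b ∷ v) → x ∈ letters v
letters-suc⁻ true  v x≢0 (here refl) = contradiction refl x≢0
letters-suc⁻ true  v x≢0 (there x∈) with ∈.∈-map⁻ suc x∈
... | _ , x∈′ , refl = x∈′
letters-suc⁻ false v x≢0 x∈ with ∈.∈-map⁻ suc x∈
... | _ , x∈′ , refl = x∈′

≤ʷ⇒⊆ : ∀ u v → u ≤ʷ v ≡ true → letters u ⊆ letters v
≤ʷ⇒⊆ []          []          _  x∈ = x∈
≤ʷ⇒⊆ (false ∷ u) (b ∷ v)     le x∈ with ∈.∈-map⁻ suc x∈
... | _ , x∈′ , refl = letters-suc⁺ b v (≤ʷ⇒⊆ u v le x∈′)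
≤ʷ⇒⊆ (true ∷ u)  (true ∷ v)  le (here refl) = here refl
≤ʷ⇒⊆ (true ∷ u)  (true ∷ v)  le (there x∈) with ∈.∈-map⁻ suc x∈
... | _ , x∈′ , refl = letters-suc⁺ true v (≤ʷ⇒⊆ u v le x∈′)

⊆⇒≤ʷ : ∀ u v → length u ≡ length v → letters u ⊆ letters v → u ≤ʷ v ≡ true
⊆⇒≤ʷ []          []          _  _   = refl
⊆⇒≤ʷ (true ∷ u)  (false ∷ v) _  sub with ∈.∈-map⁻ suc (sub (here refl))
... | _ , 0∈ , refl = contradiction 0∈ (0∉letters v)
⊆⇒≤ʷ (false ∷ u) (b ∷ v)     eq sub = ⊆⇒≤ʷ u v (suc-injective eq) λ x∈ →
  letters-suc⁻ b v (λ { refl → 0∉letters u x∈ }) (sub (letters-suc⁺ false u x∈))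
⊆⇒≤ʷ (true ∷ u)  (true ∷ v)  eq sub = ⊆⇒≤ʷ u v (suc-injective eq) λ x∈ →
  letters-suc⁻ true v (λ { refl → 0∉letters u x∈ }) (sub (letters-suc⁺ true u x∈))

S-⊆-≤ʷ : ∀ u v → length u ≡ length v → does (_⊆?_ _≟_ (S (fromLetters u)) (S (fromLetters v))) ≡ u ≤ʷ v
S-⊆-≤ʷ u v eq with u ≤ʷ v in le
... | true  = dec-true (_⊆?_ _≟_ (S (fromLetters u)) (S (fromLetters v)))
  (subst₂ _⊆_ (sym (S-fromLetters u)) (sym (S-fromLetters v)) (≤ʷ⇒⊆ u v le))
... | false = dec-false (_⊆?_ _≟_ (S (fromLetters u)) (S (fromLetters v)))
  λ sub → contradiction (trans (sym le) (⊆⇒≤ʷ u v eq (subst₂ _⊆_ (S-fromLetters u) (S-fromLetters v) sub))) λ ()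

fromLetters-injective : ∀ u v → parts (fromLetters u) ≡ parts (fromLetters v) → u ≡ v
fromLetters-injective u v eq = ≤ʷ-antisym u v (sub u v eq) (sub v u (sym eq))
  where
  sub : ∀ u v → parts (fromLetters u) ≡ parts (fromLetters v) → u ≤ʷ v ≡ true
  sub u v eq = ⊆⇒≤ʷ u v
    (suc-injective (trans (sym (size-fromLetters u)) (trans (cong sum eq) (size-fromLetters v))))
    (subst₂ _⊆_ (S-fromLetters u) (trans (cong partialSums eq) (S-fromLetters v)) id)

parts-≡ʷ : ∀ u v → does (List.≡-dec _≟_ (parts (fromLetters u)) (parts (fromLetters v))) ≡ u ≡ʷ v
parts-≡ʷ u v with u ≡ʷ v in eq
... | true  = dec-true (List.≡-dec _≟_ (parts (fromLetters u)) (parts (fromLetters v)))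
                (cong (parts ∘ fromLetters) (≡ʷ⇒≡ u v eq))
... | false = dec-false (List.≡-dec _≟_ (parts (fromLetters u)) (parts (fromLetters v)))
                λ same → contradiction (trans (sym eq)
                  (trans (cong (u ≡ʷ_) (sym (fromLetters-injective u v same))) (≡ʷ-refl u))) λ ()

words : ℕ → List (List Bool)
words zero    = [] ∷ []
words (suc n) = concatMap (λ v → (true ∷ v) ∷ (false ∷ v) ∷ []) (words n)

compositions-words : ∀ n → compositions (suc n) ≡ map fromLetters (words n)
compositions-words zero    = refl
compositions-words (suc n) = begin
  concatMap extend (compositions (suc n))
    ≡⟨ cong (concatMap extend) (compositions-words n) ⟩
  concatMap extend (map fromLetters (words n))
    ≡⟨ List.concatMap-map extend fromLetters (words n) ⟩
  concatMap (extend ∘ fromLetters) (words n)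
    ≡⟨ List.map-concatMap fromLetters (λ v → (true ∷ v) ∷ (false ∷ v) ∷ []) (words n) ⟨
  map fromLetters (words (suc n)) ∎
  where
  open ≡-Reasoning
  extend : Composition → List Composition
  extend α = newPart α ∷ growPart α ∷ []

words-length : ∀ n {v} → v ∈ words n → length v ≡ n
words-length zero    (here refl) = refl
words-length (suc n) v∈ with find (∈.∈-concatMap⁻ (λ v → (true ∷ v) ∷ (false ∷ v) ∷ []) {xs = words n} v∈)
... | w , w∈ , here refl         = cong suc (words-length n w∈)
... | w , w∈ , there (here refl) = cong suc (words-length n w∈)

∈-words : ∀ v → v ∈ words (length v)
∈-words []      = here refl
∈-words (b ∷ v) = ∈.∈-concatMap⁺ (λ v → (true ∷ v) ∷ (false ∷ v) ∷ []) (lose (∈-words v) (member b))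
  where
  member : ∀ b → b ∷ v ∈ (true ∷ v) ∷ (false ∷ v) ∷ []
  member true  = here refl
  member false = there (here refl)

private
  -- Only `v = w` can contribute. If `w` has another length than `n` there is no such term, and
  -- `u ≤ʷ w` is `false` as well.
  Σ-words : ∀ n u w → length u ≡ n → Σℤ (words n) (λ v → 𝟙ℤ (u ≤ʷ v) ℤ.* 𝟙ℤ (w ≡ʷ v)) ≡ 𝟙ℤ (u ≤ʷ w)
  Σ-words zero    []      []      _  = refl
  Σ-words zero    []      (b ∷ w) _  = refl
  Σ-words (suc n) (a ∷ u) w       eq = trans
    (Σℤ-concatMap (λ v → (true ∷ v) ∷ (false ∷ v) ∷ []) (words n) _) (step a w)
    where
    open ≡-Reasoning
    term : Bool → List Bool → List Bool → ℤ
    term a w v = 𝟙ℤ ((a ∷ u) ≤ʷ v) ℤ.* 𝟙ℤ (w ≡ʷ v)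
    both : Bool → List Bool → List Bool → ℤ
    both a w v = term a w (true ∷ v) ℤ.+ (term a w (false ∷ v) ℤ.+ 0ℤ)
    ih : ∀ w → Σℤ (words n) (λ v → 𝟙ℤ (u ≤ʷ v) ℤ.* 𝟙ℤ (w ≡ʷ v)) ≡ 𝟙ℤ (u ≤ʷ w)
    ih w = Σ-words n u w (suc-injective eq)
    zero-term : ∀ x y → x ≡ 0ℤ → y ≡ 0ℤ → x ℤ.+ (y ℤ.+ 0ℤ) ≡ 0ℤ
    zero-term _ _ refl refl = refl
    step : ∀ a w → Σℤ (words n) (both a w) ≡ 𝟙ℤ ((a ∷ u) ≤ʷ w)
    step a     []          = Σℤ-zero (words n) λ v _ → zero-term _ _
      (ℤ.*-zeroʳ (𝟙ℤ ((a ∷ u) ≤ʷ (true ∷ v)))) (ℤ.*-zeroʳ (𝟙ℤ ((a ∷ u) ≤ʷ (false ∷ v))))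
    step true  (true ∷ w)  = trans (Σℤ-cong (words n) λ v _ → ℤ.+-identityʳ _) (ih w)
    step false (true ∷ w)  = trans (Σℤ-cong (words n) λ v _ → trans
      (cong (λ z → 𝟙ℤ (u ≤ʷ v) ℤ.* 𝟙ℤ (w ≡ʷ v) ℤ.+ (z ℤ.+ 0ℤ)) (ℤ.*-zeroʳ (𝟙ℤ (u ≤ʷ v)))) (ℤ.+-identityʳ _)) (ih w)
    step true  (false ∷ w) = Σℤ-zero (words n) λ v _ → zero-term (𝟙ℤ (u ≤ʷ v) ℤ.* 0ℤ) 0ℤ
      (ℤ.*-zeroʳ (𝟙ℤ (u ≤ʷ v))) refl
    step false (false ∷ w) = trans (Σℤ-cong (words n) λ v _ → trans
      (cong (ℤ._+ (𝟙ℤ (u ≤ʷ v) ℤ.* 𝟙ℤ (w ≡ʷ v) ℤ.+ 0ℤ)) (ℤ.*-zeroʳ (𝟙ℤ (u ≤ʷ v))))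
      (trans (ℤ.+-identityˡ _) (ℤ.+-identityʳ _))) (ih w)

filter-parts : ∀ α → filter nonZero? (parts α) ≡ parts α
filter-parts α = List.filter-all nonZero? (nonZeroParts α)

-- At the exponents `parts β` only `M β` takes the value 1, so the value of F there tells whether
-- `M β` occurs in it.
F-fromLetters : ∀ u w → F (fromLetters u) (parts (fromLetters w)) ≡ 𝟙ℤ (u ≤ʷ w)
F-fromLetters u w = begin
  Σℤ (filter sub? (compositions ∣ fromLetters u ∣)) (λ β → M β (parts (fromLetters w)))
    ≡⟨ cong (λ n → Σℤ (filter sub? (compositions n)) (λ β → M β (parts (fromLetters w)))) (size-fromLetters u) ⟩
  Σℤ (filter sub? (compositions (suc n))) (λ β → M β (parts (fromLetters w)))
    ≡⟨ Σℤ-filter sub? (compositions (suc n)) _ ⟩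
  Σℤ (compositions (suc n)) (λ β → 𝟙ℤ (does (sub? β)) ℤ.* M β (parts (fromLetters w)))
    ≡⟨ cong (λ βs → Σℤ βs (λ β → 𝟙ℤ (does (sub? β)) ℤ.* M β (parts (fromLetters w)))) (compositions-words n) ⟩
  Σℤ (map fromLetters (words n)) (λ β → 𝟙ℤ (does (sub? β)) ℤ.* M β (parts (fromLetters w)))
    ≡⟨ Σℤ-map fromLetters (words n) _ ⟩
  Σℤ (words n) (λ v → 𝟙ℤ (does (sub? (fromLetters v))) ℤ.* M (fromLetters v) (parts (fromLetters w)))
    ≡⟨ Σℤ-cong (words n) (λ v v∈ → cong₂ ℤ._*_ (cong 𝟙ℤ (S-⊆-≤ʷ u v (sym (words-length n v∈))))
         (cong 𝟙ℤ (trans (cong (λ e → does (List.≡-dec _≟_ e (parts (fromLetters v)))) (filter-parts (fromLetters w)))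
           (parts-≡ʷ w v)))) ⟩
  Σℤ (words n) (λ v → 𝟙ℤ (u ≤ʷ v) ℤ.* 𝟙ℤ (w ≡ʷ v))
    ≡⟨ Σ-words n u w refl ⟩
  𝟙ℤ (u ≤ʷ w) ∎
  where
  open ≡-Reasoning
  n = length u
  sub? : Decidable (λ β → S (fromLetters u) ⊆ S β)
  sub? β = _⊆?_ _≟_ (S (fromLetters u)) (S β)

-- As for fromWord, the first letter is ignored.
_≤⁺_ _≡⁺_ : List Bool → List Bool → Bool
[]      ≤⁺ []      = true
[]      ≤⁺ (_ ∷ _) = false
(_ ∷ _) ≤⁺ []      = false
(_ ∷ u) ≤⁺ (_ ∷ v) = u ≤ʷ v

[]      ≡⁺ []      = true
[]      ≡⁺ (_ ∷ _) = false
(_ ∷ _) ≡⁺ []      = false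
(_ ∷ u) ≡⁺ (_ ∷ v) = u ≡ʷ v

F-fromWord : ∀ u w → F (fromWord u) (parts (fromWord w)) ≡ 𝟙ℤ (u ≤⁺ w)
F-fromWord []      []      = refl
F-fromWord []      (_ ∷ w) = trans (ℤ.+-identityʳ _) (cong 𝟙ℤ
  (dec-false (List.≡-dec _≟_ (filter nonZero? (parts (fromLetters w))) []) λ eq →
    nonEmpty (fromLetters-nonEmpty w) (trans (sym (filter-parts (fromLetters w))) eq)))
  where
  nonEmpty : ∀ {as : List ℕ} → ∃[ b ] ∃[ bs ] as ≡ b ∷ bs → as ≢ []
  nonEmpty (_ , _ , refl) ()
F-fromWord (_ ∷ u) []      = Σℤ-zero (filter sub? (compositions ∣ fromLetters u ∣)) λ β β∈ →
  cong 𝟙ℤ (dec-false (List.≡-dec _≟_ [] (parts β)) (λ eq → size≢0 β (proj₁ (∈.∈-filter⁻ sub? {xs = compositions ∣ fromLetters u ∣} β∈)) (sym eq)))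
  where
  sub? : Decidable (λ β → S (fromLetters u) ⊆ S β)
  sub? β = _⊆?_ _≟_ (S (fromLetters u)) (S β)
  size≢0 : ∀ β → β ∈ compositions ∣ fromLetters u ∣ → parts β ≢ []
  size≢0 β β∈ eq with ∈.∈-map⁻ fromLetters (subst (β ∈_) (compositions-words (length u))
    (subst (λ n → β ∈ compositions n) (size-fromLetters u) β∈))
  ... | v , _ , refl with trans (sym eq) (proj₂ (proj₂ (fromLetters-nonEmpty v)))
  ...   | ()
F-fromWord (_ ∷ u) (_ ∷ w) = F-fromLetters u w

-- Values at the parts of a composition are coefficients in the basis M; Möbius inversion over
-- coarsenings converts them into coefficients in the basis F.
F-coefficient : Series → List Bool → ℤ
F-coefficient f []      = f []
F-coefficient f (_ ∷ w) = möbius (λ v → f (parts (fromLetters v))) w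

F-coefficient-cong : ∀ {f g} → f ≗ g → ∀ w → F-coefficient f w ≡ F-coefficient g w
F-coefficient-cong eq []      = eq []
F-coefficient-cong eq (_ ∷ w) = möbius-cong (λ v → eq (parts (fromLetters v))) w

F-coefficient-∑ : {I : Set} (is : List I) (f : I → Series) → ∀ w →
  F-coefficient (∑ is f) w ≡ Σℤ is (λ i → F-coefficient (f i) w)
F-coefficient-∑ is f []      = refl
F-coefficient-∑ is f (_ ∷ w) = möbius-Σ is (λ i v → f i (parts (fromLetters v))) w

F-coefficient-· : ∀ c f w → F-coefficient (c · f) w ≡ c ℤ.* F-coefficient f w
F-coefficient-· c f []      = refl
F-coefficient-· c f (_ ∷ w) = möbius-* c (λ v → f (parts (fromLetters v))) w

F-coefficient-F : ∀ u w → F-coefficient (F (fromWord u)) w ≡ 𝟙ℤ (u ≡⁺ w)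
F-coefficient-F []      []      = refl
F-coefficient-F (b ∷ u) []      = F-fromWord (b ∷ u) []
F-coefficient-F []      (b ∷ w) = trans (möbius-cong (λ v → F-fromWord [] (b ∷ v)) w) (möbius-const-0 w)
F-coefficient-F (b ∷ u) (_ ∷ w) = trans (möbius-cong (F-fromLetters u) w) (möbius-≤ʷ u w)

-- Lists of lattice paths and the states they visit

module Enumeration {r : ℕ} (top : Vec ℕ r) (top-suc-≤ : ∀ i → at top (suc i) ≤ at top i) where
  open Paths top top-suc-≤

  paths : ℕ → State → List (List ℕ)
  paths zero    κ = filter (λ _ → Vec.≡-dec _≟_ κ top) ([] ∷ [])
  paths (suc n) κ = concatMap (λ i → map (i ∷_) (paths n (inc i κ))) (filter (addable? κ) (upTo r))

  ∈-paths⁻ : ∀ n κ {p} → p ∈ paths n κ → Path κ p × length p ≡ n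
  ∈-paths⁻ zero    κ p∈ with ∈.∈-filter⁻ (λ _ → Vec.≡-dec _≟_ κ top) {xs = [] ∷ []} p∈
  ... | here refl , refl = done , refl
  ∈-paths⁻ (suc n) κ p∈
    with find (∈.∈-concatMap⁻ (λ i → map (i ∷_) (paths n (inc i κ))) {xs = filter (addable? κ) (upTo r)} p∈)
  ... | i , i∈ , p∈′ with ∈.∈-map⁻ (i ∷_) p∈′
  ...   | q , q∈ , refl with ∈-paths⁻ n (inc i κ) q∈
  ...     | π , eq = step (proj₂ (∈.∈-filter⁻ (addable? κ) {xs = upTo r} i∈)) π , cong suc eq

  ∈-paths⁺ : ∀ {κ p} → Path κ p → p ∈ paths (length p) κ
  ∈-paths⁺ done = ∈.∈-filter⁺ (λ _ → Vec.≡-dec _≟_ top top) (here refl) refl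
  ∈-paths⁺ {κ} {i ∷ p} (step add π) = ∈.∈-concatMap⁺ (λ i → map (i ∷_) (paths (length p) (inc i κ)))
    (lose (∈.∈-filter⁺ (addable? κ) (∈.∈-upTo⁺ (addable-row κ add)) add) (∈.∈-map⁺ (i ∷_) (∈-paths⁺ π)))

  paths-unique : ∀ n κ → Unique (paths n κ)
  paths-unique zero    κ = Unique.filter⁺ (λ _ → Vec.≡-dec _≟_ κ top) ([] ∷ [])
  paths-unique (suc n) κ = Unique.concat⁺
    (All.map⁺ (All.tabulate λ {i} _ → Unique.map⁺ (λ { refl → refl }) (paths-unique n (inc i κ))))
    (AllPairs.map⁺ (AllPairs.map disjoint (Unique.filter⁺ (addable? κ) (Unique.upTo⁺ r))))
    where
    disjoint : ∀ {i j} → i ≢ j → ∀ {p} →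
      ¬ (p ∈ map (i ∷_) (paths n (inc i κ)) × p ∈ map (j ∷_) (paths n (inc j κ)))
    disjoint i≢j (a , b) with ∈.∈-map⁻ _ a | ∈.∈-map⁻ _ b
    ... | _ , _ , refl | _ , _ , refl = i≢j refl

  stateAt : (ℕ → ℕ) → State → ℕ → State
  stateAt w κ zero    = κ
  stateAt w κ (suc t) = inc (w t) (stateAt w κ t)

  stateAt-shift : ∀ w κ t → stateAt w κ (suc t) ≡ stateAt (w ∘ suc) (inc (w 0) κ) t
  stateAt-shift w κ zero    = refl
  stateAt-shift w κ (suc t) = cong (inc (w (suc t))) (stateAt-shift w κ t)

  stateAt-mono : ∀ w κ {s t} → s ≤ t → ∀ i → at (stateAt w κ s) i ≤ at (stateAt w κ t) i
  stateAt-mono w κ {t = zero}  z≤n i = ≤-refl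
  stateAt-mono w κ {s} {suc t} s≤t i with m≤n⇒m<n∨m≡n s≤t
  ... | inj₁ lt   = ≤-trans (stateAt-mono w κ (s≤s⁻¹ lt) i) (at-≤-inc (w t) i (stateAt w κ t))
  ... | inj₂ refl = ≤-refl

  stateAt-good : ∀ w κ n → Good κ → (∀ t → t < n → Addable (stateAt w κ t) (w t)) →
    ∀ t → t ≤ n → Good (stateAt w κ t)
  stateAt-good w κ n g add zero    _  = g
  stateAt-good w κ n g add (suc t) lt = good-inc (stateAt-good w κ n g add t (<⇒≤ lt)) (add t lt)

  stateAt-path : ∀ n w κ → (∀ t → t < n → Addable (stateAt w κ t) (w t)) → stateAt w κ n ≡ top →
    Path κ (applyUpTo w n)
  stateAt-path zero    w κ add refl = done
  stateAt-path (suc n) w κ add eq   = step (add 0 (s≤s z≤n)) (stateAt-path n (w ∘ suc) (inc (w 0) κ)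
    (λ t lt → subst (λ κ → Addable κ (w (suc t))) (stateAt-shift w κ t) (add (suc t) (s≤s lt)))
    (trans (sym (stateAt-shift w κ n)) eq))

  path-addable : ∀ {κ p} → Path κ p → ∀ t → t < length p → Addable (stateAt (entry p) κ t) (entry p t)
  path-addable (step add π) zero lt = add
  path-addable {κ} {i ∷ p} (step add π) (suc t) (s≤s lt) =
    subst (λ κ → Addable κ (entry p t)) (sym (stateAt-shift (entry (i ∷ p)) κ t)) (path-addable π t lt)

  path-end : ∀ {κ p} → Path κ p → stateAt (entry p) κ (length p) ≡ top
  path-end done = refl
  path-end {κ} {i ∷ p} (step add π) = trans (stateAt-shift (entry (i ∷ p)) κ (length p)) (path-end π)

  -- The time at which a given box is added.
  crossing : ∀ w κ n {i c} → (∀ t → t < n → w t < r) → at κ i ≤ c → c < at (stateAt w κ n) i →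
    ∃[ t ] t < n × w t ≡ i × at (stateAt w κ t) i ≡ c
  crossing w κ zero    row le lt = contradiction le (<⇒≱ lt)
  crossing w κ (suc n) {i} {c} row le lt with c <? at (stateAt w κ n) i
  ... | yes lt′ = let t , t<n , rest = crossing w κ n (λ t t<n → row t (≤-trans t<n (n≤1+n n))) le lt′
                  in t , ≤-trans t<n (n≤1+n n) , rest
  ... | no  ge  with w n ≟ i
  ...   | yes refl = n , ≤-refl , refl , ≤-antisym (≮⇒≥ ge)
          (s≤s⁻¹ (≤-trans lt (≤-reflexive (at-inc (row n ≤-refl) (stateAt w κ n)))))
  ...   | no ne    = contradiction (≤-trans lt (≤-reflexive (at-inc-≢ ne (stateAt w κ n)))) ge

entry-ext : ∀ {p q} → length p ≡ length q → (∀ t → t < length p → entry p t ≡ entry q t) → p ≡ q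
entry-ext {[]}    {[]}    _  _  = refl
entry-ext {_ ∷ p} {_ ∷ q} eq ps = cong₂ _∷_ (ps 0 (s≤s z≤n))
  (entry-ext (suc-injective eq) (λ t lt → ps (suc t) (s≤s lt)))

entry-applyUpTo : ∀ (w : ℕ → ℕ) n {t} → t < n → entry (applyUpTo w n) t ≡ w t
entry-applyUpTo w (suc n) {zero}  _        = refl
entry-applyUpTo w (suc n) {suc t} (s≤s lt) = entry-applyUpTo (w ∘ suc) n lt

applyUpTo-cong : {X : Set} {f g : ℕ → X} → ∀ n → (∀ i → i < n → f i ≡ g i) → applyUpTo f n ≡ applyUpTo g n
applyUpTo-cong zero    eq = refl
applyUpTo-cong (suc n) eq = cong₂ _∷_ (eq 0 (s≤s z≤n)) (applyUpTo-cong n (λ i lt → eq (suc i) (s≤s lt)))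

lookup-injective : {X : Set} {xs : List X} → Unique xs → ∀ {i j} → List.lookup xs i ≡ List.lookup xs j → i ≡ j
lookup-injective {xs = x ∷ xs} (x∉ ∷ u) {Fin.zero}  {Fin.zero}  eq = refl
lookup-injective {xs = x ∷ xs} (x∉ ∷ u) {Fin.zero}  {Fin.suc j} eq = contradiction eq (All.lookup x∉ (∈.∈-lookup j))
lookup-injective {xs = x ∷ xs} (x∉ ∷ u) {Fin.suc i} {Fin.zero}  eq = contradiction (sym eq) (All.lookup x∉ (∈.∈-lookup i))
lookup-injective {xs = x ∷ xs} (x∉ ∷ u) {Fin.suc i} {Fin.suc j} eq = cong Fin.suc (lookup-injective u eq)

injective⇒surjective : ∀ {n} (f : Fin n → Fin n) → (∀ {x y} → f x ≡ f y → x ≡ y) → ∀ v → ∃[ x ] f x ≡ v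
injective⇒surjective {suc n} f inj v with Fin.any? (λ x → f x Fin.≟ v)
... | yes some = some
... | no none  = contradiction
  (Fin.injective⇒≤ {f = λ x → Fin.punchOut (avoids x)} (λ {x} {y} eq → inj (Fin.punchOut-injective (avoids x) (avoids y) eq)))
  (<⇒≱ (n<1+n n))
  where
  avoids : ∀ x → v ≢ f x
  avoids x eq = none (x , sym eq)

∈-allVecs : {X : Set} {xs : List X} → (∀ x → x ∈ xs) → ∀ {n} (v : Vec X n) → v ∈ allVecs xs n
∈-allVecs all []      = here refl
∈-allVecs all (x ∷ v) = ∈.∈-cartesianProductWith⁺ _∷_ (all x) (∈-allVecs all v)

allVecs-unique : {X : Set} {xs : List X} → Unique xs → ∀ n → Unique (allVecs xs n)
allVecs-unique u zero    = [] ∷ []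
allVecs-unique u (suc n) = Unique.cartesianProductWith⁺ _∷_ (λ { refl → refl , refl }) u (allVecs-unique u n)

setWord : (n : ℕ) {D : Pred ℕ 0ℓ} → Decidable D → List Bool
setWord zero    D? = []
setWord (suc n) D? = false ∷ applyUpTo (λ i → does (D? (suc i))) n

fromSet-fromLetters : ∀ n {D : Pred ℕ 0ℓ} (D? : Decidable D) →
  fromSet (suc n) D? ≡ fromLetters (applyUpTo (λ i → does (D? (suc i))) n)
fromSet-fromLetters zero    D? = refl
fromSet-fromLetters (suc n) D? with does (D? 1)
... | true  = cong newPart (fromSet-fromLetters n (D? ∘ suc))
... | false = cong growPart (fromSet-fromLetters n (D? ∘ suc))

fromSet-fromWord : ∀ n {D : Pred ℕ 0ℓ} (D? : Decidable D) → fromSet n D? ≡ fromWord (setWord n D?)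
fromSet-fromWord zero    D? = refl
fromSet-fromWord (suc n) D? = fromSet-fromLetters n D?

descentWord-applyUpTo : ∀ i p → descentWord (i ∷ p) ≡
  false ∷ applyUpTo (λ t → does (suc (entry (i ∷ p) t) ≤? entry p t)) (length p)
descentWord-applyUpTo i p = cong (false ∷_) (go i p)
  where
  go : ∀ i p → descents (suc i) p ≡ applyUpTo (λ t → does (suc (entry (i ∷ p) t) ≤? entry p t)) (length p)
  go i []      = refl
  go i (j ∷ p) = cong (does (suc i ≤? j) ∷_) (go j p)

-- Standard Young tableaux correspond to lattice paths

module Tableaux (A : SkewShape) where

  top bottom : Vec ℕ (#rows A)
  top    = tab (#rows A) (outer A !_)
  bottom = tab (#rows A) (inner A !_)

  at-top : ∀ i → at top i ≡ outer A ! i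
  at-top = at-tab (#rows A) (outer-beyond A)

  at-bottom : ∀ i → at bottom i ≡ inner A ! i
  at-bottom = at-tab (#rows A) λ i le →
    n≤0⇒n≡0 (≤-trans (contained A i) (≤-reflexive (outer-beyond A i le)))

  top-suc-≤ : ∀ i → at top (suc i) ≤ at top i
  top-suc-≤ i = subst₂ _≤_ (sym (at-top (suc i))) (sym (at-top i)) (!-suc-≤ (outer A) i)

  open Paths top top-suc-≤ public
  open Enumeration top top-suc-≤ public

  good-bottom : Good bottom
  good-bottom = good
    (λ i → subst₂ _≤_ (sym (at-bottom (suc i))) (sym (at-bottom i)) (!-suc-≤ (inner A) i))
    (λ i → subst₂ _≤_ (sym (at-bottom i)) (sym (at-top i)) (contained A i))

  private
    n = size A
    grid = cartesianProduct (upTo (#rows A)) (upTo (#cols A))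

  Position : Set
  Position = Fin n

  position-box : ∀ q → Box A (row A q) (col A q)
  position-box q = proj₂ (∈.∈-filter⁻ (λ (i , j) → box? A i j) {xs = grid} (∈.∈-lookup {xs = boxes A} q))

  box-position : ∀ {i j} → Box A i j → ∃[ q ] row A q ≡ i × col A q ≡ j
  box-position {i} {j} b = Any.index ij∈ , sym (cong proj₁ (Any.lookup-index ij∈)) , sym (cong proj₂ (Any.lookup-index ij∈))
    where
    ij∈ : (i , j) ∈ boxes A
    ij∈ = ∈.∈-filter⁺ (λ (i , j) → box? A i j)
      (∈.∈-cartesianProduct⁺ (∈.∈-upTo⁺ (box-row A b)) (∈.∈-upTo⁺ (box-col A b))) b

  position-≡ : ∀ {q q′} → row A q ≡ row A q′ → col A q ≡ col A q′ → q ≡ q′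
  position-≡ rows≡ cols≡ = lookup-injective
    (Unique.filter⁺ (λ (i , j) → box? A i j)
      (Unique.cartesianProduct⁺ (Unique.upTo⁺ (#rows A)) (Unique.upTo⁺ (#cols A))))
    (cong₂ _,_ rows≡ cols≡)

  time : Filling A → Position → ℕ
  time T q = toℕ (Vec.lookup T q)

  time<n : ∀ T q → time T q < n
  time<n T q = Fin.toℕ<n (Vec.lookup T q)

  _RecordedBy_ : Filling A → List ℕ → Set
  T RecordedBy p = length p ≡ n × (∀ q → entry p (time T q) ≡ row A q)

  module _ (T : Filling A) (syt : IsSYT A T) where

    time-injective : ∀ {q q′} → time T q ≡ time T q′ → q ≡ q′
    time-injective {q} {q′} eq = proj₁ syt q q′ (cong suc eq)

    at-time : ∀ {t} → t < n → ∃[ q ] time T q ≡ t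
    at-time t<n with injective⇒surjective (Vec.lookup T) (time-injective ∘ cong toℕ) (Fin.fromℕ< t<n)
    ... | q , eq = q , trans (cong toℕ eq) (Fin.toℕ-fromℕ< t<n)

    module _ (w : ℕ → ℕ) (w-time : ∀ q → w (time T q) ≡ row A q) where

      state : ℕ → State
      state = stateAt w bottom

      Filled : ℕ → Set
      Filled t = ∀ q → (time T q < t → col A q < at (state t) (row A q))
                     × (col A q < at (state t) (row A q) → time T q < t)

      bottom-≤ : ∀ t i → inner A ! i ≤ at (state t) i
      bottom-≤ t i = ≤-trans (≤-reflexive (sym (at-bottom i))) (stateAt-mono w bottom (z≤n {t}) i)

      -- If the box of time `t` lay beyond the border of its row, the box at the border would have a
      -- smaller value and would already be filled; if it lay before the border, it would itself be
      -- filled too early.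
      filled-col : ∀ {t} → Filled t → ∀ q → time T q ≡ t → col A q ≡ at (state t) (row A q)
      filled-col {t} inv q refl = ≤-antisym
        (≮⇒≥ λ lt → let
            q′ , row≡ , col≡ = box-position {row A q} {at (state t) (row A q)}
              (bottom-≤ t (row A q) , <-trans lt (proj₂ (position-box q)))
            earlier = s≤s⁻¹ (proj₁ (proj₂ syt) q′ q row≡ (<-≤-trans (s≤s (≤-reflexive col≡)) lt))
          in <-irrefl (trans col≡ (cong (at (state t)) (sym row≡))) (proj₁ (inv q′) earlier))
        (≮⇒≥ λ lt → <-irrefl refl (proj₂ (inv q) lt))

      filled-addable : ∀ {t} → Filled t → ∀ q → time T q ≡ t → Addable (state t) (row A q)
      filled-addable {t} inv q refl =
          subst₂ _<_ (filled-col {t} inv q refl) (sym (at-top (row A q))) (proj₂ (position-box q))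
        , subst (_< above (state t) (row A q)) (filled-col {t} inv q refl) (free (row A q) refl)
        where
        free : ∀ i → row A q ≡ i → col A q < above (state t) i
        free zero    eq = <-≤-trans (proj₂ (position-box q))
          (≤-reflexive (trans (cong (outer A !_) eq) (sym (at-top 0))))
        -- The position above either belongs to the inner shape, which every state contains, or is a
        -- box of A with a smaller value.
        free (suc i) eq with inner A ! i ≤? col A q
        ... | no  gt = <-≤-trans (≰⇒> gt) (bottom-≤ t i)
        ... | yes le = let
            q′ , row≡ , col≡ = box-position {i} {col A q} (le , <-≤-trans (proj₂ (position-box q))
              (!-antitone (outer A) (≤-trans (n≤1+n i) (≤-reflexive (sym eq)))))
            earlier = s≤s⁻¹ (proj₂ (proj₂ syt) q′ q col≡
              (≤-trans (s≤s (≤-reflexive row≡)) (≤-reflexive (sym eq))))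
          in subst₂ _<_ col≡ (cong (at (state t)) row≡) (proj₁ (inv q′) earlier)

      filled-suc : ∀ t → ∃[ q ] time T q ≡ t → Filled t → Filled (suc t)
      filled-suc t (q₀ , refl) inv q rewrite w-time q₀ with row A q₀ ≟ row A q
      ... | no ne = (λ lt → subst (col A q <_) (sym (at-inc-≢ ne (state t)))
                      (proj₁ (inv q) (≤∧≢⇒< (s≤s⁻¹ lt) (λ eq → ne (cong (row A) (sym (time-injective eq)))))))
                  , (λ lt → m<n⇒m<1+n (proj₂ (inv q) (subst (col A q <_) (at-inc-≢ ne (state t)) lt)))
      ... | yes eq = (λ lt → subst (col A q <_) (sym grown) (to (m≤n⇒m<n∨m≡n (s≤s⁻¹ lt))))
                   , (λ lt → from (m≤n⇒m<n∨m≡n (s≤s⁻¹ (subst (col A q <_) grown lt))))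
        where
        grown : at (inc (row A q₀) (state t)) (row A q) ≡ suc (at (state t) (row A q))
        grown = subst (λ i → at (inc (row A q₀) (state t)) i ≡ suc (at (state t) i)) eq
          (at-inc (box-row A (position-box q₀)) (state t))
        to : time T q < t ⊎ time T q ≡ t → col A q < suc (at (state t) (row A q))
        to (inj₁ lt)   = m<n⇒m<1+n (proj₁ (inv q) lt)
        to (inj₂ same) = s≤s (≤-reflexive (filled-col {t} inv q same))
        from : col A q < at (state t) (row A q) ⊎ col A q ≡ at (state t) (row A q) → time T q < suc t
        from (inj₁ lt)   = m<n⇒m<1+n (proj₂ (inv q) lt)
        from (inj₂ same) = s≤s (≤-reflexive (cong (time T) (position-≡ (sym eq)
          (trans same (trans (cong (at (state t)) (sym eq)) (sym (filled-col {t} inv q₀ refl)))))))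

      filled : ∀ t → t ≤ n → Filled t
      filled zero    _   q = (λ ()) , λ lt → contradiction (proj₁ (position-box q))
        (<⇒≱ (<-≤-trans lt (≤-reflexive (at-bottom (row A q)))))
      filled (suc t) t<n = filled-suc t (at-time t<n) (filled t (<⇒≤ t<n))

      tableau-addable : ∀ t → t < n → Addable (state t) (w t)
      tableau-addable t t<n with at-time t<n
      ... | q , refl = subst (Addable (state (time T q))) (sym (w-time q))
                         (filled-addable {time T q} (filled (time T q) (<⇒≤ t<n)) q refl)

      tableau-end : state n ≡ top
      tableau-end = at-ext λ i → ≤-antisym
        (below (stateAt-good w bottom n good-bottom tableau-addable n ≤-refl) i)
        (≤-trans (≤-reflexive (at-top i)) (full i (outer A ! i) refl))
        where
        full : ∀ i m → outer A ! i ≡ m → m ≤ at (state n) i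
        full i m eq with m ≤? inner A ! i
        ... | yes le = ≤-trans le (bottom-≤ n i)
        full i zero    eq | no _  = z≤n
        full i (suc m) eq | no gt = let
            q , row≡ , col≡ = box-position {i} {m} (s≤s⁻¹ (≰⇒> gt) , ≤-reflexive (sym eq))
          in subst₂ _<_ col≡ (cong (at (state n)) row≡) (proj₁ (filled n ≤-refl q) (time<n T q))

      tableau-path : Path bottom (applyUpTo w n)
      tableau-path = stateAt-path n w bottom tableau-addable tableau-end

    rowAt : ℕ → ℕ
    rowAt t with t <? n
    ... | yes t<n = row A (proj₁ (at-time t<n))
    ... | no  _   = 0

    rowAt-time : ∀ q → rowAt (time T q) ≡ row A q
    rowAt-time q with time T q <? n
    ... | yes t<n = cong (row A) (time-injective (proj₂ (at-time t<n)))
    ... | no  t≮n = contradiction (time<n T q) t≮n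

    tableau⇒path : ∃[ p ] p ∈ paths n bottom × T RecordedBy p
    tableau⇒path = applyUpTo rowAt n
      , subst (λ m → applyUpTo rowAt n ∈ paths m bottom) (List.length-applyUpTo rowAt n)
          (∈-paths⁺ (tableau-path rowAt rowAt-time))
      , List.length-applyUpTo rowAt n
      , λ q → trans (entry-applyUpTo rowAt n (time<n T q)) (rowAt-time q)

    recordedBy-unique : ∀ p p′ → T RecordedBy p → T RecordedBy p′ → p ≡ p′
    recordedBy-unique p p′ (len , ent) (len′ , ent′) = entry-ext (trans len (sym len′)) λ t lt →
      let q , eq = at-time (<-≤-trans lt (≤-reflexive len))
      in subst (λ t → entry p t ≡ entry p′ t) eq (trans (ent q) (sym (ent′ q)))

    recordedBy-descents : ∀ p → T RecordedBy p → comp A T ≡ fromWord (descentWord p)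
    recordedBy-descents p (len , ent) =
      trans (fromSet-fromWord n (descent? A T)) (cong fromWord (same p n len ent ≤-refl))
      where
      -- The length is generalised from `size A` to `m` so that it can be matched. Entry `t` is the
      -- row of value `t + 1`, so the letter comparing entries `t` and `t + 1` belongs to the
      -- descent `t + 1`.
      same : ∀ p m → length p ≡ m → (∀ q → entry p (time T q) ≡ row A q) → m ≤ n →
        setWord m (descent? A T) ≡ descentWord p
      same []      zero    _  _   _  = refl
      same (i ∷ p) (suc m) eq ent m<n = sym (trans (descentWord-applyUpTo i p) (cong (false ∷_)
        (trans (cong (applyUpTo _) (suc-injective eq)) (applyUpTo-cong m λ t t<m →
          does-⇔ (mk⇔ (to t (≤-trans (s≤s t<m) m<n)) (from t)) (suc (entry (i ∷ p) t) ≤? entry p t) (descent? A T (suc t))))))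
        where
        to : ∀ t → suc t < n → entry (i ∷ p) t < entry p t → Descent A T (suc t)
        to t lt less = let
            q , eq = at-time (<-trans (n<1+n t) lt)
            q′ , eq′ = at-time lt
          in q , q′ , cong suc eq , cong suc eq′
           , subst₂ _<_ (trans (cong (entry (i ∷ p)) (sym eq)) (ent q)) (trans (cong (entry (i ∷ p)) (sym eq′)) (ent q′)) less
        from : ∀ t → Descent A T (suc t) → entry (i ∷ p) t < entry p t
        from t (q , q′ , eq , eq′ , less) = subst₂ _<_
          (sym (trans (cong (entry (i ∷ p)) (sym (suc-injective eq))) (ent q)))
          (sym (trans (cong (entry (i ∷ p)) (sym (suc-injective eq′))) (ent q′))) less

  -- At each time both fillings use the box at the border of the row given by `p`, and the state
  -- with this border depends on `p` alone.
  path-determines : ∀ T T′ p → IsSYT A T → IsSYT A T′ → T RecordedBy p → T′ RecordedBy p → T ≡ T′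
  path-determines T T′ p syt syt′ (_ , ent) (_ , ent′) = trans (sym (Vec.tabulate∘lookup T))
    (trans (Vec.tabulate-cong λ q → Fin.toℕ-injective (same q)) (Vec.tabulate∘lookup T′))
    where
    same : ∀ q → time T q ≡ time T′ q
    same q with at-time T′ syt′ (time<n T q)
    ... | q′ , eq = trans (sym eq) (cong (time T′) (sym (position-≡ row≡
      (trans (filled-col T syt (entry p) ent {time T q} (filled T syt (entry p) ent (time T q) (<⇒≤ (time<n T q))) q refl)
        (trans (cong (at (stateAt (entry p) bottom (time T q))) row≡)
          (sym (filled-col T′ syt′ (entry p) ent′ {time T q} (filled T′ syt′ (entry p) ent′ (time T q) (<⇒≤ (time<n T q))) q′ eq)))))))
      where
      row≡ : row A q ≡ row A q′
      row≡ = trans (sym (ent q)) (trans (cong (entry p) (sym eq)) (ent′ q′))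

  module _ {p} (π : Path bottom p) (len : length p ≡ n) where

    private
      st : ℕ → State
      st = stateAt (entry p) bottom

      add : ∀ t → t < n → Addable (st t) (entry p t)
      add t t<n = path-addable π t (<-≤-trans t<n (≤-reflexive (sym len)))

      good-st : ∀ t → t ≤ n → Good (st t)
      good-st = stateAt-good (entry p) bottom n good-bottom add

      when : ∀ q → ∃[ t ] t < n × entry p t ≡ row A q × at (st t) (row A q) ≡ col A q
      when q = crossing (entry p) bottom n (λ t t<n → addable-row (st t) (add t t<n))
        (≤-trans (≤-reflexive (at-bottom (row A q))) (proj₁ (position-box q)))
        (<-≤-trans (proj₂ (position-box q)) (≤-reflexive (trans (sym (at-top (row A q)))
          (cong (λ κ → at κ (row A q)) (trans (sym (path-end π)) (cong st len))))))

      filling : Filling A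
      filling = Vec.tabulate (λ q → Fin.fromℕ< (proj₁ (proj₂ (when q))))

      time-when : ∀ q → time filling q ≡ proj₁ (when q)
      time-when q = trans (cong toℕ (Vec.lookup∘tabulate _ q)) (Fin.toℕ-fromℕ< _)

      injective : ∀ q q′ → proj₁ (when q) ≡ proj₁ (when q′) → q ≡ q′
      injective q q′ eq with when q | when q′
      injective q q′ refl | t , _ , row≡ , col≡ | _ , _ , row≡′ , col≡′ = position-≡ rows≡
        (trans (sym col≡) (trans (cong (at (st t)) rows≡) col≡′))
        where
        rows≡ = trans (sym row≡) row≡′

      row-increasing : ∀ q q′ → row A q ≡ row A q′ → col A q < col A q′ → proj₁ (when q) < proj₁ (when q′)
      row-increasing q q′ rows lt with when q | when q′
      ... | t , _ , _ , col≡ | t′ , _ , _ , col≡′ = ≰⇒> λ t′≤t → <⇒≱ lt (≤-trans (≤-reflexive (sym col≡′))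
        (≤-trans (stateAt-mono (entry p) bottom t′≤t (row A q′))
          (≤-reflexive (trans (cong (at (st t)) (sym rows)) col≡))))

      -- When the lower box is added, the row just above it reaches past its column, hence so does
      -- the row of `q`; the upper box is already there.
      col-increasing : ∀ q q′ → col A q ≡ col A q′ → row A q < row A q′ → proj₁ (when q) < proj₁ (when q′)
      col-increasing q q′ cols lt with when q | when q′
      ... | t , _ , _ , col≡ | t′ , t′<n , row≡′ , col≡′ = ≰⇒> λ t′≤t →
        <-irrefl (trans col≡′ (trans (sym cols) (sym col≡)))
          (<-≤-trans (higher (row A q′) lt (subst (Addable (st t′)) row≡′ (add t′ t′<n)))
            (stateAt-mono (entry p) bottom t′≤t (row A q)))
        where
        higher : ∀ i′ → row A q < i′ → Addable (st t′) i′ → at (st t′) i′ < at (st t′) (row A q)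
        higher (suc i′) (s≤s le) (_ , lt) = <-≤-trans lt (antitone (decreasing (good-st t′ (<⇒≤ t′<n))) le)

    path⇒tableau : ∃[ T ] IsSYT A T × T RecordedBy p
    path⇒tableau = filling
      , ( (λ q q′ eq → injective q q′ (trans (sym (time-when q)) (trans (suc-injective eq) (time-when q′))))
        , (λ q q′ rows lt → s≤s (subst₂ _<_ (sym (time-when q)) (sym (time-when q′)) (row-increasing q q′ rows lt)))
        , (λ q q′ cols lt → s≤s (subst₂ _<_ (sym (time-when q)) (sym (time-when q′)) (col-increasing q q′ cols lt))))
      , len , λ q → trans (cong (entry p) (time-when q)) (proj₁ (proj₂ (proj₂ (when q))))

  ∈-SYTs : ∀ {T} → IsSYT A T → T ∈ SYTs A
  ∈-SYTs {T} syt = ∈.∈-filter⁺ (isSYT? A) (∈-allVecs ∈.∈-allFin T) syt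

  SYTs-isSYT : ∀ {T} → T ∈ SYTs A → IsSYT A T
  SYTs-isSYT T∈ = proj₂ (∈.∈-filter⁻ (isSYT? A) {xs = allVecs (allFin n) n} T∈)

  skewSchur-paths : ∀ e → skewSchur A e ≡ Σℤ (paths n bottom) (λ p → F (fromWord (descentWord p)) e)
  skewSchur-paths e = Σℤ-bijection _RecordedBy_
    (Unique.filter⁺ (isSYT? A) (allVecs-unique (Unique.allFin⁺ n) n))
    (paths-unique n bottom)
    (λ T T∈ → tableau⇒path T (SYTs-isSYT T∈))
    (λ p p∈ → let π , len = ∈-paths⁻ n bottom p∈
                  T , syt , rec = path⇒tableau π len in T , ∈-SYTs syt , rec)
    (λ {T} {p} {p′} T∈ _ _ → recordedBy-unique T (SYTs-isSYT T∈) p p′)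
    (λ {T} {T′} {p} T∈ T′∈ _ → path-determines T T′ p (SYTs-isSYT T∈) (SYTs-isSYT T′∈))
    (λ {T} {p} T∈ _ rec → cong (λ α → F α e) (recordedBy-descents T (SYTs-isSYT T∈) p rec))

descentWord-≡⁺ : ∀ p q → descentWord p ≡⁺ descentWord q ≡ true → descentWord p ≡ descentWord q
descentWord-≡⁺ []      []      _  = refl
descentWord-≡⁺ (i ∷ p) (j ∷ q) eq = cong (false ∷_) (≡ʷ⇒≡ _ _ eq)

≡⁺-refl : ∀ w → w ≡⁺ w ≡ true
≡⁺-refl []      = refl
≡⁺-refl (_ ∷ w) = ≡ʷ-refl w

𝟙ℤ-nonneg : ∀ b → 0ℤ ℤ.≤ 𝟙ℤ b
𝟙ℤ-nonneg true  = ℤ.+≤+ z≤n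
𝟙ℤ-nonneg false = ℤ.+≤+ z≤n

𝟙ℤ-≢0 : ∀ {b} → 𝟙ℤ b ≢ 0ℤ → b ≡ true
𝟙ℤ-≢0 {true}  _  = refl
𝟙ℤ-≢0 {false} ne = contradiction refl ne

-- Descent words of a shape bound its rectangle numbers

_HasWord_ : SkewShape → List Bool → Set
A HasWord w = ∃[ p ] Path bottom p × descentWord p ≡ w
  where open Tableaux A

module _ (A : SkewShape) where
  open Tableaux A
  open Greedy top top-suc-≤ using (greedy)

  excessBeyond-rects : ∀ k l → excessBeyond k l bottom ≡ rects (suc k) (suc l) A
  excessBeyond-rects k l = trans
    (Σ<-cong (#rows A) (λ i _ → cong₂ (λ x y → x ∸ (y + l)) (at-top (i + k)) (at-bottom i)))
    (sym (rects-formula A k l))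

  path-size : ∀ {p} → Path bottom p → length p ≡ size A
  path-size π = trans (path-length good-bottom π) (trans
    (Σ<-cong (#rows A) (λ i _ → trans
      (cong₂ (λ x y → x ∸ y) (trans (at-top (i + 0)) (cong (outer A !_) (+-identityʳ i)))
        (trans (+-identityʳ _) (at-bottom i))) refl))
    (sym (size-formula A)))

  F-coefficient-skewSchur : ∀ w →
    F-coefficient (skewSchur A) w ≡ Σℤ (paths (size A) bottom) (λ p → 𝟙ℤ (descentWord p ≡⁺ w))
  F-coefficient-skewSchur w = trans (F-coefficient-cong skewSchur-paths w)
    (trans (F-coefficient-∑ (paths (size A) bottom) (λ p → F (fromWord (descentWord p))) w)
      (Σℤ-cong (paths (size A) bottom) (λ p _ → F-coefficient-F (descentWord p) w)))

  -- The coefficient counts the paths with this descent word, so nothing cancels.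
  hasWord⇒positive : ∀ {w} → A HasWord w → 0ℤ ℤ.< F-coefficient (skewSchur A) w
  hasWord⇒positive {w} (p , π , refl) = subst (0ℤ ℤ.<_) (sym (F-coefficient-skewSchur w))
    (Σℤ-pos (paths (size A) bottom) (λ q → 𝟙ℤ-nonneg (descentWord q ≡⁺ w))
      (subst (λ n → p ∈ paths n bottom) (path-size π) (∈-paths⁺ π))
      (subst (λ b → 0ℤ ℤ.< 𝟙ℤ b) (sym (≡⁺-refl w)) (ℤ.+<+ (s≤s z≤n))))

  nonzero⇒hasWord : ∀ p → F-coefficient (skewSchur A) (descentWord p) ≢ 0ℤ → A HasWord (descentWord p)
  nonzero⇒hasWord p ne = let
      q , q∈ , nz = Σℤ-≢0 (paths (size A) bottom) (λ eq → ne (trans (F-coefficient-skewSchur (descentWord p)) eq))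
    in q , proj₁ (∈-paths⁻ (size A) bottom q∈) , descentWord-≡⁺ q p (𝟙ℤ-≢0 nz)

  hasWord⇒rects-≤ : ∀ {w} → A HasWord w → ∀ k l → rects (suc k) (suc l) A ≤ remaining k l w
  hasWord⇒rects-≤ (p , π , refl) k l =
    ≤-trans (≤-reflexive (sym (excessBeyond-rects k l))) (excess≤remaining k l good-bottom π)

  optimalPath : ∀ k → ∃[ p ] Path bottom p
    × (∀ j → j ≤ k → remaining j 0 (descentWord p) ≤ rects (suc j) 1 A)
    × (∀ l → remaining k l (descentWord p) ≤ rects (suc k) (suc l) A)
  optimalPath k = let p , π , bdⱼ , bdₗ = greedy k good-bottom in p , π
    , (λ j le → ≤-trans (bdⱼ j le) (≤-reflexive (excessBeyond-rects j 0)))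
    , λ l → ≤-trans (bdₗ l) (≤-reflexive (excessBeyond-rects k l))

module _ (A B : SkewShape) where

  -- The word of A that is optimal for `k` also occurs in B and leaves at least the rectangle number
  -- of B.
  words-⊆⇒rects-≥ : (∀ p → A HasWord (descentWord p) → B HasWord (descentWord p)) →
    ∀ k l → rects (suc k) (suc l) B ≤ rects (suc k) (suc l) A
  words-⊆⇒rects-≥ sub k l =
    let p , π , _ , bd = optimalPath A k
    in ≤-trans (hasWord⇒rects-≤ B (sub p (p , π , refl)) k l) (bd l)

sameRects : ∀ A B → (∀ k l → rects (suc k) (suc l) B ≤ rects (suc k) (suc l) A) →
  (∀ k l → rects (suc k) (suc l) A ≤ rects (suc k) (suc l) B) → SameRects A B
sameRects A B le ge (suc k) (suc l) _ _ = ≤-antisym (ge k l) (le k l)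

skewSchur-≗⇒sameRects : ∀ A B → skewSchur A ≗ skewSchur B → SameRects A B
skewSchur-≗⇒sameRects A B eq = sameRects A B
  (words-⊆⇒rects-≥ A B (sub A B eq)) (words-⊆⇒rects-≥ B A (sub B A (sym ∘ eq)))
  where
  sub : ∀ A B → skewSchur A ≗ skewSchur B → ∀ p → A HasWord (descentWord p) → B HasWord (descentWord p)
  sub A B eq p has = nonzero⇒hasWord B p λ eq₀ → ℤ.<-irrefl
    (sym (trans (F-coefficient-cong eq (descentWord p)) eq₀)) (hasWord⇒positive A has)

-- The support of the F-expansion

_≟ᶜ_ : (α β : Composition) → Dec (α ≡ β)
α ≟ᶜ β with List.≡-dec _≟_ (parts α) (parts β)
... | yes eq = yes (composition-≡ eq)
... | no ne  = no (ne ∘ cong parts)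

-- Each part is marked by `true` at its first unit. The word thus starts with `true`, whereas a
-- descent word starts with `false`; `fromWord`, `≤⁺` and `≡⁺` ignore that letter.
toWord : List ℕ → List Bool
toWord []       = []
toWord (a ∷ as) = true ∷ replicate (pred a) false ++ toWord as

parts-growPart : ∀ α {a as} → parts α ≡ a ∷ as → parts (growPart α) ≡ suc a ∷ as
parts-growPart (mkComposition (_ ∷ _) _) refl = refl

fromWord-toWord : ∀ {as} → All NonZero as → parts (fromWord (toWord as)) ≡ as
fromWord-toWord {[]}         []       = refl
fromWord-toWord {suc a ∷ as} (_ ∷ ps) = run a
  where
  run : ∀ a → parts (fromLetters (replicate a false ++ toWord as)) ≡ suc a ∷ as
  run zero    = one as (fromWord-toWord ps)
    where
    one : ∀ as → parts (fromWord (toWord as)) ≡ as → parts (fromLetters (toWord as)) ≡ 1 ∷ as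
    one []       _  = refl
    one (b ∷ bs) eq = cong (1 ∷_) eq
  run (suc a) = parts-growPart (fromLetters (replicate a false ++ toWord as)) (run a)

composition-word : ∀ α → fromWord (toWord (parts α)) ≡ α
composition-word α = composition-≡ (fromWord-toWord (nonZeroParts α))

≡⁺⇒fromWord-≡ : ∀ u w → u ≡⁺ w ≡ true → fromWord u ≡ fromWord w
≡⁺⇒fromWord-≡ []      []      _  = refl
≡⁺⇒fromWord-≡ (_ ∷ u) (_ ∷ w) eq = cong fromLetters (≡ʷ⇒≡ u w eq)

coeff-vanishing : {I : Set} {b : I → Series} {f : Series} (E : Expansion b f) → ∀ i →
  i ∉ Expansion.support E → coeff E i ≡ 0ℤ
coeff-vanishing E i i∉ = decidable-stable (coeff E i ℤ.≟ 0ℤ) (λ ne → i∉ (Expansion.vanishing E i ne))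

F-coefficient-expansion : {I : Set} {b : I → Series} {f : Series} (E : Expansion b f) → ∀ w →
  F-coefficient f w ≡ Σℤ (Expansion.support E) (λ i → coeff E i ℤ.* F-coefficient (b i) w)
F-coefficient-expansion {b = b} E w = trans (F-coefficient-cong (Expansion.combination E) w)
  (trans (F-coefficient-∑ (Expansion.support E) (λ i → coeff E i · b i) w)
    (Σℤ-cong (Expansion.support E) (λ i _ → F-coefficient-· (coeff E i) (b i) w)))

-- `F-coefficient` annihilates every summand but one. All expansions in F therefore agree, and the
-- unknown expansion behind a member of `supp-F` can be evaluated.
coeff-F : ∀ {f} (E : Expansion F f) → ∀ w → coeff E (fromWord w) ≡ F-coefficient f w
coeff-F {f} E w = sym (trans (F-coefficient-expansion E w) (collect (Any.any? (α ≟ᶜ_) (Expansion.support E))))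
  where
  α = fromWord w
  off : ∀ β → β ≢ α → F-coefficient (F β) w ≡ 0ℤ
  off β ne = trans (cong (λ β → F-coefficient (F β) w) (sym (composition-word β)))
    (trans (F-coefficient-F (toWord (parts β)) w) (decidable-stable (_ ℤ.≟ 0ℤ) λ nz →
      ne (trans (sym (composition-word β)) (≡⁺⇒fromWord-≡ (toWord (parts β)) w (𝟙ℤ-≢0 nz)))))
  on : F-coefficient (F α) w ≡ 1ℤ
  on = trans (F-coefficient-F w w) (cong 𝟙ℤ (≡⁺-refl w))
  vanish : ∀ β → β ≢ α → coeff E β ℤ.* F-coefficient (F β) w ≡ 0ℤ
  vanish β ne = trans (cong (coeff E β ℤ.*_) (off β ne)) (ℤ.*-zeroʳ (coeff E β))
  collect : Dec (α ∈ Expansion.support E) →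
    Σℤ (Expansion.support E) (λ β → coeff E β ℤ.* F-coefficient (F β) w) ≡ coeff E α
  collect (yes α∈) = trans (Σℤ-single (Expansion.unique E) α∈ (λ β _ → vanish β))
    (trans (cong (coeff E α ℤ.*_) on) (ℤ.*-identityʳ (coeff E α)))
  collect (no α∉)  = trans
    (Σℤ-zero (Expansion.support E) (λ β β∈ → vanish β (λ { refl → α∉ β∈ }))) (sym (coeff-vanishing E α α∉))

F-expansion : {I : Set} (is : List I) (c : I → Composition) → Expansion F (∑ is (F ∘ c))
F-expansion is c = record
  { coeff       = mult
  ; support     = supp
  ; unique      = deduplicate-! (map c is)
  ; vanishing   = λ α ne → let i , i∈ , nz = Σℤ-≢0 is ne
                           in in-supp i∈ (sym (hit (c i ≟ᶜ α) nz))
  ; combination = λ e → sym (trans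
      (Σℤ-cong supp (λ α _ → trans (ℤ.*-comm (mult α) (F α e)) (sym (Σℤ-* (F α e) is (λ i → 𝟙ℤ (does (c i ≟ᶜ α)))))))
      (trans (Σℤ-swap supp is (λ α i → F α e ℤ.* 𝟙ℤ (does (c i ≟ᶜ α))))
        (Σℤ-cong is (λ i i∈ → trans
          (Σℤ-single (deduplicate-! (map c is)) (in-supp i∈ refl) (λ α _ ne →
            trans (cong (λ b → F α e ℤ.* 𝟙ℤ b) (dec-false (c i ≟ᶜ α) (ne ∘ sym))) (ℤ.*-zeroʳ (F α e))))
          (trans (cong (λ b → F (c i) e ℤ.* 𝟙ℤ b) (dec-true (c i ≟ᶜ c i) refl)) (ℤ.*-identityʳ (F (c i) e)))))))
  }
  where
  open import Data.List.Relation.Unary.Unique.DecPropositional.Properties _≟ᶜ_ using (deduplicate-!)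
  supp = deduplicate _≟ᶜ_ (map c is)
  mult : Composition → ℤ
  mult α = Σℤ is (λ i → 𝟙ℤ (does (c i ≟ᶜ α)))
  in-supp : ∀ {i α} → i ∈ is → α ≡ c i → α ∈ supp
  in-supp i∈ refl = ∈.∈-deduplicate⁺ _≟ᶜ_ (∈.∈-map⁺ c i∈)
  hit : ∀ {P : Set} (P? : Dec P) → 𝟙ℤ (does P?) ≢ 0ℤ → P
  hit (yes p) _  = p
  hit (no _)  ne = contradiction refl ne

supp-F-≐⇒sameRects : ∀ A B → supp-F A ≐ supp-F B → SameRects A B
supp-F-≐⇒sameRects A B (A⊆B , B⊆A) = sameRects A B
  (words-⊆⇒rects-≥ A B (sub A B A⊆B)) (words-⊆⇒rects-≥ B A (sub B A B⊆A))
  where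
  sub : ∀ A B → (∀ {α} → supp-F A α → supp-F B α) → ∀ p → A HasWord (descentWord p) → B HasWord (descentWord p)
  sub A B A⊆B p has = nonzero⇒hasWord B p λ eq₀ → ℤ.<-irrefl (sym (trans (coeff-F (proj₁ inB) w) eq₀)) (proj₂ inB)
    where
    w = descentWord p
    inB : supp-F B (fromWord w)
    inB = A⊆B (F-expansion (SYTs A) (comp A)
              , subst (0ℤ ℤ.<_) (sym (coeff-F (F-expansion (SYTs A) (comp A)) w)) (hasWord⇒positive A has))

-- Reading off rectangles from a Schur expansion

Σ<-entry : ∀ l as → Σ< (length as) (λ i → entry as i ∸ l) ≡ excess l as
Σ<-entry l []       = refl
Σ<-entry l (a ∷ as) = cong (a ∸ l +_) (Σ<-entry l as)

Σ<-entry-drop : ∀ j l as → Σ< (length as) (λ i → entry as (i + j) ∸ l) ≡ excess l (drop j as)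
Σ<-entry-drop zero    l as       = trans
  (Σ<-cong (length as) (λ i _ → cong (λ i → entry as i ∸ l) (+-identityʳ i))) (Σ<-entry l as)
Σ<-entry-drop (suc j) l []       = refl
Σ<-entry-drop (suc j) l (a ∷ as) = begin
  Σ< (suc (length as)) (λ i → entry (a ∷ as) (i + suc j) ∸ l)
    ≡⟨ Σ<-cong (suc (length as)) (λ i _ → cong (λ i → entry (a ∷ as) i ∸ l) (+-suc i j)) ⟩
  Σ< (suc (length as)) (λ i → entry as (i + j) ∸ l)
    ≡⟨ Σ<-last (length as) _ ⟩
  Σ< (length as) (λ i → entry as (i + j) ∸ l) + (entry as (length as + j) ∸ l)
    ≡⟨ cong₂ _+_ (Σ<-entry-drop j l as)
         (trans (cong (_∸ l) (entry-beyond as (length as + j) (m≤m+n (length as) j))) (0∸n≡0 l)) ⟩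
  excess l (drop j as) + 0
    ≡⟨ +-identityʳ _ ⟩
  excess l (drop j as) ∎
  where open ≡-Reasoning

rows-of : Partition → List ℕ
rows-of λ′ = parts (composition λ′)

-- In a straight shape, deleting the `j` top boxes of all columns and the `l` leftmost boxes of all
-- rows deletes the first `j` rows and `l` columns.
rects-straight : ∀ λ′ j l → rects (suc j) (suc l) (λ′ /∅) ≡ excess l (drop j (rows-of λ′))
rects-straight λ′ j l = trans (rects-formula (λ′ /∅) j l) (Σ<-entry-drop j l (rows-of λ′))

excess-0 : ∀ as → excess 0 as ≡ sum as
excess-0 as = cong sum (List.map-id as)

excess-large : ∀ {l} as → sum as ≤ l → excess l as ≡ 0
excess-large []       _  = refl
excess-large (a ∷ as) le = cong₂ _+_ (m≤n⇒m∸n≡0 (≤-trans (m≤m+n a (sum as)) le))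
                                     (excess-large as (≤-trans (m≤n+m (sum as) a) le))

sum-drop-≤ : ∀ k as → sum (drop k as) ≤ sum as
sum-drop-≤ zero    as       = ≤-refl
sum-drop-≤ (suc k) []       = ≤-refl
sum-drop-≤ (suc k) (a ∷ as) = ≤-trans (sum-drop-≤ k as) (m≤n+m (sum as) a)

linked-drop : ∀ k {as} → Linked _≥_ as → Linked _≥_ (drop k as)
linked-drop zero    l         = l
linked-drop (suc k) []        = []
linked-drop (suc k) [-]       = linked-drop k []
linked-drop (suc k) (_ ∷ l)   = linked-drop k l

-- Each of the first `k` parts is a difference of consecutive tail sums; positivity of the parts
-- excludes that one list ends earlier.
drop-sums-injective : ∀ k {as bs} → All NonZero as → All NonZero bs → drop k as ≡ drop k bs →
  (∀ j → j ≤ k → sum (drop j as) ≡ sum (drop j bs)) → as ≡ bs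
drop-sums-injective zero    _ _ eq _ = eq
drop-sums-injective (suc k) {[]}         {[]}         _ _ _ _ = refl
drop-sums-injective (suc k) {[]}         {suc b ∷ bs} _ _ _ s = contradiction (s 0 z≤n) λ ()
drop-sums-injective (suc k) {[]}         {zero ∷ bs}  _ (record { nonZero = () } ∷ _)
drop-sums-injective (suc k) {suc a ∷ as} {[]}         _ _ _ s = contradiction (s 0 z≤n) λ ()
drop-sums-injective (suc k) {zero ∷ as}  {[]}         (record { nonZero = () } ∷ _)
drop-sums-injective (suc k) {a ∷ as}     {b ∷ bs}     (_ ∷ pa) (_ ∷ pb) eq s
  with drop-sums-injective k pa pb eq (λ j le → s (suc j) (s≤s le))
... | refl = cong (_∷ as) (+-cancelʳ-≡ (sum as) a b (s 0 z≤n))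

module Profile (k N : ℕ) where

  -- Restricted to j ≤ k, and to the second index 0 or the first index k, the
  -- numbers of rectangles of a shape are all attained by one descent word.
  infix 4 _≼_
  _≼_ : SkewShape → SkewShape → Set
  A ≼ B = (∀ j → j ≤ k → rects (suc j) 1 A ≤ rects (suc j) 1 B)
        × (∀ l → rects (suc k) (suc l) A ≤ rects (suc k) (suc l) B)

  ≼-trans : ∀ A B C → A ≼ B → B ≼ C → A ≼ C
  ≼-trans A B C (a , b) (c , d) = (λ j le → ≤-trans (a j le) (c j le)) , λ l → ≤-trans (b l) (d l)

  -- `_≼_` compares infinitely many numbers. For partitions of size at most `N` those with `l`
  -- beyond `N` are 0, so this finite sum detects strict inequality and supports an induction.
  weight : SkewShape → ℕ
  weight A = Σ< (suc k) (λ j → rects (suc j) 1 A) + Σ< (suc N) (λ l → rects (suc k) (suc l) A)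

  hasWord⇒≼ : ∀ A B p → A HasWord (descentWord p) →
    (∀ j → j ≤ k → remaining j 0 (descentWord p) ≤ rects (suc j) 1 B) →
    (∀ l → remaining k l (descentWord p) ≤ rects (suc k) (suc l) B) → A ≼ B
  hasWord⇒≼ A B p has bdⱼ bdₗ =
      (λ j le → ≤-trans (hasWord⇒rects-≤ A has j 0) (bdⱼ j le))
    , (λ l → ≤-trans (hasWord⇒rects-≤ A has k l) (bdₗ l))

  ∣_∣ₚ : Partition → ℕ
  ∣ λ′ ∣ₚ = sum (rows-of λ′)

  size-≼ : ∀ λ′ μ′ → (λ′ /∅) ≼ (μ′ /∅) → ∣ λ′ ∣ₚ ≤ ∣ μ′ ∣ₚ
  size-≼ λ′ μ′ (le , _) = subst₂ _≤_
    (trans (rects-straight λ′ 0 0) (excess-0 (rows-of λ′))) (trans (rects-straight μ′ 0 0) (excess-0 (rows-of μ′)))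
    (le 0 z≤n)

  -- Comparable profiles of equal weight agree entry by entry. The entries at `(k , l)` recover the
  -- rows after the first `k`, those at `(j , 0)` the first `k` rows.
  ≼-tight : ∀ λ′ μ′ → (λ′ /∅) ≼ (μ′ /∅) → ∣ μ′ ∣ₚ ≤ N → weight (μ′ /∅) ≤ weight (λ′ /∅) → λ′ ≡ μ′
  ≼-tight λ′ μ′ λ≼μ@(leⱼ , leₗ) bound heavy = partition-≡
    (drop-sums-injective k (nonZeroParts (composition λ′)) (nonZeroParts (composition μ′)) tails sums)
    where
    as = rows-of λ′
    bs = rows-of μ′
    sumⱼ : ∀ A → ℕ
    sumⱼ A = Σ< (suc k) (λ j → rects (suc j) 1 A)
    sumₗ : ∀ A → ℕ
    sumₗ A = Σ< (suc N) (λ l → rects (suc k) (suc l) A)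
    sumⱼ-≤ : sumⱼ (λ′ /∅) ≤ sumⱼ (μ′ /∅)
    sumⱼ-≤ = Σ<-mono (suc k) (λ j lt → leⱼ j (s≤s⁻¹ lt))
    sumₗ-≤ : sumₗ (λ′ /∅) ≤ sumₗ (μ′ /∅)
    sumₗ-≤ = Σ<-mono (suc N) (λ l _ → leₗ l)
    eqⱼ : ∀ j → j < suc k → rects (suc j) 1 (λ′ /∅) ≡ rects (suc j) 1 (μ′ /∅)
    eqⱼ = Σ<-tight (suc k) (λ j lt → leⱼ j (s≤s⁻¹ lt))
      (+-cancelʳ-≤ (sumₗ (μ′ /∅)) _ _ (≤-trans heavy (+-monoʳ-≤ (sumⱼ (λ′ /∅)) sumₗ-≤)))
    eqₗ : ∀ l → l < suc N → rects (suc k) (suc l) (λ′ /∅) ≡ rects (suc k) (suc l) (μ′ /∅)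
    eqₗ = Σ<-tight (suc N) (λ l _ → leₗ l)
      (+-cancelˡ-≤ (sumⱼ (μ′ /∅)) _ _ (≤-trans heavy (+-monoˡ-≤ (sumₗ (λ′ /∅)) sumⱼ-≤)))
    large : ∀ ν → ∣ ν ∣ₚ ≤ N → ∀ l → N < l → excess l (drop k (rows-of ν)) ≡ 0
    large ν le l lt = excess-large (drop k (rows-of ν)) (≤-trans (sum-drop-≤ k (rows-of ν)) (≤-trans le (<⇒≤ lt)))
    excesses : ∀ l → excess l (drop k as) ≡ excess l (drop k bs)
    excesses l with l <? suc N
    ... | yes lt = trans (sym (rects-straight λ′ k l)) (trans (eqₗ l lt) (rects-straight μ′ k l))
    ... | no  ge = trans (large λ′ (≤-trans (size-≼ λ′ μ′ λ≼μ) bound) l (≮⇒≥ ge)) (sym (large μ′ bound l (≮⇒≥ ge)))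
    tails : drop k as ≡ drop k bs
    tails = excess-injective (linked-drop k (decreasingParts λ′)) (linked-drop k (decreasingParts μ′))
      (All.drop⁺ k (nonZeroParts (composition λ′))) (All.drop⁺ k (nonZeroParts (composition μ′))) excesses
    sums : ∀ j → j ≤ k → sum (drop j as) ≡ sum (drop j bs)
    sums j le = begin
      sum (drop j as)               ≡⟨ excess-0 (drop j as) ⟨
      excess 0 (drop j as)          ≡⟨ rects-straight λ′ j 0 ⟨
      rects (suc j) 1 (λ′ /∅)       ≡⟨ eqⱼ j (s≤s le) ⟩
      rects (suc j) 1 (μ′ /∅)       ≡⟨ rects-straight μ′ j 0 ⟩
      excess 0 (drop j bs)          ≡⟨ excess-0 (drop j bs) ⟩
      sum (drop j bs)               ∎
      where open ≡-Reasoning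

_≟ᵖ_ : (λ′ μ′ : Partition) → Dec (λ′ ≡ μ′)
λ′ ≟ᵖ μ′ with List.≡-dec _≟_ (rows-of λ′) (rows-of μ′)
... | yes eq = yes (partition-≡ eq)
... | no ne  = no (ne ∘ cong rows-of)

*-≢0 : ∀ {x y} → x ≢ 0ℤ → y ≢ 0ℤ → x ℤ.* y ≢ 0ℤ
*-≢0 {x} x≢0 y≢0 eq = [ x≢0 , y≢0 ]′ (ℤ.i*j≡0⇒i≡0∨j≡0 x eq)

module _ (A : SkewShape) (E : Expansion schur (skewSchur A)) where

  private
    term : List Bool → Partition → ℤ
    term w μ′ = coeff E μ′ ℤ.* F-coefficient (schur μ′) w

    term-≢0 : ∀ p {μ′} → term (descentWord p) μ′ ≢ 0ℤ → coeff E μ′ ≢ 0ℤ × (μ′ /∅) HasWord (descentWord p)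
    term-≢0 p {μ′} ne =
        (λ eq → ne (cong (ℤ._* F-coefficient (schur μ′) (descentWord p)) eq))
      , nonzero⇒hasWord (μ′ /∅) p (λ eq → ne (trans (cong (coeff E μ′ ℤ.*_) eq) (ℤ.*-zeroʳ (coeff E μ′))))

    other-term : ∀ w λ′ → coeff E λ′ ≢ 0ℤ → (λ′ /∅) HasWord w → F-coefficient (skewSchur A) w ≡ 0ℤ →
      ∃[ μ′ ] μ′ ≢ λ′ × term w μ′ ≢ 0ℤ
    other-term w λ′ c≢0 has eq₀ =
      search (Any.any? (λ μ′ → ¬? (μ′ ≟ᵖ λ′) ×-dec ¬? (term w μ′ ℤ.≟ 0ℤ)) (Expansion.support E))
      where
      search : Dec (Any (λ μ′ → μ′ ≢ λ′ × term w μ′ ≢ 0ℤ) (Expansion.support E)) →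
        ∃[ μ′ ] μ′ ≢ λ′ × term w μ′ ≢ 0ℤ
      search (yes some) = let μ′ , _ , found = find some in μ′ , found
      search (no none)  = contradiction
        (trans (sym (Σℤ-single (Expansion.unique E) (Expansion.vanishing E λ′ c≢0)
                 (λ μ′ μ′∈ ne → decidable-stable (term w μ′ ℤ.≟ 0ℤ) (λ nz → none (lose μ′∈ (ne , nz))))))
               (trans (sym (F-coefficient-expansion E w)) eq₀))
        (*-≢0 c≢0 (λ eq → ℤ.<-irrefl (sym eq) (hasWord⇒positive (λ′ /∅) has)))

  module _ (k N : ℕ) where
    open Profile k N

    -- If s_A does not contain F of the optimal word of λ′, then that term of
    -- s_λ′ is cancelled by some s_μ′ with μ′ strictly lighter than λ′.
    expansion-lower : ∀ m λ′ → weight (λ′ /∅) < m → ∣ λ′ ∣ₚ ≤ N → coeff E λ′ ≢ 0ℤ → A ≼ (λ′ /∅)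
    expansion-lower (suc m) λ′ light bound c≢0 = decide (F-coefficient (skewSchur A) (descentWord p) ℤ.≟ 0ℤ)
      where
      optimal = optimalPath (λ′ /∅) k
      p = proj₁ optimal
      bdⱼ = proj₁ (proj₂ (proj₂ optimal))
      bdₗ = proj₂ (proj₂ (proj₂ optimal))
      decide : Dec (F-coefficient (skewSchur A) (descentWord p) ≡ 0ℤ) → A ≼ (λ′ /∅)
      decide (no nz)    = hasWord⇒≼ A (λ′ /∅) p (nonzero⇒hasWord A p nz) bdⱼ bdₗ
      decide (yes eq₀) = let
          μ′ , ne , nz = other-term (descentWord p) λ′ c≢0 (p , proj₁ (proj₂ optimal) , refl) eq₀
          c′≢0 , has = term-≢0 p nz
          -- `μ′` has the optimal word of `λ′`, so its profile is bounded by that of `λ′`; being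
          -- different, it is strictly lighter.
          μ≼λ = hasWord⇒≼ (μ′ /∅) (λ′ /∅) p has bdⱼ bdₗ
          lighter = ≰⇒> (λ heavy → ne (≼-tight μ′ λ′ μ≼λ bound heavy))
        in ≼-trans A (μ′ /∅) (λ′ /∅)
             (expansion-lower m μ′ (<-≤-trans lighter (s≤s⁻¹ light)) (≤-trans (size-≼ μ′ λ′ μ≼λ) bound) c′≢0) μ≼λ

    -- The optimal word of A has a positive coefficient in its skew Schur function, so some Schur
    -- function of the expansion contains it.
    expansion-attained : ∃[ λ′ ] coeff E λ′ ≢ 0ℤ × (λ′ /∅) ≼ A
    expansion-attained = let
        p , π , bdⱼ , bdₗ = optimalPath A k
        λ′ , _ , nz = Σℤ-≢0 (Expansion.support E) {term (descentWord p)} (λ eq → ℤ.<-irrefl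
          (sym (trans (F-coefficient-expansion E (descentWord p)) eq)) (hasWord⇒positive A (p , π , refl)))
        c≢0 , has = term-≢0 p nz
      in λ′ , c≢0 , hasWord⇒≼ (λ′ /∅) A p has bdⱼ bdₗ

supp-s-⊆⇒rects-≥ : ∀ A B → Expansion schur (skewSchur A) → (∀ {λ′} → supp-s A λ′ → supp-s B λ′) →
  ∀ k l → rects (suc k) (suc l) B ≤ rects (suc k) (suc l) A
supp-s-⊆⇒rects-≥ A B E A⊆B k l = let
    -- `_≼_` involves `k` alone, so 0 is a placeholder. The `N` below bounds the size of `λ′`; in
    -- its support every member lies above B, whence B ≼ `λ′` ≼ A.
    λ′ , c≢0 , λ≼A = expansion-attained A E k 0
    E′ , c′≢0 = A⊆B {λ′} (E , c≢0)
    N = sum (rows-of λ′)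
    _ , B≤λ = expansion-lower B E′ k N (suc (Profile.weight k N (λ′ /∅))) λ′ ≤-refl ≤-refl c′≢0
  in ≤-trans (B≤λ l) (proj₂ λ≼A l)

-- Monomial coefficients and chains of horizontal strips

module _ {I K : Set} where

  -- The sets `P i` form a partition of `Q`. This splits the strips according to the row of their
  -- first box.
  Σℤ-fibre : {P : I → K → Set} (P? : ∀ i κ → Dec (P i κ)) {Q : K → Set} (Q? : ∀ κ → Dec (Q κ))
    {is : List I} → Unique is → (κs : List K) (h : K → ℤ) →
    (∀ κ → Q κ → ∃[ i ] i ∈ is × P i κ) → (∀ i κ → i ∈ is → P i κ → Q κ) →
    (∀ i j κ → i ∈ is → j ∈ is → P i κ → P j κ → i ≡ j) →
    Σℤ is (λ i → Σℤ (filter (P? i) κs) h) ≡ Σℤ (filter Q? κs) h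
  Σℤ-fibre {P} P? {Q} Q? {is} u κs h some into only = begin
    Σℤ is (λ i → Σℤ (filter (P? i) κs) h)
      ≡⟨ Σℤ-cong is (λ i _ → Σℤ-filter (P? i) κs h) ⟩
    Σℤ is (λ i → Σℤ κs (λ κ → 𝟙ℤ (does (P? i κ)) ℤ.* h κ))
      ≡⟨ Σℤ-swap is κs (λ i κ → 𝟙ℤ (does (P? i κ)) ℤ.* h κ) ⟩
    Σℤ κs (λ κ → Σℤ is (λ i → 𝟙ℤ (does (P? i κ)) ℤ.* h κ))
      ≡⟨ Σℤ-cong κs (λ κ _ → fibre κ (Q? κ)) ⟩
    Σℤ κs (λ κ → 𝟙ℤ (does (Q? κ)) ℤ.* h κ)
      ≡⟨ Σℤ-filter Q? κs h ⟨
    Σℤ (filter Q? κs) h ∎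
    where
    open ≡-Reasoning
    off : ∀ i κ → ¬ P i κ → 𝟙ℤ (does (P? i κ)) ℤ.* h κ ≡ 0ℤ
    off i κ ¬p = cong (λ b → 𝟙ℤ b ℤ.* h κ) (dec-false (P? i κ) ¬p)
    fibre : ∀ κ (q? : Dec (Q κ)) → Σℤ is (λ i → 𝟙ℤ (does (P? i κ)) ℤ.* h κ) ≡ 𝟙ℤ (does q?) ℤ.* h κ
    fibre κ (no ¬q) = Σℤ-zero is λ i i∈ → off i κ (¬q ∘ into i κ i∈)
    fibre κ (yes q) = let i , i∈ , p = some κ q in trans
      (Σℤ-single u i∈ (λ j j∈ ne → off j κ (λ p′ → ne (only j i κ j∈ i∈ p′ p))))
      (cong (λ b → 𝟙ℤ b ℤ.* h κ) (dec-true (P? i κ) p))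

module Chains {r : ℕ} (top : Vec ℕ r) (top-suc-≤ : ∀ i → at top (suc i) ≤ at top i) where
  open Paths top top-suc-≤
  open Enumeration top top-suc-≤
  open Greedy top top-suc-≤

  all-rows? : {P : ℕ → Set} → (∀ i → Dec (P i)) → (∀ i → r ≤ i → P i) → Dec (∀ i → P i)
  all-rows? {P} P? beyond with allUpTo? P? r
  ... | yes all = yes λ i → [ all , beyond i ]′ (<-≤-connex i r)
  ... | no ¬all = no λ all → ¬all λ {i} _ → all i

  -- κ / μ is a horizontal strip of size b.
  record Strip (b : ℕ) (μ κ : State) : Set where
    constructor strip
    field
      grows     : ∀ i → at μ i ≤ at κ i
      interlace : ∀ i → at κ (suc i) ≤ at μ i
      inside    : ∀ i → at κ i ≤ at top i
      size-eq   : total κ ≡ b + total μ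

  open Strip

  strip? : ∀ b μ κ → Dec (Strip b μ κ)
  strip? b μ κ with all-rows? (λ i → at μ i ≤? at κ i) (λ i le → ≤-trans (≤-reflexive (at-beyond μ le)) z≤n)
                  | all-rows? (λ i → at κ (suc i) ≤? at μ i)
                      (λ i le → ≤-trans (≤-reflexive (at-beyond κ (≤-trans le (n≤1+n i)))) z≤n)
                  | all-rows? (λ i → at κ i ≤? at top i) (λ i le → ≤-trans (≤-reflexive (at-beyond κ le)) z≤n)
                  | total κ ≟ b + total μ
  ... | yes g | yes i | yes n | yes s = yes (strip g i n s)
  ... | no ¬g | _     | _     | _     = no (¬g ∘ grows)
  ... | _     | no ¬i | _     | _     = no (¬i ∘ interlace)
  ... | _     | _     | no ¬n | _     = no (¬n ∘ inside)
  ... | _     | _     | _     | no ¬s = no (¬s ∘ size-eq)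

  -- A crude finite superset of the diagrams inside `top`; `strip?` selects from it.
  states : List State
  states = allVecs (upTo (suc (at top 0))) r

  states-unique : Unique states
  states-unique = allVecs-unique (Unique.upTo⁺ (suc (at top 0))) r

  ∈-states : ∀ {κ : State} → (∀ i → at κ i ≤ at top i) → κ ∈ states
  ∈-states {κ} le = go κ (λ i → ≤-trans (le i) (top-antitone z≤n))
    where
    go : ∀ {m} (v : Vec ℕ m) → (∀ i → at v i ≤ at top 0) → v ∈ allVecs (upTo (suc (at top 0))) m
    go []      _  = here refl
    go (x ∷ v) le = ∈.∈-cartesianProductWith⁺ _∷_ (∈.∈-upTo⁺ (s≤s (le 0))) (go v (le ∘ suc))

  -- A skew Kostka number: the number of semistandard tableaux of shape `top / μ` and content `β`,
  -- read as chains of horizontal strips.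
  chains : List ℕ → State → ℤ
  chains []      μ = 𝟙ℤ (does (Vec.≡-dec _≟_ μ top))
  chains (b ∷ β) μ = Σℤ (filter (strip? b μ) states) (chains β)

  pathCount : List Bool → ℕ → State → ℤ
  pathCount v s μ = Σℤ (paths (length v) μ) (λ p → 𝟙ℤ (descents s p ≤ʷ v))

  candidates : State → List ℕ
  candidates μ = filter (addable? μ) (upTo r)

  candidates⁻ : ∀ μ {i} → i ∈ candidates μ → Addable μ i
  candidates⁻ μ i∈ = proj₂ (∈.∈-filter⁻ (addable? μ) {xs = upTo r} i∈)

  private
    pathCount-∷ : ∀ a v s μ → pathCount (a ∷ v) s μ ≡
      Σℤ (candidates μ) (λ i → Σℤ (paths (length v) (inc i μ)) (λ p → 𝟙ℤ ((does (s ≤? i) ∷ descents (suc i) p) ≤ʷ (a ∷ v))))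
    pathCount-∷ a v s μ = trans
      (Σℤ-concatMap (λ i → map (i ∷_) (paths (length v) (inc i μ))) (candidates μ) _)
      (Σℤ-cong (candidates μ) (λ i _ → Σℤ-map (i ∷_) (paths (length v) (inc i μ)) _))

    ≤ʷ-true : ∀ b u v → (b ∷ u) ≤ʷ (true ∷ v) ≡ u ≤ʷ v
    ≤ʷ-true true  u v = refl
    ≤ʷ-true false u v = refl

  pathCount-true : ∀ v s μ → pathCount (true ∷ v) s μ ≡
    Σℤ (candidates μ) (λ i → pathCount v (suc i) (inc i μ))
  pathCount-true v s μ = trans (pathCount-∷ true v s μ) (Σℤ-cong (candidates μ) λ i _ →
    Σℤ-cong (paths (length v) (inc i μ)) λ p _ → cong 𝟙ℤ (≤ʷ-true (does (s ≤? i)) (descents (suc i) p) v))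

  pathCount-false : ∀ v s μ → pathCount (false ∷ v) s μ ≡
    Σℤ (filter (_<? s) (candidates μ)) (λ i → pathCount v (suc i) (inc i μ))
  pathCount-false v s μ = trans (pathCount-∷ false v s μ) (trans
    (Σℤ-cong (candidates μ) λ i _ → term i (s ≤? i))
    (sym (Σℤ-filter (_<? s) (candidates μ) (λ i → pathCount v (suc i) (inc i μ)))))
    where
    term : ∀ i (s≤i? : Dec (s ≤ i)) →
      Σℤ (paths (length v) (inc i μ)) (λ p → 𝟙ℤ ((does s≤i? ∷ descents (suc i) p) ≤ʷ (false ∷ v))) ≡
      𝟙ℤ (does (i <? s)) ℤ.* pathCount v (suc i) (inc i μ)
    term i (yes s≤i) = trans (Σℤ-zero (paths (length v) (inc i μ)) (λ _ _ → refl))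
      (cong (λ b → 𝟙ℤ b ℤ.* pathCount v (suc i) (inc i μ)) (sym (dec-false (i <? s) (≤⇒≯ s≤i))))
    term i (no s≰i)  = trans (sym (ℤ.*-identityˡ (pathCount v (suc i) (inc i μ))))
      (cong (λ b → 𝟙ℤ b ℤ.* pathCount v (suc i) (inc i μ)) (sym (dec-true (i <? s) (≰⇒> s≰i))))

  -- Rows are numbered below `r`, so with threshold `r` the letter `false` forbids nothing. The
  -- first box of a part can thus be treated like the rest of its run.
  pathCount-true-false : ∀ v s μ → pathCount (true ∷ v) s μ ≡ pathCount (false ∷ v) r μ
  pathCount-true-false v s μ = trans (pathCount-true v s μ) (trans
    (cong (λ is → Σℤ is (λ i → pathCount v (suc i) (inc i μ)))
      (sym (List.filter-all (_<? r) (All.tabulate (λ i∈ → addable-row μ (candidates⁻ μ i∈))))))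
    (sym (pathCount-false v r μ)))

  -- A run without descents fills its strip from the lowest row upwards; this is what can still be
  -- added when the next box must lie above row `s`.
  Run : ℕ → ℕ → State → State → Set
  Run b s μ κ = Strip b μ κ × (∀ i → s ≤ i → at κ i ≡ at μ i)

  run? : ∀ b s μ κ → Dec (Run b s μ κ)
  run? b s μ κ = strip? b μ κ ×-dec all-rows? (λ i → (s ≤? i) →-dec (at κ i ≟ at μ i))
    (λ i le _ → trans (at-beyond κ le) (sym (at-beyond μ le)))

  total-tight : ∀ (κ κ′ : State) → (∀ i → at κ i ≤ at κ′ i) → total κ′ ≤ total κ → κ ≡ κ′
  total-tight κ κ′ le ge = at-ext λ i → [ Σ<-tight r (λ i _ → le i) ge i
    , (λ r≤i → trans (at-beyond κ r≤i) (sym (at-beyond κ′ r≤i))) ]′ (<-≤-connex i r)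

  -- The first letter of a run without descents is the lowest row it changes.
  run-split : ∀ b s μ κ → Run (suc b) s μ κ →
    ∃[ i ] i ∈ filter (_<? s) (candidates μ) × Run b (suc i) (inc i μ) κ
  run-split b s μ κ (st , fixed) with find-max r (λ i → at μ i <? at κ i)
  ... | inj₂ none = contradiction
    (Σ<-mono r {at κ} {at μ} (λ i lt → ≮⇒≥ (none i lt)))
    (<⇒≱ (≤-trans (s≤s (m≤n+m (total μ) b)) (≤-reflexive (sym (size-eq st)))))
  ... | inj₁ (i , i<r , lt , greatest) = i
    , ∈.∈-filter⁺ (_<? s) (∈.∈-filter⁺ (addable? μ) (∈.∈-upTo⁺ i<r) (<-≤-trans lt (inside st i) , free i lt)) i<s
    , strip (inc-≤ μ κ i<r (grows st) lt)
        (λ j → ≤-trans (interlace st j) (at-≤-inc i j μ)) (inside st)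
        (trans (size-eq st) (trans (sym (+-suc b (total μ))) (cong (b +_) (sym (total-inc i<r μ)))))
    , λ j i<j → trans (same j i<j (<-≤-connex j r)) (sym (at-inc-≢ (<⇒≢ i<j) μ))
    where
    i<s : i < s
    i<s = ≰⇒> λ s≤i → <⇒≢ lt (sym (fixed i s≤i))
    free : ∀ i → at μ i < at κ i → at μ i < above μ i
    free zero    lt = <-≤-trans lt (inside st 0)
    free (suc i) lt = <-≤-trans lt (interlace st i)
    same : ∀ j → i < j → j < r ⊎ r ≤ j → at κ j ≡ at μ j
    same j i<j (inj₁ j<r) = ≤-antisym (≮⇒≥ (greatest j i<j j<r)) (grows st j)
    same j i<j (inj₂ r≤j) = trans (at-beyond κ r≤j) (sym (at-beyond μ r≤j))

  run-join : ∀ b s μ κ i → Good μ → i < s → Addable μ i → Run b (suc i) (inc i μ) κ → Run (suc b) s μ κ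
  run-join b s μ κ i g i<s add (st , fixed) =
      strip (λ j → ≤-trans (at-≤-inc i j μ) (grows st j)) lace (inside st)
        (trans (size-eq st) (trans (cong (b +_) (total-inc (addable-row μ add) μ)) (+-suc b (total μ))))
    , λ j s≤j → trans (fixed j (≤-trans i<s s≤j)) (at-inc-≢ (<⇒≢ (<-≤-trans i<s s≤j)) μ)
    where
    lace : ∀ j → at κ (suc j) ≤ at μ j
    lace j with i ≟ j
    -- The box just put into row `i` gives no support to row `suc i`, because the rest of the run
    -- leaves that row unchanged.
    ... | yes refl = ≤-trans (≤-reflexive (trans (fixed (suc i) ≤-refl) (at-inc-≢ (<⇒≢ (n<1+n i)) μ))) (decreasing g i)
    ... | no ne    = ≤-trans (interlace st j) (≤-reflexive (at-inc-≢ ne μ))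

  -- If one run started in a strictly lower row than the other, it would change a row that the other
  -- leaves fixed.
  run-first : ∀ b s μ κ i j → i ∈ filter (_<? s) (candidates μ) → j ∈ filter (_<? s) (candidates μ) →
    Run b (suc i) (inc i μ) κ → Run b (suc j) (inc j μ) κ → i ≡ j
  run-first b s μ κ i j i∈ j∈ ρ ρ′ = ≤-antisym (≮⇒≥ (not-below j i i∈ ρ′ ρ)) (≮⇒≥ (not-below i j j∈ ρ ρ′))
    where
    not-below : ∀ i j → j ∈ filter (_<? s) (candidates μ) →
      Run b (suc i) (inc i μ) κ → Run b (suc j) (inc j μ) κ → ¬ i < j
    not-below i j j∈ (_ , fixed) (st , _) i<j = <⇒≱ (n<1+n (at μ j))
      (≤-trans (≤-reflexive (sym (at-inc j<r μ)))
        (≤-trans (grows st j) (≤-reflexive (trans (fixed j i<j) (at-inc-≢ (<⇒≢ i<j) μ)))))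
      where
      j<r = addable-row μ (candidates⁻ μ (proj₁ (∈.∈-filter⁻ (_<? s) {xs = candidates μ} j∈)))

  -- Every horizontal strip is added by exactly one run without descents, so summing over runs is
  -- summing over strips.
  pathCount-run : ∀ v (h : State → ℤ) → (∀ s κ → Good κ → pathCount v s κ ≡ h κ) → ∀ b s μ → Good μ →
    pathCount (replicate b false ++ v) s μ ≡ Σℤ (filter (run? b s μ) states) h
  pathCount-run v h eq zero s μ g = trans (eq s μ g) (sym (Σℤ-single
    (Unique.filter⁺ (run? 0 s μ) states-unique)
    (∈.∈-filter⁺ (run? 0 s μ) (∈-states (below g))
      (strip (λ _ → ≤-refl) (decreasing g) (below g) refl , λ _ _ → refl))
    (λ κ κ∈ ne → contradiction (sym (same κ (proj₂ (∈.∈-filter⁻ (run? 0 s μ) {xs = states} κ∈)))) ne)))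
    where
    same : ∀ κ → Run 0 s μ κ → μ ≡ κ
    same κ (st , _) = total-tight μ κ (grows st) (≤-reflexive (size-eq st))
  pathCount-run v h eq (suc b) s μ g = begin
    pathCount (false ∷ replicate b false ++ v) s μ
      ≡⟨ pathCount-false (replicate b false ++ v) s μ ⟩
    Σℤ is (λ i → pathCount (replicate b false ++ v) (suc i) (inc i μ))
      ≡⟨ Σℤ-cong is (λ i i∈ → pathCount-run v h eq b (suc i) (inc i μ) (good-inc g (addable i∈))) ⟩
    Σℤ is (λ i → Σℤ (filter (run? b (suc i) (inc i μ)) states) h)
      ≡⟨ Σℤ-fibre (λ i → run? b (suc i) (inc i μ)) (run? (suc b) s μ)
           (Unique.filter⁺ (_<? s) (Unique.filter⁺ (addable? μ) (Unique.upTo⁺ r))) states h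
           (run-split b s μ)
           (λ i κ i∈ → run-join b s μ κ i g (proj₂ (∈.∈-filter⁻ (_<? s) {xs = candidates μ} i∈)) (addable i∈))
           (λ i j κ → run-first b s μ κ i j) ⟩
    Σℤ (filter (run? (suc b) s μ) states) h ∎
    where
    open ≡-Reasoning
    is = filter (_<? s) (candidates μ)
    addable : ∀ {i} → i ∈ is → Addable μ i
    addable i∈ = candidates⁻ μ (proj₁ (∈.∈-filter⁻ (_<? s) {xs = candidates μ} i∈))

  -- No descent is allowed between the letters `true` of `toWord β`, so a path consists of stretches
  -- whose lengths are the parts, each adding a strip. The initial `true` makes the result
  -- independent of `s`.
  pathCount-chains : ∀ {β} → All NonZero β → ∀ s μ → Good μ → pathCount (toWord β) s μ ≡ chains β μ
  pathCount-chains {[]} [] s μ g with Vec.≡-dec _≟_ μ top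
  ... | yes _ = refl
  ... | no _  = refl
  pathCount-chains {suc b ∷ β} (_ ∷ ps) s μ g = trans (pathCount-true-false (replicate b false ++ toWord β) s μ)
    (trans (pathCount-run (toWord β) (chains β) (pathCount-chains ps) (suc b) r μ g)
      (cong (λ κs → Σℤ κs (chains β)) (List.filter-≐ (run? (suc b) r μ) (strip? (suc b) μ)
        (proj₁ , λ {κ} st → st , λ i r≤i → trans (at-beyond κ r≤i) (sym (at-beyond μ r≤i))) states)))

  -- Exchanging adjacent strips μ ⊆ κ ⊆ ν: for given μ and ν, each row of κ
  -- ranges over an interval of its own, and reversing all of these intervals
  -- exchanges the two sizes.
  module Reflection (μ ν : State) where

    -- The two interlacing conditions bound row `i` of κ below by `μ` and the next row of `ν`, and
    -- above by `ν` and the previous row of `μ`.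
    low high : ℕ → ℕ
    low i  = at μ i ⊔ at ν (suc i)
    high zero    = at ν 0
    high (suc i) = at ν (suc i) ⊓ at μ i

    reflect : State → State
    reflect κ = tab r (λ i → low i + high i ∸ at κ i)

    high-≤ : ∀ i → high i ≤ at ν i
    high-≤ zero    = ≤-refl
    high-≤ (suc i) = m⊓n≤m (at ν (suc i)) (at μ i)

    at-reflect : ∀ κ i → at (reflect κ) i ≡ low i + high i ∸ at κ i
    at-reflect κ = at-tab r λ i r≤i → trans
      (cong (_∸ at κ i) (cong₂ _+_
        (cong₂ _⊔_ (at-beyond μ r≤i) (at-beyond ν (≤-trans r≤i (n≤1+n i))))
        (n≤0⇒n≡0 (≤-trans (high-≤ i) (≤-reflexive (at-beyond ν r≤i))))))
      (0∸n≡0 (at κ i))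

    module _ {a b κ} (s : Strip a μ κ) (t : Strip b κ ν) where

      low-≤ : ∀ i → low i ≤ at κ i
      low-≤ i = ⊔-lub (grows s i) (interlace t i)

      ≤-high : ∀ i → at κ i ≤ high i
      ≤-high zero    = grows t 0
      ≤-high (suc i) = ⊓-glb (grows t (suc i)) (interlace s i)

      low-≤-reflect : ∀ i → low i ≤ at (reflect κ) i
      low-≤-reflect i = ≤-trans (m+n≤o⇒m≤o∸n (low i) (+-monoʳ-≤ (low i) (≤-high i)))
        (≤-reflexive (sym (at-reflect κ i)))

      reflect-≤-high : ∀ i → at (reflect κ) i ≤ high i
      reflect-≤-high i = ≤-trans (≤-reflexive (at-reflect κ i))
        (≤-trans (∸-monoʳ-≤ (low i + high i) (low-≤ i)) (≤-reflexive (m+n∸m≡n (low i) (high i))))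

      reflect-involutive : reflect (reflect κ) ≡ κ
      reflect-involutive = at-ext λ i → trans (at-reflect (reflect κ) i)
        (trans (cong (low i + high i ∸_) (at-reflect κ i))
          (m∸[m∸n]≡n (≤-trans (≤-high i) (m≤n+m (high i) (low i)))))

      -- The lower end in row `i` and the upper end in row `suc i` are the maximum and minimum of
      -- the same two numbers, whose sum they preserve. The upper end in row 0 and the lower end in
      -- the last row remain.
      total-intervals : ∀ n → n ≡ r → Σ< n (λ i → low i + high i) ≡ Σ< n (at μ) + Σ< n (at ν)
      total-intervals zero    _    = refl
      total-intervals (suc n) n≡r = begin
        Σ< (suc n) (λ i → low i + high i)
          ≡⟨ Σ<-+ (suc n) low high ⟩
        Σ< (suc n) low + Σ< (suc n) high
          ≡⟨ cong (_+ Σ< (suc n) high) (Σ<-last n low) ⟩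
        (Σ< n low + low n) + (at ν 0 + Σ< n (high ∘ suc))
          ≡⟨ cong (λ x → (Σ< n low + x) + (at ν 0 + Σ< n (high ∘ suc))) last-low ⟩
        (Σ< n low + at μ n) + (at ν 0 + Σ< n (high ∘ suc))
          ≡⟨ rearrange (Σ< n low) (at μ n) (at ν 0) (Σ< n (high ∘ suc)) ⟩
        (Σ< n low + Σ< n (high ∘ suc)) + (at μ n + at ν 0)
          ≡⟨ cong (_+ (at μ n + at ν 0)) (trans (sym (Σ<-+ n low (high ∘ suc)))
               (trans (Σ<-cong n (λ i _ → ⊔+⊓ (at μ i) (at ν (suc i)))) (Σ<-+ n (at μ) (at ν ∘ suc)))) ⟩
        (Σ< n (at μ) + Σ< n (at ν ∘ suc)) + (at μ n + at ν 0)
          ≡⟨ rearrange′ (Σ< n (at μ)) (Σ< n (at ν ∘ suc)) (at μ n) (at ν 0) ⟩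
        (Σ< n (at μ) + at μ n) + Σ< (suc n) (at ν)
          ≡⟨ cong (_+ Σ< (suc n) (at ν)) (Σ<-last n (at μ)) ⟨
        Σ< (suc n) (at μ) + Σ< (suc n) (at ν) ∎
        where
        open ≡-Reasoning
        last-low : low n ≡ at μ n
        last-low = trans (cong (at μ n ⊔_) (at-beyond ν (≤-reflexive (sym n≡r)))) (⊔-identityʳ (at μ n))
        ⊔+⊓ : ∀ x y → (x ⊔ y) + (y ⊓ x) ≡ x + y
        ⊔+⊓ x y with ≤-total x y
        ... | inj₁ le = trans (cong₂ _+_ (m≤n⇒m⊔n≡n le) (m≥n⇒m⊓n≡n le)) (+-comm y x)
        ... | inj₂ ge = cong₂ _+_ (m≥n⇒m⊔n≡m ge) (m≤n⇒m⊓n≡m ge)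
        rearrange : ∀ w x y z → (w + x) + (y + z) ≡ (w + z) + (x + y)
        rearrange w x y z = trans (cong ((w + x) +_) (+-comm y z)) (+-interchange w x z y)
        rearrange′ : ∀ w x y z → (w + x) + (y + z) ≡ (w + y) + (z + x)
        rearrange′ w x y z = trans (+-interchange w x y z) (cong ((w + y) +_) (+-comm x z))

      total-reflect : total (reflect κ) + total κ ≡ total μ + total ν
      total-reflect = trans (sym (Σ<-+ r (at (reflect κ)) (at κ))) (trans
        (Σ<-cong r (λ i _ → trans (cong (_+ at κ i) (at-reflect κ i))
          (m∸n+n≡m (≤-trans (≤-high i) (m≤n+m (high i) (low i))))))
        (total-intervals r refl))

      total-reflect′ : total (reflect κ) ≡ b + total μ
      total-reflect′ = +-cancelʳ-≡ (total κ) _ _ (trans total-reflect (trans (cong (total μ +_) (size-eq t))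
        (trans (sym (+-assoc (total μ) b (total κ))) (cong (_+ total κ) (+-comm (total μ) b)))))

      reflect-strip₁ : Strip b μ (reflect κ)
      reflect-strip₁ = strip
        (λ i → ≤-trans (m≤m⊔n (at μ i) (at ν (suc i))) (low-≤-reflect i))
        (λ i → ≤-trans (reflect-≤-high (suc i)) (m⊓n≤n (at ν (suc i)) (at μ i)))
        (λ i → ≤-trans (reflect-≤-high i) (≤-trans (high-≤ i) (inside t i)))
        total-reflect′

      reflect-strip₂ : Strip a (reflect κ) ν
      reflect-strip₂ = strip
        (λ i → ≤-trans (reflect-≤-high i) (high-≤ i))
        (λ i → ≤-trans (m≤n⊔m (at μ i) (at ν (suc i))) (low-≤-reflect i))
        (inside t)
        (trans (size-eq t) (trans (cong (b +_) (size-eq s)) (trans (x+[y+z]≡y+[x+z] b a (total μ))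
          (cong (a +_) (sym total-reflect′)))))

  middle? : ∀ a b μ ν κ → Dec (Strip a μ κ × Strip b κ ν)
  middle? a b μ ν κ = strip? a μ κ ×-dec strip? b κ ν

  -- In terms of tableaux, `reflect` is the Bender-Knuth involution.
  middle-swap : ∀ a b μ ν (c : ℤ) →
    Σℤ (filter (middle? a b μ ν) states) (λ _ → c) ≡ Σℤ (filter (middle? b a μ ν) states) (λ _ → c)
  middle-swap a b μ ν c = Σℤ-bijection (λ κ κ′ → κ′ ≡ reflect κ)
    (Unique.filter⁺ (middle? a b μ ν) states-unique) (Unique.filter⁺ (middle? b a μ ν) states-unique)
    (λ κ κ∈ → let s , t = member a b κ∈ in reflect κ , image s t , refl)
    (λ κ κ∈ → let s , t = member b a κ∈ in reflect κ , image s t , sym (reflect-involutive s t))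
    (λ { _ _ _ refl refl → refl })
    (λ κ∈ κ′∈ _ eq eq′ → let s , t = member a b κ∈ ; s′ , t′ = member a b κ′∈ in
      trans (sym (reflect-involutive s t)) (trans (cong reflect (trans (sym eq) eq′)) (reflect-involutive s′ t′)))
    (λ _ _ _ → refl)
    where
    open Reflection μ ν
    member : ∀ a b {κ} → κ ∈ filter (middle? a b μ ν) states → Strip a μ κ × Strip b κ ν
    member a b κ∈ = proj₂ (∈.∈-filter⁻ (middle? a b μ ν) {xs = states} κ∈)
    image : ∀ {a b κ} → Strip a μ κ → Strip b κ ν → reflect κ ∈ filter (middle? b a μ ν) states
    image {a} {b} s t = ∈.∈-filter⁺ (middle? b a μ ν) (∈-states (inside (reflect-strip₁ s t)))
      (reflect-strip₁ s t , reflect-strip₂ s t)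

  -- Grouping by the end `ν` of the second strip leaves only the diagram in the middle to vary, so
  -- the two sizes can be exchanged.
  chains-middle : ∀ a b β μ → chains (a ∷ b ∷ β) μ ≡
    Σℤ states (λ ν → Σℤ (filter (middle? a b μ ν) states) (λ _ → chains β ν))
  chains-middle a b β μ = begin
    Σℤ (filter (strip? a μ) states) (λ κ → Σℤ (filter (strip? b κ) states) (chains β))
      ≡⟨ Σℤ-filter (strip? a μ) states _ ⟩
    Σℤ states (λ κ → 𝟙ℤ (does (strip? a μ κ)) ℤ.* Σℤ (filter (strip? b κ) states) (chains β))
      ≡⟨ Σℤ-cong states (λ κ _ → trans
           (cong (𝟙ℤ (does (strip? a μ κ)) ℤ.*_) (Σℤ-filter (strip? b κ) states (chains β)))
           (sym (Σℤ-* (𝟙ℤ (does (strip? a μ κ))) states _))) ⟩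
    Σℤ states (λ κ → Σℤ states (λ ν → 𝟙ℤ (does (strip? a μ κ)) ℤ.* (𝟙ℤ (does (strip? b κ ν)) ℤ.* chains β ν)))
      ≡⟨ Σℤ-swap states states _ ⟩
    Σℤ states (λ ν → Σℤ states (λ κ → 𝟙ℤ (does (strip? a μ κ)) ℤ.* (𝟙ℤ (does (strip? b κ ν)) ℤ.* chains β ν)))
      ≡⟨ Σℤ-cong states (λ ν _ → trans
           (Σℤ-cong states (λ κ _ → both (strip? a μ κ) (strip? b κ ν) (chains β ν)))
           (sym (Σℤ-filter (middle? a b μ ν) states (λ _ → chains β ν)))) ⟩
    Σℤ states (λ ν → Σℤ (filter (middle? a b μ ν) states) (λ _ → chains β ν)) ∎
    where
    open ≡-Reasoning
    both : ∀ {P Q : Set} (P? : Dec P) (Q? : Dec Q) c →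
      𝟙ℤ (does P?) ℤ.* (𝟙ℤ (does Q?) ℤ.* c) ≡ 𝟙ℤ (does (P? ×-dec Q?)) ℤ.* c
    both (yes _) Q? c = ℤ.*-identityˡ (𝟙ℤ (does Q?) ℤ.* c)
    both (no _)  Q? c = refl

  chains-↭ : ∀ {β γ} → β ↭ γ → ∀ μ → chains β μ ≡ chains γ μ
  chains-↭ ↭.refl μ = refl
  chains-↭ (↭.prep b p) μ = Σℤ-cong (filter (strip? b μ) states) (λ κ _ → chains-↭ p κ)
  chains-↭ (↭.swap {xs = β} {ys = γ} a b p) μ = begin
    chains (a ∷ b ∷ β) μ
      ≡⟨ chains-middle a b β μ ⟩
    Σℤ states (λ ν → Σℤ (filter (middle? a b μ ν) states) (λ _ → chains β ν))
      ≡⟨ Σℤ-cong states (λ ν _ → trans (middle-swap a b μ ν (chains β ν))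
           (Σℤ-cong (filter (middle? b a μ ν) states) (λ _ _ → chains-↭ p ν))) ⟩
    Σℤ states (λ ν → Σℤ (filter (middle? b a μ ν) states) (λ _ → chains γ ν))
      ≡⟨ chains-middle b a γ μ ⟨
    chains (b ∷ a ∷ γ) μ ∎
    where open ≡-Reasoning
  chains-↭ (↭.trans p q) μ = trans (chains-↭ p μ) (chains-↭ q μ)

  -- After any `j` horizontal strips at least `excessBeyond j 0 κ` boxes remain, and the parts of
  -- `β` after the first `j` must provide them.
  chains-≢0 : ∀ β {κ} → chains β κ ≢ 0ℤ → (∀ i → at κ i ≤ at top i) × (∀ j → excessBeyond j 0 κ ≤ sum (drop j β))
  chains-≢0 [] {κ} ne with Vec.≡-dec _≟_ κ top
  ... | no _     = contradiction refl ne
  ... | yes refl = (λ _ → ≤-refl) , (λ j → ≤-trans (≤-reflexive (excessBeyond-top j 0)) z≤n)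
  chains-≢0 (b ∷ β) {κ} ne = le , bound
    where
    found = Σℤ-≢0 (filter (strip? b κ) states) {chains β} ne
    κ′ = proj₁ found
    st : Strip b κ κ′
    st = proj₂ (∈.∈-filter⁻ (strip? b κ) {xs = states} (proj₁ (proj₂ found)))
    ih = chains-≢0 β (proj₂ (proj₂ found))
    le : ∀ i → at κ i ≤ at top i
    le i = ≤-trans (grows st i) (inside st i)
    bound : ∀ j → excessBeyond j 0 κ ≤ sum (drop j (b ∷ β))
    bound (suc j) = ≤-trans (excessBeyond-row j 0 κ κ′ (interlace st)) (proj₂ ih j)
    bound zero    = +-cancelʳ-≤ (total κ) _ _ (begin
      excessBeyond 0 0 κ + total κ      ≡⟨ trans (excessBeyond-total κ le) (sym (excessBeyond-total κ′ (proj₁ ih))) ⟩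
      excessBeyond 0 0 κ′ + total κ′    ≤⟨ +-mono-≤ (proj₂ ih 0) (≤-reflexive (size-eq st)) ⟩
      sum β + (b + total κ)             ≡⟨ +-assoc (sum β) b (total κ) ⟨
      (sum β + b) + total κ             ≡⟨ cong (_+ total κ) (+-comm (sum β) b) ⟩
      sum (b ∷ β) + total κ             ∎)
      where open ≤-Reasoning

  -- Equality forces each strip to have the size of the largest one; it is then contained in
  -- `fillRows κ` and equal to it, so there is a single chain.
  chains-≡1 : ∀ β {κ} → Good κ → (∀ j → excessBeyond j 0 κ ≡ sum (drop j β)) → chains β κ ≡ 1ℤ
  chains-≡1 [] {κ} g eq = cong 𝟙ℤ (dec-true (Vec.≡-dec _≟_ κ top) (total-tight κ top (below g)
    (≤-reflexive (trans (sym (excessBeyond-total κ (below g))) (cong (_+ total κ) (eq 0))))))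
  chains-≡1 (b ∷ β) {κ} g eq = trans
    (Σℤ-single (Unique.filter⁺ (strip? b κ) states-unique)
      (∈.∈-filter⁺ (strip? b κ) (∈-states (below g′)) filled-strip)
      (λ κ′ κ′∈ ne → contradiction (only κ′ (proj₂ (∈.∈-filter⁻ (strip? b κ) {xs = states} κ′∈))) ne))
    (chains-≡1 β g′ eq′)
    where
    g′ = good-fillRows g
    eq′ : ∀ j → excessBeyond j 0 (fillRows κ) ≡ sum (drop j β)
    eq′ j = trans (≤-antisym (excessBeyond-fillRows j 0 κ) (excessBeyond-row j 0 κ (fillRows κ)
      (λ i → ≤-trans (≤-reflexive (at-fillRows κ (suc i))) (m⊓n≤m (at κ i) (at top (suc i)))))) (eq (suc j))
    filled-total : total (fillRows κ) ≡ b + total κ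
    filled-total = +-cancelˡ-≡ (sum β) _ _ (begin
      sum β + total (fillRows κ)                            ≡⟨ cong (_+ total (fillRows κ)) (eq′ 0) ⟨
      excessBeyond 0 0 (fillRows κ) + total (fillRows κ)    ≡⟨ excessBeyond-total (fillRows κ) (below g′) ⟩
      total top                                             ≡⟨ excessBeyond-total κ (below g) ⟨
      excessBeyond 0 0 κ + total κ                          ≡⟨ cong (_+ total κ) (trans (eq 0) (+-comm b (sum β))) ⟩
      (sum β + b) + total κ                                 ≡⟨ +-assoc (sum β) b (total κ) ⟩
      sum β + (b + total κ)                                 ∎)
      where open ≡-Reasoning
    filled-strip : Strip b κ (fillRows κ)
    filled-strip = strip (≤-fillRows g)
      (λ i → ≤-trans (≤-reflexive (at-fillRows κ (suc i))) (m⊓n≤m (at κ i) (at top (suc i)))) (below g′) filled-total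
    only : ∀ κ′ → Strip b κ κ′ → κ′ ≡ fillRows κ
    only κ′ st = total-tight κ′ (fillRows κ) le (≤-reflexive (trans filled-total (sym (size-eq st))))
      where
      le : ∀ i → at κ′ i ≤ at (fillRows κ) i
      le zero    = ≤-trans (⊓-glb (inside st 0) (inside st 0)) (≤-reflexive (sym (at-fillRows κ 0)))
      le (suc i) = ≤-trans (⊓-glb (interlace st i) (inside st (suc i))) (≤-reflexive (sym (at-fillRows κ (suc i))))

-- The Schur expansion of a skew Schur function

length-toWord : ∀ {as} → All NonZero as → length (toWord as) ≡ sum as
length-toWord {[]}         []       = refl
length-toWord {suc a ∷ as} (_ ∷ ps) = cong suc (trans (List.length-++ (replicate a false))
  (cong₂ _+_ (List.length-replicate a) (length-toWord ps)))

≤⁺-length : ∀ u w → length u ≢ length w → u ≤⁺ w ≡ false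
≤⁺-length []      []      ne = contradiction refl ne
≤⁺-length []      (_ ∷ w) ne = refl
≤⁺-length (_ ∷ u) []      ne = refl
≤⁺-length (_ ∷ u) (_ ∷ w) ne = go u w (ne ∘ cong suc)
  where
  go : ∀ u w → length u ≢ length w → u ≤ʷ w ≡ false
  go []          []          ne = contradiction refl ne
  go []          (_ ∷ w)     ne = refl
  go (_ ∷ u)     []          ne = refl
  go (false ∷ u) (_ ∷ w)     ne = go u w (ne ∘ cong suc)
  go (true ∷ u)  (true ∷ w)  ne = go u w (ne ∘ cong suc)
  go (true ∷ u)  (false ∷ w) ne = refl

F-nonZero : ∀ α e → F α e ≡ F α (filter nonZero? e)
F-nonZero α e = cong (λ e′ → Σℤ (filter (λ β → _⊆?_ _≟_ (S α) (S β)) (compositions ∣ α ∣))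
    (λ β → 𝟙ℤ (does (List.≡-dec _≟_ e′ (parts β)))))
  (sym (List.filter-idem nonZero? e))

module _ (A : SkewShape) where
  open Tableaux A
  open Chains top top-suc-≤

  skewSchur-nonZero : ∀ e → skewSchur A e ≡ skewSchur A (filter nonZero? e)
  skewSchur-nonZero e = Σℤ-cong (SYTs A) (λ T _ → F-nonZero (comp A T) e)

  skewSchur-words : ∀ α → skewSchur A (parts α) ≡
    Σℤ (paths (size A) bottom) (λ p → 𝟙ℤ (descentWord p ≤⁺ toWord (parts α)))
  skewSchur-words α = trans (skewSchur-paths (parts α)) (Σℤ-cong (paths (size A) bottom) λ p _ →
    trans (cong (λ e → F (fromWord (descentWord p)) e) (sym (fromWord-toWord (nonZeroParts α))))
      (F-fromWord (descentWord p) (toWord (parts α))))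

  skewSchur-degree : ∀ α → ∣ α ∣ ≢ size A → skewSchur A (parts α) ≡ 0ℤ
  skewSchur-degree α ne = trans (skewSchur-words α) (Σℤ-zero (paths (size A) bottom) λ p p∈ →
    cong 𝟙ℤ (≤⁺-length (descentWord p) (toWord (parts α)) λ eq → ne
      (trans (sym (length-toWord (nonZeroParts α)))
        (trans (sym eq) (trans (length-descentWord p) (proj₂ (∈-paths⁻ (size A) bottom p∈)))))))

  skewSchur-chains : ∀ α → ∣ α ∣ ≡ size A → skewSchur A (parts α) ≡ chains (parts α) bottom
  skewSchur-chains α eq = trans (skewSchur-words α) (trans
    (cong (λ n → Σℤ (paths n bottom) (λ p → 𝟙ℤ (descentWord p ≤⁺ w)))
      (trans (sym eq) (sym (length-toWord (nonZeroParts α)))))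
    (trans (Σℤ-cong (paths (length w) bottom) (λ p p∈ → cong 𝟙ℤ (start w (proj₁ (∈-paths⁻ (length w) bottom p∈)))))
      (pathCount-chains (nonZeroParts α) (#rows A) bottom good-bottom)))
    where
    w = toWord (parts α)
    -- `≤⁺` skips the first letter. The threshold `#rows A` makes that letter `false`, which is
    -- below both letters, so `≤ʷ` gives the same answer.
    start : ∀ w {κ p} → Path κ p → descentWord p ≤⁺ w ≡ descents (#rows A) p ≤ʷ w
    start []      done = refl
    start (_ ∷ w) done = refl
    start []      (step _ _) = refl
    start (a ∷ w) {κ} {i ∷ p} (step add _) = sym (cong (λ b → (b ∷ descents (suc i) p) ≤ʷ (a ∷ w))
      (dec-false (#rows A ≤? i) (<⇒≱ (addable-row κ add))))

  skewSchur-↭ : ∀ {α β} → parts α ↭ parts β → skewSchur A (parts α) ≡ skewSchur A (parts β)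
  skewSchur-↭ {α} {β} p = decide (∣ α ∣ ≟ size A)
    where
    decide : Dec (∣ α ∣ ≡ size A) → skewSchur A (parts α) ≡ skewSchur A (parts β)
    decide (yes eq) = trans (skewSchur-chains α eq)
      (trans (chains-↭ p bottom) (sym (skewSchur-chains β (trans (sym (Sum.sum-↭ p)) eq))))
    decide (no ne)  = trans (skewSchur-degree α ne)
      (sym (skewSchur-degree β (λ eq → ne (trans (Sum.sum-↭ p) eq))))

  -- By symmetry a skew Schur function is determined by its values at partitions, so linear
  -- relations need checking only there.
  skewSchur-sorted : ∀ e → skewSchur A e ≡ skewSchur A (sortedParts e)
  skewSchur-sorted e = trans (skewSchur-nonZero e)
    (skewSchur-↭ {mkComposition (filter nonZero? e) (All.all-filter nonZero? e)} {composition (sortedNonZero e)}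
      (↭-sym (↭.filter-↭ nonZero? (sort-↭ ≥-decTotalOrder e))))

size-straight : ∀ λ′ → size (λ′ /∅) ≡ sum (rows-of λ′)
size-straight λ′ = trans (size-formula (λ′ /∅)) (trans (Σ<-entry 0 (rows-of λ′)) (excess-0 (rows-of λ′)))

module _ (λ′ : Partition) where
  open Tableaux (λ′ /∅)
  open Chains top top-suc-≤

  excessBeyond-straight : ∀ j → excessBeyond j 0 bottom ≡ sum (drop j (rows-of λ′))
  excessBeyond-straight j = trans (excessBeyond-rects (λ′ /∅) j 0)
    (trans (rects-straight λ′ j 0) (excess-0 (drop j (rows-of λ′))))

  schur-diagonal : schur λ′ (rows-of λ′) ≡ 1ℤ
  schur-diagonal = trans (skewSchur-chains (λ′ /∅) (composition λ′) (sym (size-straight λ′)))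
    (chains-≡1 (rows-of λ′) good-bottom excessBeyond-straight)

  -- The Kostka number vanishes unless `λ′` dominates `μ′`; dominance appears here through tail
  -- sums, which reverses the inequality.
  schur-dominance : ∀ μ′ → schur λ′ (rows-of μ′) ≢ 0ℤ → ∀ j → sum (drop j (rows-of λ′)) ≤ sum (drop j (rows-of μ′))
  schur-dominance μ′ ne = decide (sum (rows-of μ′) ≟ size (λ′ /∅))
    where
    decide : Dec (sum (rows-of μ′) ≡ size (λ′ /∅)) → ∀ j → sum (drop j (rows-of λ′)) ≤ sum (drop j (rows-of μ′))
    decide (no wrong) j = contradiction (skewSchur-degree (λ′ /∅) (composition μ′) wrong) ne
    decide (yes eq)   j = ≤-trans (≤-reflexive (sym (excessBeyond-straight j)))
      (proj₂ (chains-≢0 (rows-of μ′) (λ eq₀ → ne (trans (skewSchur-chains (λ′ /∅) (composition μ′) eq) eq₀))) j)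

-- Forward substitution: the equation at the first index `p` contains only the unknown of `p`, so
-- its solution is `g p`. Its contribution is subtracted before the remaining equations are solved.
solve-unitriangular : {I : Set} → ((i j : I) → Dec (i ≡ j)) → (K : I → I → ℤ) → (∀ i → K i i ≡ 1ℤ) →
  ∀ {is} → Unique is → AllPairs (λ i j → K j i ≡ 0ℤ) is → (g : I → ℤ) →
  Σ[ c ∈ (I → ℤ) ] (∀ i → c i ≢ 0ℤ → i ∈ is) × (∀ j → j ∈ is → g j ≡ Σℤ is (λ i → c i ℤ.* K i j))
solve-unitriangular _≟ᴵ_ K diag {[]}     []        []        g = (λ _ → 0ℤ) , (λ _ ne → contradiction refl ne) , λ _ ()
solve-unitriangular {I} _≟ᴵ_ K diag {p ∷ is} (p∉ ∷ u) (k ∷ ks) g = c , vanishing , solution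
  where
  rest = solve-unitriangular _≟ᴵ_ K diag u ks (λ j → g j ℤ.- g p ℤ.* K p j)
  c′ = proj₁ rest
  c : I → ℤ
  c i = if does (i ≟ᴵ p) then g p else c′ i
  c-p : c p ≡ g p
  c-p = cong (if_then g p else c′ p) (dec-true (p ≟ᴵ p) refl)
  c-≢ : ∀ {i} → i ≢ p → c i ≡ c′ i
  c-≢ {i} ne = cong (if_then g p else c′ i) (dec-false (i ≟ᴵ p) ne)
  vanishing : ∀ i → c i ≢ 0ℤ → i ∈ p ∷ is
  vanishing i ne with i ≟ᴵ p
  ... | yes refl = here refl
  ... | no _     = there (proj₁ (proj₂ rest) i ne)
  tail : ∀ j → Σℤ is (λ i → c i ℤ.* K i j) ≡ Σℤ is (λ i → c′ i ℤ.* K i j)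
  tail j = Σℤ-cong is (λ i i∈ → cong (ℤ._* K i j) (c-≢ (λ i≡p → All.lookup p∉ i∈ (sym i≡p))))
  cancel : ∀ x y → x ≡ y ℤ.+ (x ℤ.- y)
  cancel = solve-∀
  solution : ∀ j → j ∈ p ∷ is → g j ≡ Σℤ (p ∷ is) (λ i → c i ℤ.* K i j)
  solution j (here refl) = sym (trans
    (cong₂ ℤ._+_ (cong₂ ℤ._*_ c-p (diag p))
      (Σℤ-zero is (λ i i∈ → trans (cong (c i ℤ.*_) (All.lookup k i∈)) (ℤ.*-zeroʳ (c i)))))
    (trans (ℤ.+-identityʳ _) (ℤ.*-identityʳ (g p))))
  solution j (there j∈) = sym (trans
    (cong₂ ℤ._+_ (cong (ℤ._* K p j) c-p) (trans (tail j) (sym (proj₂ (proj₂ rest) j j∈))))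
    (sym (cancel (g j) (g p ℤ.* K p j))))

∈-compositions : ∀ α → α ∈ compositions ∣ α ∣
∈-compositions α = subst (λ n → α ∈ compositions n) (length-toWord (nonZeroParts α))
  (subst (_∈ compositions (length w)) (composition-word α) (member w))
  where
  w = toWord (parts α)
  member : ∀ w → fromWord w ∈ compositions (length w)
  member []      = here refl
  member (_ ∷ v) = subst (fromLetters v ∈_) (sym (compositions-words (length v))) (∈.∈-map⁺ fromLetters (∈-words v))

compositions-size : ∀ n {α} → α ∈ compositions n → ∣ α ∣ ≡ n
compositions-size zero    (here refl) = refl
compositions-size (suc n) {α} α∈ with ∈.∈-map⁻ fromLetters (subst (α ∈_) (compositions-words n) α∈)
... | v , v∈ , refl = trans (size-fromLetters v) (cong suc (words-length n v∈))

sortedNonZero-rows : ∀ λ′ → sortedNonZero (rows-of λ′) ≡ λ′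
sortedNonZero-rows λ′ = partition-excess-≡ λ m → excess-sortedNonZero m (rows-of λ′)

sum-sortedParts : ∀ as → sum (sortedParts as) ≡ sum as
sum-sortedParts as = trans (sym (excess-0 (sortedParts as))) (trans (excess-sortedNonZero 0 as) (excess-0 as))

length-≤-sum : ∀ {as} → All NonZero as → length as ≤ sum as
length-≤-sum {[]}         []       = z≤n
length-≤-sum {suc a ∷ as} (_ ∷ ps) = s≤s (≤-trans (length-≤-sum ps) (m≤n+m (sum as) a))

module Partitions (n : ℕ) where
  open import Data.List.Relation.Unary.Unique.DecPropositional.Properties _≟ᵖ_ using (deduplicate-!)

  -- Monotone for the reverse of the dominance order.
  key : Partition → ℕ
  key λ′ = Σ< (suc n) (λ j → sum (drop j (rows-of λ′)))

  byKey = onDecTotalOrder ≤-decTotalOrder key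

  unsorted : List Partition
  unsorted = deduplicate _≟ᵖ_ (map (sortedNonZero ∘ parts) (compositions n))

  partitions : List Partition
  partitions = sort byKey unsorted

  partitions-unique : Unique partitions
  partitions-unique = Unique-resp-↭ (↭-sym (sort-↭ byKey unsorted))
    (deduplicate-! (map (sortedNonZero ∘ parts) (compositions n)))

  ∈-partitions : ∀ λ′ → sum (rows-of λ′) ≡ n → λ′ ∈ partitions
  ∈-partitions λ′ refl = ↭.∈-resp-↭ (↭-sym (sort-↭ byKey unsorted)) (∈.∈-deduplicate⁺ _≟ᵖ_
    (subst (_∈ map (sortedNonZero ∘ parts) (compositions n)) (sortedNonZero-rows λ′)
      (∈.∈-map⁺ (sortedNonZero ∘ parts) (∈-compositions (composition λ′)))))

  partitions-size : ∀ {λ′} → λ′ ∈ partitions → sum (rows-of λ′) ≡ n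
  partitions-size λ∈ = let
      α , α∈ , eq = ∈.∈-map⁻ (sortedNonZero ∘ parts) (∈.∈-deduplicate⁻ _≟ᵖ_
        (map (sortedNonZero ∘ parts) (compositions n)) (↭.∈-resp-↭ (sort-↭ byKey unsorted) λ∈))
    in trans (cong (sum ∘ rows-of) eq) (trans (sum-sortedParts (parts α)) (compositions-size n α∈))

  key-tight : ∀ λ′ μ′ → sum (rows-of λ′) ≡ n → sum (rows-of μ′) ≡ n →
    (∀ j → sum (drop j (rows-of λ′)) ≤ sum (drop j (rows-of μ′))) → key μ′ ≤ key λ′ → λ′ ≡ μ′
  key-tight λ′ μ′ sizeλ sizeμ le ge = partition-≡ (drop-sums-injective n
    (nonZeroParts (composition λ′)) (nonZeroParts (composition μ′))
    (trans (short λ′ sizeλ) (sym (short μ′ sizeμ)))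
    (λ j j≤n → Σ<-tight (suc n) (λ j _ → le j) ge j (s≤s j≤n)))
    where
    short : ∀ ν → sum (rows-of ν) ≡ n → drop n (rows-of ν) ≡ []
    short ν eq = List.drop-all n (rows-of ν) (≤-trans (length-≤-sum (nonZeroParts (composition ν))) (≤-reflexive eq))

  -- A nonzero value would give `key μ′ ≤ key λ′` by dominance, while the sorting gives the
  -- converse. By `key-tight` the two partitions would be equal, so ties in the key do no harm.
  partitions-triangular : AllPairs (λ λ′ μ′ → schur μ′ (rows-of λ′) ≡ 0ℤ) partitions
  partitions-triangular = go partitions partitions-size partitions-unique
    (Linked.Linked⇒AllPairs ≤-trans (sort-↗ byKey unsorted))
    where
    go : ∀ λs → (∀ {λ′} → λ′ ∈ λs → sum (rows-of λ′) ≡ n) → Unique λs →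
      AllPairs (λ λ′ μ′ → key λ′ ≤ key μ′) λs → AllPairs (λ λ′ μ′ → schur μ′ (rows-of λ′) ≡ 0ℤ) λs
    go []        sizes []       []       = []
    go (λ′ ∷ λs) sizes (λ∉ ∷ u) (k ∷ ks) = All.tabulate (λ {μ′} μ∈ → decidable-stable (_ ℤ.≟ 0ℤ) (λ ne →
        All.lookup λ∉ μ∈ (sym (key-tight μ′ λ′ (sizes (there μ∈)) (sizes (here refl))
          (schur-dominance μ′ λ′ ne) (All.lookup k μ∈)))))
      ∷ go λs (sizes ∘ there) u ks

-- The coefficients solve the system at the partitions of `size A`. Sorting the exponents carries
-- the identity to all monomials of that degree; in other degrees both sides are zero.
schur-expansion : ∀ A → Expansion schur (skewSchur A)
schur-expansion A = expand (solve-unitriangular _≟ᵖ_ (λ μ′ ν → schur μ′ (rows-of ν)) schur-diagonal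
  partitions-unique partitions-triangular (λ ν → skewSchur A (rows-of ν)))
  where
  open Partitions (size A)
  expand : (Σ[ c ∈ (Partition → ℤ) ] (∀ μ′ → c μ′ ≢ 0ℤ → μ′ ∈ partitions)
      × (∀ ν → ν ∈ partitions → skewSchur A (rows-of ν) ≡ Σℤ partitions (λ μ′ → c μ′ ℤ.* schur μ′ (rows-of ν)))) →
    Expansion schur (skewSchur A)
  expand (c , vanishing , solution) = record
    { coeff       = c
    ; support     = partitions
    ; unique      = partitions-unique
    ; vanishing   = vanishing
    ; combination = λ e → trans (skewSchur-sorted A e) (trans
        (at-partition (sortedNonZero e) (sum (rows-of (sortedNonZero e)) ≟ size A))
        (Σℤ-cong partitions (λ μ′ _ → cong (c μ′ ℤ.*_) (sym (skewSchur-sorted (μ′ /∅) e)))))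
    }
    where
    at-partition : ∀ ν → Dec (sum (rows-of ν) ≡ size A) →
      skewSchur A (rows-of ν) ≡ Σℤ partitions (λ μ′ → c μ′ ℤ.* schur μ′ (rows-of ν))
    at-partition ν (yes eq) = solution ν (∈-partitions ν eq)
    at-partition ν (no ne)  = trans (skewSchur-degree A (composition ν) ne)
      (sym (Σℤ-zero partitions {λ μ′ → c μ′ ℤ.* schur μ′ (rows-of ν)} λ μ′ μ∈ → trans
        (cong (c μ′ ℤ.*_) (skewSchur-degree (μ′ /∅) (composition ν)
          (λ eq → ne (trans eq (trans (size-straight μ′) (partitions-size μ∈))))))
        (ℤ.*-zeroʳ (c μ′))))

supp-s-≐⇒sameRects : ∀ A B → supp-s A ≐ supp-s B → SameRects A B
supp-s-≐⇒sameRects A B (A⊆B , B⊆A) = sameRects A B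
  (supp-s-⊆⇒rects-≥ A B (schur-expansion A) A⊆B) (supp-s-⊆⇒rects-≥ B A (schur-expansion B) B⊆A)

corollary4p3 : (A B : SkewShape) →
    ((SameRows A B ⇔ SameCols A B) × (SameCols A B ⇔ SameRects A B))
    × (skewSchur A ≗ skewSchur B ⊎ (supp-s A ≐ supp-s B) ⊎ (supp-F A ≐ supp-F B) →
    SameRows A B × SameCols A B × SameRects A B)
corollary4p3 A B =
    ( mk⇔ (Cols.from ∘ Rows.to) (Rows.from ∘ Cols.to) , sameCols⇔sameRects A B)
  , λ same → let rects≡ = [ skewSchur-≗⇒sameRects A B
                          , [ supp-s-≐⇒sameRects A B , supp-F-≐⇒sameRects A B ]′ ]′ same
             in Rows.from rects≡ , Cols.from rects≡ , rects≡
  where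
  module Rows = Equivalence (sameRows⇔sameRects A B)
  module Cols = Equivalence (sameCols⇔sameRects A B)
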